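{- Let $n,m,b\in\mathbb{Z}$ with $n\ge 3$, $|m|\ge 2$ and $b\ge 2$. Assume that $\gcd(b,m)=1$ and that $b$ is squarefree. Let $$\mathcal{D}:=\frac{n^n(1-bm^{2n})^{n+1}+bm^{2n}(n+1)^{n+1}}{(1+bm^{2n}n)^2}\in\mathbb{Z},$$ and assume that $$d:=\frac{|\mathcal{D}|}{\prod_{p\text{ prime},\ p\mid bm}p^{\nu_p(\mathcal{D})}}$$ is squarefree. If $\gcd(n,m)=1$, then the polynomial $$\mathcal{F}_{n,b,m,1}(x)=x^n+b\sum_{j=1}^{n}(m^2x)^{n-j}$$ is monogenic.
   Context: A monic polynomial $f(x)\in\mathbb{Z}[x]$ is called monogenic if $f(x)$ is irreducible over $\mathbb{Q}$ and $\{1,\theta,\theta^2,\ldots,\theta^{\deg(f)-1}\}$ is a basis (over $\mathbb{Z}$) for the ring of integers of $\mathbb{Q}(\theta)$, where $f(\theta)=0$. Here $\nu_p(z)$ denotes the $p$-adic valuation of the integer $z$. The quantity $\mathcal{D}$ is always an integer. In the sum, the term $j=n$ is $(m^2x)^0=1$. -}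

module Defs where

open import Level using (Level; _⊔_; 0ℓ)
open import Algebra.Bundles.Raw using (RawRing)
import Algebra.Definitions.RawSemiring as SemiringDefs
open import Data.Nat.Base as ℕ using (ℕ; zero; suc; NonZero)
import Data.Nat.Properties as ℕ
import Data.Nat.Divisibility as ℕ
open import Data.Nat.Primality using (Prime; prime?; prime⇒nonZero)
open import Data.Nat.ListAction using (product)
open import Data.Nat.ListAction.Properties using (product≢0)
open import Data.Integer.Base as ℤ using (ℤ; +_; 1ℤ; ∣_∣; _^_)
import Data.Integer.Properties as ℤ
open import Data.Integer.Divisibility.Signed using (_∣_; divides; quotient)
open import Data.Integer.Tactic.RingSolver using (solve-∀)
open import Data.Rational.Base as ℚ using (ℚ)
open import Data.List.Base using (List; []; _∷_; map; filter; upTo)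
open import Data.List.Relation.Unary.All as All using (All)
open import Data.List.Relation.Unary.All.Properties using (map⁺; all-filter)
open import Data.Fin.Base using (Fin; toℕ)
open import Data.Product.Base using (_×_; _,_; proj₁; ∃-syntax)
open import Relation.Nullary.Decidable.Core using (yes; no; _×-dec_)
open import Relation.Binary.PropositionalEquality
  using (_≡_; refl; sym; trans; cong; cong₂; module ≡-Reasoning)

private variable
  c ℓ c′ ℓ′ : Level

------------------------------------------------------------------------
-- Polynomials

-- R[x], with polynomials given by their coefficient lists, constant term
-- first.  Trailing zeros are allowed, so equality compares coefficients
-- rather than lists.

module Polynomial (R : RawRing c ℓ) where
  open RawRing R

  Poly : Set c
  Poly = List Carrier

  coeff : Poly → ℕ → Carrier
  coeff []      _       = 0#
  coeff (a ∷ _) zero    = a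
  coeff (_ ∷ p) (suc i) = coeff p i

  _+ₚ_ : Poly → Poly → Poly
  []      +ₚ q       = q
  (a ∷ p) +ₚ []      = a ∷ p
  (a ∷ p) +ₚ (b ∷ q) = (a + b) ∷ (p +ₚ q)

  _*ₚ_ : Poly → Poly → Poly
  []      *ₚ q = []
  (a ∷ p) *ₚ q = map (a *_) q +ₚ (0# ∷ (p *ₚ q))

  const : Carrier → Poly
  const a = a ∷ []

  X : Poly
  X = 0# ∷ 1# ∷ []

  IsMonicOfDegree : ℕ → Poly → Set ℓ
  IsMonicOfDegree n p = coeff p n ≈ 1# × (∀ i → n ℕ.< i → coeff p i ≈ 0#)

  polyRing : RawRing c ℓ
  polyRing = record
    { Carrier = Poly
    ; _≈_     = λ p q → ∀ i → coeff p i ≈ coeff q i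
    ; _+_     = _+ₚ_
    ; _*_     = _*ₚ_
    ; -_      = map (-_)
    ; 0#      = []
    ; 1#      = const 1#
    }

-- p(α) for α in a ring S, the coefficients being sent to S by φ.

eval : (R : RawRing c ℓ) (S : RawRing c′ ℓ′) →
       (RawRing.Carrier R → RawRing.Carrier S) →
       Polynomial.Poly R → RawRing.Carrier S → RawRing.Carrier S
eval R S φ []      α = RawRing.0# S
eval R S φ (a ∷ p) α = φ a + α * eval R S φ p α
  where open RawRing S

-- R/(f) for a commutative ring R: the elements are those of R, taken
-- modulo f.

_/⟨_⟩ : (R : RawRing c ℓ) → RawRing.Carrier R → RawRing c (c ⊔ ℓ)
R /⟨ f ⟩ = record
  { Carrier = Carrier
  ; _≈_     = λ x y → f ∣ᴿ (x + (- y))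
  ; _+_     = _+_
  ; _*_     = _*_
  ; -_      = -_
  ; 0#      = 0#
  ; 1#      = 1#
  }
  where
  open RawRing R
  open SemiringDefs rawSemiring using () renaming (_∣_ to _∣ᴿ_)

module ℤ[x] = Polynomial ℤ.+-*-rawRing
module ℚ[x] = Polynomial ℚ.+-*-rawRing

toℚ[x] : ℤ[x].Poly → ℚ[x].Poly
toℚ[x] = map (ℚ._/ 1)

IrreducibleOverℚ : ℤ[x].Poly → Set
IrreducibleOverℚ f = SemiringDefs.Irreducible (RawRing.rawSemiring ℚ[x].polyRing) (toℚ[x] f)

------------------------------------------------------------------------
-- Monogenic polynomials

-- For f irreducible over ℚ, ℚ(θ) with f(θ) = 0 is ℚ[x]/(f), θ being the
-- class of x.

module NumberField (f : ℤ[x].Poly) where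

  ℚ⟨θ⟩ : RawRing 0ℓ 0ℓ
  ℚ⟨θ⟩ = ℚ[x].polyRing /⟨ toℚ[x] f ⟩

  open RawRing ℚ⟨θ⟩ public
  open SemiringDefs rawSemiring public using (sum) renaming (_^_ to _^ᴷ_)

  θ : Carrier
  θ = ℚ[x].X

  fromℤ : ℤ → Carrier
  fromℤ a = ℚ[x].const (a ℚ./ 1)

  -- Membership in the ring of integers.
  IsIntegral : Carrier → Set
  IsIntegral α = ∃[ g ] (∃[ k ] ℤ[x].IsMonicOfDegree k g)
                      × eval ℤ.+-*-rawRing ℚ⟨θ⟩ fromℤ g α ≈ 0#

  ℤ-combination : ∀ {n} → (Fin n → ℤ) → (Fin n → Carrier) → Carrier
  ℤ-combination a v = sum (λ i → fromℤ (a i) * v i)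

  record IsIntegralBasis {n : ℕ} (v : Fin n → Carrier) : Set where
    field
      integral    : ∀ i → IsIntegral (v i)
      spanning    : ∀ α → IsIntegral α → ∃[ a ] α ≈ ℤ-combination a v
      independent : ∀ a → ℤ-combination a v ≈ 0# → ∀ i → a i ≡ + 0

record Monogenic (f : ℤ[x].Poly) : Set where
  open NumberField f
  field
    degree      : ℕ
    monic       : ℤ[x].IsMonicOfDegree degree f
    irreducible : IrreducibleOverℚ f
    powerBasis  : IsIntegralBasis {degree} (λ i → θ ^ᴷ toℕ i)

------------------------------------------------------------------------
-- Squarefreeness and valuations

Squarefree : ℕ → Set
Squarefree n = ∀ k → (k ℕ.* k) ℕ.∣ n → k ≡ 1

-- largestPower p z k is the largest i ≤ k with pⁱ ∣ z.

largestPower : ℕ → ℕ → ℕ → ℕ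
largestPower p z zero    = 0
largestPower p z (suc k) with (p ℕ.^ suc k) ℕ.∣? z
... | yes _ = suc k
... | no  _ = largestPower p z k

-- The p-adic valuation of z, for p ≥ 2 and z ≠ 0: since i < pⁱ, no exponent
-- beyond ∣ z ∣ can occur.  (Junk value ν p 0 = 0.)

ν : ℕ → ℤ → ℕ
ν p z = largestPower p ∣ z ∣ ∣ z ∣

-- For a ≠ 0.

primeDivisors : ℤ → List ℕ
primeDivisors a = filter (λ p → prime? p ×-dec (p ℕ.∣? ∣ a ∣)) (upTo (suc ∣ a ∣))

-- ∏ p^{ν_p(z)} over the primes p dividing a.

partAt : ℤ → ℤ → ℕ
partAt a z = product (map (λ p → p ℕ.^ ν p z) (primeDivisors a))

partAt-nonZero : ∀ a z → NonZero (partAt a z)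
partAt-nonZero a z = product≢0 (map⁺ (All.map (λ {p} → power≢0 {p})
  (all-filter (λ p → prime? p ×-dec (p ℕ.∣? ∣ a ∣)) (upTo (suc ∣ a ∣)))))
  where
  power≢0 : ∀ {p} → Prime p × p ℕ.∣ ∣ a ∣ → NonZero (p ℕ.^ ν p z)
  power≢0 {p} (p-prime , _) = ℕ.m^n≢0 p (ν p z) {{prime⇒nonZero p-prime}}

------------------------------------------------------------------------
-- The polynomial ℱ and the quantities 𝒟 and d

module _ (n : ℕ) (m b : ℤ) where

  -- The index i runs from 0, so that j = i + 1 runs from 1 to n.
  ℱ : ℤ[x].Poly
  ℱ = X ^ₚ n + const b * sum {n} (λ i → (const (m ^ 2) * X) ^ₚ (n ℕ.∸ suc (toℕ i)))
    where
    open RawRing ℤ[x].polyRing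
    open SemiringDefs rawSemiring using (sum) renaming (_^_ to _^ₚ_)
    open ℤ[x] using (X; const)

  open import Data.Integer.Base using (_+_; _*_; _-_)

  𝒟-numerator : ℤ
  𝒟-numerator = (+ n) ^ n * (1ℤ - b * m ^ (2 ℕ.* n)) ^ suc n
              + b * m ^ (2 ℕ.* n) * (+ n + 1ℤ) ^ suc n

  𝒟-denominator : ℤ
  𝒟-denominator = (1ℤ + b * m ^ (2 ℕ.* n) * + n) ^ 2

private
  open import Data.Integer.Base using (_+_; _*_; _-_; -_)

  ^-distrib-* : ∀ x y k → (x * y) ^ k ≡ x ^ k * y ^ k
  ^-distrib-* x y zero    = refl
  ^-distrib-* x y (suc k) =
    trans (cong (x * y *_) (^-distrib-* x y k)) (lemma x y (x ^ k) (y ^ k))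
    where
    lemma : ∀ x y a b → x * y * (a * b) ≡ x * a * (y * b)
    lemma = solve-∀

  -- (a − t)ᵏ⁺¹ ≡ aᵏ⁺¹ − (k+1) t aᵏ  (mod t²)
  binomial : ∀ a t k → ∃[ q ]
    (a - t) ^ suc k ≡ a * a ^ k - (+ suc k) * t * a ^ k + q * t ^ 2
  binomial a t zero    = + 0 , lemma a t
    where
    lemma : ∀ a t → (a - t) * 1ℤ ≡ a * 1ℤ - 1ℤ * t * 1ℤ + + 0 * (t * (t * 1ℤ))
    lemma = solve-∀
  binomial a t (suc k) with binomial a t k
  ... | q , eq = (+ suc k) * a ^ k + q * (a - t) ,
    trans (cong ((a - t) *_) eq) (lemma a t (+ suc k) (a ^ k) q)
    where
    lemma : ∀ a t s w q →
      (a - t) * (a * w - s * t * w + q * (t * (t * 1ℤ))) ≡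
      a * (a * w) - (1ℤ + s) * t * (a * w) + (s * w + q * (a - t)) * (t * (t * 1ℤ))
    lemma = solve-∀

  -- With t = 1 + u n:  n · numerator = (n+1−t)ⁿ⁺¹ + (t−1)(n+1)ⁿ⁺¹ ≡ 0 (mod t²),
  -- and n is invertible modulo t².
  divisibility : ∀ n u →
    ((1ℤ + u * + n) ^ 2) ∣
    ((+ n) ^ n * (1ℤ - u) ^ suc n + u * (+ n + 1ℤ) ^ suc n)
  divisibility n u
    with binomial (1ℤ + + n) (1ℤ + u * + n) n
  ... | q , eq = divides
    (num + q * (u * u * N - (1ℤ + 1ℤ) * t * u))
    (trans (lemma₃ num u N)
      (trans (cong (λ z → num * (t * (t * 1ℤ)) + z * (u * u * N - (1ℤ + 1ℤ) * t * u)) n·num)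
             (lemma₄ num q (u * u * N - (1ℤ + 1ℤ) * t * u) (t ^ 2))))
    where
    open ≡-Reasoning
    N t num : ℤ
    N = + n
    t = 1ℤ + u * N
    num = N ^ n * (1ℤ - u) ^ suc n + u * (N + 1ℤ) ^ suc n

    lemma₁ : ∀ N u w v x → N * (w * v + u * x) ≡ N * w * v + N * u * x
    lemma₁ = solve-∀

    lemma₂ : ∀ N u → N * (1ℤ - u) ≡ (1ℤ + N) - (1ℤ + u * N)
    lemma₂ = solve-∀

    lemma₃ : ∀ num u N → num ≡
      num * ((1ℤ + u * N) * ((1ℤ + u * N) * 1ℤ))
      + N * num * (u * u * N - (1ℤ + 1ℤ) * (1ℤ + u * N) * u)
    lemma₃ = solve-∀

    lemma₄ : ∀ num q r s → num * s + q * s * r ≡ (num + q * r) * s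
    lemma₄ = solve-∀

    lemma₅ : ∀ N u w q →
      ((1ℤ + N) * w - (1ℤ + N) * (1ℤ + u * N) * w
        + q * ((1ℤ + u * N) * ((1ℤ + u * N) * 1ℤ)))
      + N * u * ((1ℤ + N) * w)
      ≡ q * ((1ℤ + u * N) * ((1ℤ + u * N) * 1ℤ))
    lemma₅ = solve-∀

    n·num : N * num ≡ q * t ^ 2
    n·num = begin
      N * num
        ≡⟨ lemma₁ N u (N ^ n) ((1ℤ - u) ^ suc n) ((N + 1ℤ) ^ suc n) ⟩
      N ^ suc n * (1ℤ - u) ^ suc n + N * u * (N + 1ℤ) ^ suc n
        ≡⟨ cong₂ (λ x y → x + N * u * y)
             (trans (sym (^-distrib-* N (1ℤ - u) (suc n)))
                    (trans (cong (_^ suc n) (lemma₂ N u)) eq))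
             (cong (_^ suc n) (ℤ.+-comm N 1ℤ)) ⟩
      ((1ℤ + N) * (1ℤ + N) ^ n - (1ℤ + N) * t * (1ℤ + N) ^ n + q * t ^ 2)
        + N * u * ((1ℤ + N) * (1ℤ + N) ^ n)
        ≡⟨ lemma₅ N u ((1ℤ + N) ^ n) q ⟩
      q * t ^ 2 ∎

𝒟-integral : ∀ n m b → 𝒟-denominator n m b ∣ 𝒟-numerator n m b
𝒟-integral n m b = divisibility n (b ℤ.* m ^ (2 ℕ.* n))

module _ (n : ℕ) (m b : ℤ) where

  𝒟 : ℤ
  𝒟 = quotient (𝒟-integral n m b)

  𝒟-spec : 𝒟-numerator n m b ≡ 𝒟 ℤ.* 𝒟-denominator n m b
  𝒟-spec = _∣_.equality (𝒟-integral n m b)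

  -- The division is exact.
  d : ℕ
  d = (∣ 𝒟 ∣ ℕ./ partAt (b ℤ.* m) 𝒟) {{partAt-nonZero (b ℤ.* m) 𝒟}}

{-# OPTIONS --safe #-}
module Submission where

-- Let θ be a root of f = ℱ, u = b m²ⁿ and t = 1 + u n.  Multiplied by m² x − 1, f
-- becomes the trinomial m² xⁿ⁺¹ + (u − 1) xⁿ − b.  At a prime dividing b, f is an
-- Eisenstein polynomial, hence f is irreducible.
--
-- Suppose that α = H(θ)/p is integral, p prime, deg H < n and H ≢ 0 modulo p.
-- Clearing denominators in an integral equation shows that every homomorphism
-- from ℤ[θ] to 𝔽ₚ that kills the denominator of α, for any way of writing α as
-- a fraction, kills the numerator too.  If p ∣ b, this contradicts p² ∤ b.
-- Otherwise f divides a power of H modulo p, so f divides f′ H, and since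
-- (m² x − 1) f′ ≡ xⁿ⁻¹ L modulo f with L = (n + 1) m² x − n (1 − u), it divides
-- L H.  If p ∤ (n + 1) m², then L H ≡ κ f and the root ξ of L is a double root of f
-- modulo p; choosing ξ to be a root of L modulo p², one has p² ∣ f(ξ).  The resultant
-- of f and L is ± t 𝒟, so p² ∣ t 𝒟, and p ∤ t because 1/m² is not a double root;
-- hence p² ∣ 𝒟.  If p ∣ (n + 1) m², then L is constant modulo p, hence zero, which
-- forces p ∣ n + 1 and p ∣ 1 − u, and again p² ∣ 𝒟.  Since p does not divide b m, the
-- integer d is then divisible by p².

open import Defs
open import Level using (_⊔_; 0ℓ)
open import Algebra.Bundles using (CommutativeRing)
open import Algebra.Bundles.Raw using (RawRing)
open import Algebra.Definitions.RawMagma using () renaming (_,_ to _∣ʳ,_)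
import Algebra.Definitions.RawSemiring as RawSemiringDefinitions
open import Algebra.Structures using (IsCommutativeRing)
open import Data.Empty using (⊥; ⊥-elim)
open import Data.Fin.Base using (Fin; toℕ)
open import Data.Integer.Base as ℤ using (ℤ; +_; -[1+_]; ∣_∣; 1ℤ)
import Data.Integer.Divisibility.Signed as Signed
open import Data.Integer.GCD using (gcd)
import Data.Integer.Properties as ℤ
open import Data.Integer.Tactic.RingSolver using (solve-∀)
open import Data.List.Base using (List; []; _∷_; map; length; tabulate; upTo)
import Data.List.Properties as List
open import Data.List.Relation.Unary.All as All using (All; []; _∷_)
open import Data.List.Relation.Unary.All.Properties using (all-filter)
open import Data.List.Relation.Unary.AllPairs.Core using ([]; _∷_)
open import Data.List.Relation.Unary.Unique.Propositional using (Unique)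
open import Data.List.Relation.Unary.Unique.Propositional.Properties using (upTo⁺; filter⁺)
open import Data.Maybe.Base using (Maybe; just; nothing)
open import Data.Nat.Base as ℕ using (ℕ; zero; suc; z≤n; s≤s)
open import Data.Nat.Coprimality as Coprimality using (Coprime; coprime-divisor)
import Data.Nat.Divisibility as ℕ
import Data.Nat.DivMod as ℕ
open import Data.Nat.GCD using () renaming (gcd-greatest to gcdℕ-greatest; module Bézout to Bézoutℕ)
open import Data.Nat.ListAction using (product)
open import Data.Nat.Primality
  using (Prime; prime?; prime⇒irreducible; prime⇒nonZero; ¬prime[1]; euclidsLemma)
open import Data.Nat.Primality.Factorisation using (PrimeFactorisation; factorise)
import Data.Nat.Properties as ℕ
open import Data.Product.Base using (_×_; _,_; proj₁; proj₂; ∃-syntax; ∃₂)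
open import Data.Rational.Base as ℚ using (ℚ; mkℚ; ↥_; ↧_; toℚᵘ)
import Data.Rational.Properties as ℚ
open import Data.Rational.Unnormalised.Base as ℚᵘ using (mkℚᵘ; *≡*)
import Data.Rational.Unnormalised.Properties as ℚᵘ
open import Data.Sum.Base as Sum using (_⊎_; inj₁; inj₂; [_,_]′)
open import Function.Base using (id; _∘_)
open import Relation.Binary.Definitions using (tri<; tri≈; tri>)
open import Relation.Binary.PropositionalEquality as ≡ using (_≡_; _≢_)
open import Relation.Nullary using (Dec; yes; no; ¬_)
open import Relation.Nullary.Decidable using (map′; toSum; _×-dec_)

-- The shape of f′ keeps everything over 𝔽ₚ itself: up to the factors x and m² x - 1 it is the
-- linear polynomial L, and x is prime to f when p ∤ b. A repeated factor of f modulo p therefore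
-- divides L, so its root lies in 𝔽ₚ, integers can be substituted for x, and gcds take the place of
-- factorisations modulo p.
--
-- Several fractions for one α are used because H/p alone yields only p ∣ H(ξ). Writing L H = κ f +
-- p r, one also has α = r/L; since L(ξ) vanishes modulo p, so does r(ξ), and then κ f(ξ) = L(ξ)
-- H(ξ) - p r(ξ) is divisible by p². For p ∣ b the homomorphism is θ ↦ 0, and the second fraction
-- has a power of θ as its denominator.
--
-- The denominator of a general integral element is a product of primes, which are cancelled one at
-- a time. This is the origin of the integer s that accompanies p: it is the product of the primes
-- still to be treated, and may contain p again.

module RingSolver {c ℓ} (R : CommutativeRing c ℓ) where
  open CommutativeRing R
  open import Relation.Binary.Reasoning.Setoid setoid
  open import Algebra.Properties.Ring ring
    using (-‿distribˡ-*; -‿distribʳ-*; -0#≈0#; -‿involutive; -‿+-comm)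
  open import Algebra.Properties.Semiring.Mult semiring
    using (×-homo-+; ×1-homo-*; ×-congˡ; ×-homo-1) renaming (_×_ to _·_)
  open import Algebra.Solver.Ring.AlmostCommutativeRing
    using (fromCommutativeRing; _-Raw-AlmostCommutative⟶_)

  -- The canonical map from ℤ. The solver computes with integer coefficients, whose equality is
  -- decidable, so terms cancel even where equality in `R` cannot be decided.
  ⟦_⟧ᶻ : ℤ → Carrier
  ⟦ + n ⟧ᶻ      = n · 1#
  ⟦ -[1+ n ] ⟧ᶻ = - (suc n · 1#)

  ⊖-homo : ∀ m n → ⟦ m ℤ.⊖ n ⟧ᶻ ≈ m · 1# + - (n · 1#)
  ⊖-homo zero zero = sym (-‿inverseʳ 0#)
  ⊖-homo zero (suc n) = sym (+-identityˡ _)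
  ⊖-homo (suc m) zero = sym (trans (+-congˡ -0#≈0#) (+-identityʳ _))
  ⊖-homo (suc m) (suc n) = begin
    ⟦ suc m ℤ.⊖ suc n ⟧ᶻ                      ≡⟨ ≡.cong ⟦_⟧ᶻ (ℤ.[1+m]⊖[1+n]≡m⊖n m n) ⟩
    ⟦ m ℤ.⊖ n ⟧ᶻ                              ≈⟨ ⊖-homo m n ⟩
    M + - N                                   ≈⟨ +-congʳ (+-identityˡ M) ⟨
    0# + M + - N                              ≈⟨ +-congʳ (+-congʳ (-‿inverseʳ 1#)) ⟨
    1# + - 1# + M + - N                       ≈⟨ +-congʳ (+-assoc _ _ _) ⟩
    1# + (- 1# + M) + - N                     ≈⟨ +-congʳ (+-congˡ (+-comm _ _)) ⟩
    1# + (M + - 1#) + - N                     ≈⟨ +-congʳ (+-assoc _ _ _) ⟨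
    1# + M + - 1# + - N                       ≈⟨ +-assoc _ _ _ ⟩
    1# + M + (- 1# + - N)                     ≈⟨ +-congˡ (-‿+-comm 1# N) ⟩
    1# + M + - (1# + N)                       ∎
    where
    M = m · 1#
    N = n · 1#

  -‿homo : ∀ i → ⟦ ℤ.- i ⟧ᶻ ≈ - ⟦ i ⟧ᶻ
  -‿homo (+ zero)  = sym -0#≈0#
  -‿homo (+ suc n) = refl
  -‿homo -[1+ n ]  = sym (-‿involutive _)

  +-homo : ∀ i j → ⟦ i ℤ.+ j ⟧ᶻ ≈ ⟦ i ⟧ᶻ + ⟦ j ⟧ᶻ
  +-homo (+ m) (+ n) = ×-homo-+ 1# m n
  +-homo (+ m) -[1+ n ] = ⊖-homo m (suc n)
  +-homo -[1+ m ] (+ n) = trans (⊖-homo n (suc m)) (+-comm _ _)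
  +-homo -[1+ m ] -[1+ n ] = begin
    - (suc (suc (m ℕ.+ n)) · 1#)            ≈⟨ -‿cong (×-congˡ (≡.cong suc (ℕ.+-suc m n))) ⟨
    - ((suc m ℕ.+ suc n) · 1#)              ≈⟨ -‿cong (×-homo-+ 1# (suc m) (suc n)) ⟩
    - (suc m · 1# + suc n · 1#)             ≈⟨ -‿+-comm _ _ ⟨
    - (suc m · 1#) + - (suc n · 1#)         ∎

  *-homo⁺ : ∀ m j → ⟦ + m ℤ.* j ⟧ᶻ ≈ ⟦ + m ⟧ᶻ * ⟦ j ⟧ᶻ
  *-homo⁺ m (+ n) = trans (reflexive (≡.cong ⟦_⟧ᶻ (≡.sym (ℤ.pos-* m n)))) (×1-homo-* m n)
  *-homo⁺ m -[1+ n ] = begin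
    ⟦ + m ℤ.* -[1+ n ] ⟧ᶻ           ≡⟨ ≡.cong ⟦_⟧ᶻ (ℤ.neg-distribʳ-* (+ m) (+ suc n)) ⟨
    ⟦ ℤ.- (+ m ℤ.* + suc n) ⟧ᶻ      ≈⟨ -‿homo (+ m ℤ.* + suc n) ⟩
    - ⟦ + m ℤ.* + suc n ⟧ᶻ          ≈⟨ -‿cong (*-homo⁺ m (+ suc n)) ⟩
    - (⟦ + m ⟧ᶻ * ⟦ + suc n ⟧ᶻ)     ≈⟨ -‿distribʳ-* _ _ ⟩
    ⟦ + m ⟧ᶻ * - ⟦ + suc n ⟧ᶻ       ∎

  *-homo : ∀ i j → ⟦ i ℤ.* j ⟧ᶻ ≈ ⟦ i ⟧ᶻ * ⟦ j ⟧ᶻ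
  *-homo (+ m) j = *-homo⁺ m j
  *-homo -[1+ m ] j = begin
    ⟦ -[1+ m ] ℤ.* j ⟧ᶻ             ≡⟨ ≡.cong ⟦_⟧ᶻ (ℤ.neg-distribˡ-* (+ suc m) j) ⟨
    ⟦ ℤ.- (+ suc m ℤ.* j) ⟧ᶻ        ≈⟨ -‿homo (+ suc m ℤ.* j) ⟩
    - ⟦ + suc m ℤ.* j ⟧ᶻ            ≈⟨ -‿cong (*-homo⁺ (suc m) j) ⟩
    - (⟦ + suc m ⟧ᶻ * ⟦ j ⟧ᶻ)       ≈⟨ -‿distribˡ-* _ _ ⟩
    - ⟦ + suc m ⟧ᶻ * ⟦ j ⟧ᶻ         ∎

  morphism : ℤ.+-*-rawRing -Raw-AlmostCommutative⟶ fromCommutativeRing R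
  morphism = record
    { ⟦_⟧ = ⟦_⟧ᶻ ; +-homo = +-homo ; *-homo = *-homo ; -‿homo = -‿homo
    ; 0-homo = refl ; 1-homo = ×-homo-1 1# }

  _coeff≟_ : ∀ i j → Maybe (⟦ i ⟧ᶻ ≈ ⟦ j ⟧ᶻ)
  i coeff≟ j with i ℤ.≟ j
  ... | yes ≡.refl = just refl
  ... | no _ = nothing

  open import Algebra.Solver.Ring ℤ.+-*-rawRing (fromCommutativeRing R) morphism _coeff≟_ public
    using (solve; _:=_; _:+_; _:*_; _:-_; :-_; con)

-- Divisibility and quotients in commutative rings

module Divisibility {c ℓ} (R : CommutativeRing c ℓ) where
  open CommutativeRing R
  open RingSolver R
  open import Algebra.Properties.Semiring.Exp semiring public using (_^_; ^-homo-*; ^-congˡ)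
  open import Algebra.Properties.CommutativeSemiring.Exp commutativeSemiring public using (^-distrib-*)
  open import Relation.Binary.Reasoning.Setoid setoid

  infix 4 _∣_

  record _∣_ (x y : Carrier) : Set (c ⊔ ℓ) where
    constructor divides
    field
      quotient : Carrier
      equality : y ≈ quotient * x
  open _∣_ public

  ∣-respʳ : ∀ {x y z} → y ≈ z → x ∣ y → x ∣ z
  ∣-respʳ y≈z (divides q e) = divides q (trans (sym y≈z) e)

  ∣-refl : ∀ {x} → x ∣ x
  ∣-refl = divides 1# (sym (*-identityˡ _))

  ∣-+ : ∀ {x y z} → x ∣ y → x ∣ z → x ∣ y + z
  ∣-+ (divides q e) (divides r f) = divides (q + r) (trans (+-cong e f) (sym (distribʳ _ _ _)))

  ∣-neg : ∀ {x y} → x ∣ y → x ∣ - y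
  ∣-neg {x} (divides q e) = divides (- q)
    (trans (-‿cong e) (solve 2 (λ q x → :- (q :* x) := (:- q) :* x) refl q x))

  ∣-*ˡ : ∀ {x y} z → x ∣ y → x ∣ z * y
  ∣-*ˡ z (divides q e) = divides (z * q) (trans (*-congˡ e) (sym (*-assoc _ _ _)))

  ∣-*ʳ : ∀ {x y} z → x ∣ y → x ∣ y * z
  ∣-*ʳ z d = ∣-respʳ (*-comm _ _) (∣-*ˡ z d)

  ∣-trans : ∀ {x y z} → x ∣ y → y ∣ z → x ∣ z
  ∣-trans d (divides q e) = ∣-respʳ (sym e) (∣-*ˡ q d)

module Quotient {c ℓ} (R : CommutativeRing c ℓ) (f : CommutativeRing.Carrier R) where
  open CommutativeRing R
  open RingSolver R
  open Divisibility R

  infix 4 _~_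

  -- In this form, rather than as divisibility of a difference, compatibility with sums and products
  -- is checked by substituting for x.
  record _~_ (x y : Carrier) : Set (c ⊔ ℓ) where
    constructor congruent
    field
      factor   : Carrier
      equation : x ≈ y + factor * f
  open _~_ public

  ≈⇒~ : ∀ {x y} → x ≈ y → x ~ y
  ≈⇒~ {x} {y} e = congruent 0# (trans e (solve 2 (λ y f → y := y :+ con (+ 0) :* f) refl y f))

  ∣⇒~0 : ∀ {x} → f ∣ x → x ~ 0#
  ∣⇒~0 (divides q e) = congruent q (trans e (sym (+-identityˡ _)))

  ~0⇒∣ : ∀ {x} → x ~ 0# → f ∣ x
  ~0⇒∣ (congruent q e) = divides q (trans e (+-identityˡ _))

  ~-sym : ∀ {x y} → x ~ y → y ~ x
  ~-sym {x} {y} (congruent q e) = congruent (- q)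
    (trans (solve 3 (λ y q f → y := y :+ q :* f :+ (:- q) :* f) refl y q f) (+-congʳ (sym e)))

  ~-trans : ∀ {x y z} → x ~ y → y ~ z → x ~ z
  ~-trans {z = z} (congruent q e) (congruent r g) = congruent (r + q)
    (trans e (trans (+-congʳ g) (solve 4 (λ z r q f → z :+ r :* f :+ q :* f := z :+ (r :+ q) :* f) refl z r q f)))

  ~-+ : ∀ {x y u v} → x ~ y → u ~ v → x + u ~ y + v
  ~-+ {y = y} {v = v} (congruent q e) (congruent r g) = congruent (q + r)
    (trans (+-cong e g) (solve 5 (λ y v q r f → y :+ q :* f :+ (v :+ r :* f) := y :+ v :+ (q :+ r) :* f) refl y v q r f))

  ~-neg : ∀ {x y} → x ~ y → - x ~ - y
  ~-neg {y = y} (congruent q e) = congruent (- q)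
    (trans (-‿cong e) (solve 3 (λ y q f → :- (y :+ q :* f) := :- y :+ (:- q) :* f) refl y q f))

  ~-* : ∀ {x y u v} → x ~ y → u ~ v → x * u ~ y * v
  ~-* {y = y} {v = v} (congruent q e) (congruent r g) = congruent (q * v + y * r + q * r * f)
    (trans (*-cong e g) (solve 5 (λ y v q r f → (y :+ q :* f) :* (v :+ r :* f) := y :* v :+ (q :* v :+ y :* r :+ q :* r :* f) :* f) refl y v q r f))

  abstract
    isCommutativeRing/ : IsCommutativeRing _~_ _+_ _*_ -_ 0# 1#
    isCommutativeRing/ = record
      { isRing = record
        { +-isAbelianGroup = record
          { isGroup = record
            { isMonoid = record
              { isSemigroup = record
                { isMagma = record
                  { isEquivalence = record { refl = ≈⇒~ refl ; sym = ~-sym ; trans = ~-trans }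
                  ; ∙-cong = ~-+ }
                ; assoc = λ x y z → ≈⇒~ (+-assoc x y z) }
              ; identity = (λ x → ≈⇒~ (+-identityˡ x)) , (λ x → ≈⇒~ (+-identityʳ x)) }
            ; inverse = (λ x → ≈⇒~ (-‿inverseˡ x)) , (λ x → ≈⇒~ (-‿inverseʳ x))
            ; ⁻¹-cong = ~-neg }
          ; comm = λ x y → ≈⇒~ (+-comm x y) }
        ; *-cong = ~-*
        ; *-assoc = λ x y z → ≈⇒~ (*-assoc x y z)
        ; *-identity = (λ x → ≈⇒~ (*-identityˡ x)) , (λ x → ≈⇒~ (*-identityʳ x))
        ; distrib = (λ x y z → ≈⇒~ (distribˡ x y z)) , (λ x y z → ≈⇒~ (distribʳ x y z)) }
      ; *-comm = λ x y → ≈⇒~ (*-comm x y) }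

  quotientRing : CommutativeRing c (c ⊔ ℓ)
  quotientRing = record { isCommutativeRing = isCommutativeRing/ }

-- Polynomials over a commutative ring

IsCommutativeRingOn : ∀ {c ℓ₀ ℓ} (R : RawRing c ℓ₀) → (RawRing.Carrier R → RawRing.Carrier R → Set ℓ) → Set (c ⊔ ℓ)
IsCommutativeRingOn R _≈_ = IsCommutativeRing _≈_ _+_ _*_ -_ 0# 1#
  where open RawRing R using (_+_; _*_; -_; 0#; 1#)

record IsHomomorphism {c ℓ₀ ℓ c′ ℓ′} (R : RawRing c ℓ₀) (_≈_ : RawRing.Carrier R → RawRing.Carrier R → Set ℓ)
  (S : CommutativeRing c′ ℓ′) (φ : RawRing.Carrier R → CommutativeRing.Carrier S) : Set (c ⊔ ℓ ⊔ ℓ′) where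
  open RawRing R using (_+_; _*_; 0#; 1#)
  private
    module S = CommutativeRing S
  field
    φ-cong : ∀ {x y} → x ≈ y → φ x S.≈ φ y
    φ-+    : ∀ x y → φ (x + y) S.≈ φ x S.+ φ y
    φ-*    : ∀ x y → φ (x * y) S.≈ φ x S.* φ y
    φ-0    : φ 0# S.≈ S.0#
    φ-1    : φ 1# S.≈ S.1#

-- The relation is a parameter separate from the raw ring, so that ℤ[x] and
-- 𝔽ₚ[x] share their elements and operations.
module PolynomialRing {c ℓ₀ ℓ} (R : RawRing c ℓ₀)
  (_≈_ : RawRing.Carrier R → RawRing.Carrier R → Set ℓ) (isCR : IsCommutativeRingOn R _≈_) where

  open RawRing R using (Carrier; _+_; _*_; -_; 0#; 1#)

  base : CommutativeRing c ℓ
  base = record { isCommutativeRing = isCR }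

  private
    module B where
      open CommutativeRing base public
      open RingSolver base public
      open import Algebra.Properties.Ring ring public using (-0#≈0#)

  open Polynomial R public

  infix 4 _≋_

  -- A record because p and q can be recovered from its type by unification, whereas a bare family
  -- of equations between coefficients does not determine the two lists.
  record _≋_ (p q : Poly) : Set ℓ where
    constructor coeffwise
    field
      at : ∀ i → coeff p i ≈ coeff q i
  open _≋_ public

  coeff-+ : ∀ p q i → coeff (p +ₚ q) i ≈ (coeff p i + coeff q i)
  coeff-+ [] q i = B.sym (B.+-identityˡ _)
  coeff-+ (a ∷ p) [] i = B.sym (B.+-identityʳ _)
  coeff-+ (a ∷ p) (b ∷ q) zero = B.refl
  coeff-+ (a ∷ p) (b ∷ q) (suc i) = coeff-+ p q i

  coeff-scale : ∀ a p i → coeff (map (a *_) p) i ≈ (a * coeff p i)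
  coeff-scale a [] i = B.sym (B.zeroʳ a)
  coeff-scale a (b ∷ p) zero = B.refl
  coeff-scale a (b ∷ p) (suc i) = coeff-scale a p i

  coeff-neg : ∀ p i → coeff (map -_ p) i ≈ (- coeff p i)
  coeff-neg [] i = B.sym B.-0#≈0#
  coeff-neg (b ∷ p) zero = B.refl
  coeff-neg (b ∷ p) (suc i) = coeff-neg p i

  ≋-refl : ∀ {p} → p ≋ p
  ≋-refl = coeffwise λ i → B.refl

  ≋-sym : ∀ {p q} → p ≋ q → q ≋ p
  ≋-sym e = coeffwise λ i → B.sym (at e i)

  ≋-trans : ∀ {p q r} → p ≋ q → q ≋ r → p ≋ r
  ≋-trans e f = coeffwise λ i → B.trans (at e i) (at f i)

  +ₚ-cong : ∀ {p q r s} → p ≋ q → r ≋ s → p +ₚ r ≋ q +ₚ s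
  +ₚ-cong {p} {q} {r} {s} e f = coeffwise λ i →
    B.trans (coeff-+ p r i) (B.trans (B.+-cong (at e i) (at f i)) (B.sym (coeff-+ q s i)))

  scale-cong : ∀ {a b p q} → a ≈ b → p ≋ q → map (a *_) p ≋ map (b *_) q
  scale-cong {a} {b} {p} {q} e f = coeffwise λ i →
    B.trans (coeff-scale a p i) (B.trans (B.*-cong e (at f i)) (B.sym (coeff-scale b q i)))

  ∷-cong : ∀ {a b p q} → a ≈ b → p ≋ q → a ∷ p ≋ b ∷ q
  ∷-cong e f = coeffwise λ { zero → e ; (suc i) → at f i }

  tail-≋ : ∀ {a b p q} → a ∷ p ≋ b ∷ q → p ≋ q
  tail-≋ e = coeffwise λ i → at e (suc i)

  tail-≋[] : ∀ {a p} → a ∷ p ≋ [] → p ≋ []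
  tail-≋[] e = coeffwise λ i → at e (suc i)

  0∷[] : ∀ {a} → a ≈ 0# → a ∷ [] ≋ []
  0∷[] e = coeffwise λ { zero → e ; (suc i) → B.refl }

  0∷≋[] : ∀ {a p} → a ≈ 0# → p ≋ [] → a ∷ p ≋ []
  0∷≋[] e f = coeffwise λ { zero → e ; (suc i) → at f i }

  +ₚ-assoc : ∀ p q r → (p +ₚ q) +ₚ r ≋ p +ₚ (q +ₚ r)
  +ₚ-assoc p q r = coeffwise λ i →
    B.trans (coeff-+ (p +ₚ q) r i) (B.trans (B.+-congʳ (coeff-+ p q i)) (B.trans (B.+-assoc _ _ _)
    (B.sym (B.trans (coeff-+ p (q +ₚ r) i) (B.+-congˡ (coeff-+ q r i))))))

  +ₚ-comm : ∀ p q → p +ₚ q ≋ q +ₚ p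
  +ₚ-comm p q = coeffwise λ i →
    B.trans (coeff-+ p q i) (B.trans (B.+-comm _ _) (B.sym (coeff-+ q p i)))

  +ₚ-identityʳ : ∀ p → p +ₚ [] ≋ p
  +ₚ-identityʳ p = ≋-trans (+ₚ-comm p []) ≋-refl

  negₚ-cong : ∀ {p q} → p ≋ q → map -_ p ≋ map -_ q
  negₚ-cong {p} {q} e = coeffwise λ i →
    B.trans (coeff-neg p i) (B.trans (B.-‿cong (at e i)) (B.sym (coeff-neg q i)))

  negₚ-inverseʳ : ∀ p → p +ₚ map -_ p ≋ []
  negₚ-inverseʳ p = coeffwise λ i →
    B.trans (coeff-+ p (map -_ p) i) (B.trans (B.+-congˡ (coeff-neg p i)) (B.-‿inverseʳ _))

  negₚ-inverseˡ : ∀ p → map -_ p +ₚ p ≋ []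
  negₚ-inverseˡ p = ≋-trans (+ₚ-comm (map -_ p) p) (negₚ-inverseʳ p)

  private
    +-interchange : ∀ p q r s → (p +ₚ q) +ₚ (r +ₚ s) ≋ (p +ₚ r) +ₚ (q +ₚ s)
    +-interchange p q r s = coeffwise λ i →
      B.trans (coeff-+ (p +ₚ q) (r +ₚ s) i) (B.trans (B.+-cong (coeff-+ p q i) (coeff-+ r s i))
      (B.trans (B.solve 4 (λ p q r s → (p B.:+ q) B.:+ (r B.:+ s) B.:= (p B.:+ r) B.:+ (q B.:+ s)) B.refl _ _ _ _)
      (B.sym (B.trans (coeff-+ (p +ₚ r) (q +ₚ s) i) (B.+-cong (coeff-+ p r i) (coeff-+ q s i))))))

    scale-+ : ∀ a p q → map (a *_) (p +ₚ q) ≋ map (a *_) p +ₚ map (a *_) q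
    scale-+ a p q = coeffwise λ i →
      B.trans (coeff-scale a (p +ₚ q) i) (B.trans (B.*-congˡ (coeff-+ p q i)) (B.trans (B.distribˡ _ _ _)
      (B.sym (B.trans (coeff-+ (map (a *_) p) _ i) (B.+-cong (coeff-scale a p i) (coeff-scale a q i))))))

    scale-distrib : ∀ a b p → map ((a + b) *_) p ≋ map (a *_) p +ₚ map (b *_) p
    scale-distrib a b p = coeffwise λ i →
      B.trans (coeff-scale (a + b) p i) (B.trans (B.distribʳ _ _ _)
      (B.sym (B.trans (coeff-+ (map (a *_) p) _ i) (B.+-cong (coeff-scale a p i) (coeff-scale b p i)))))

    scale-scale : ∀ a b p → map ((a * b) *_) p ≋ map (a *_) (map (b *_) p)
    scale-scale a b p = coeffwise λ i →
      B.trans (coeff-scale (a * b) p i) (B.trans (B.*-assoc _ _ _)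
      (B.sym (B.trans (coeff-scale a (map (b *_) p) i) (B.*-congˡ (coeff-scale b p i)))))

    scale-0 : ∀ {a} p → a ≈ 0# → map (a *_) p ≋ []
    scale-0 {a} p e = coeffwise λ i → B.trans (coeff-scale a p i) (B.trans (B.*-congʳ e) (B.zeroˡ _))

  scale-1 : ∀ p → map (1# *_) p ≋ p
  scale-1 p = coeffwise λ i → B.trans (coeff-scale 1# p i) (B.*-identityˡ _)

  private
    _⟫_ : ∀ {p q r} → p ≋ q → q ≋ r → p ≋ r
    _⟫_ = ≋-trans
    infixr 1 _⟫_

    zeroˡ′ : ∀ {p} q → p ≋ [] → p *ₚ q ≋ []
    zeroˡ′ {[]} q e = ≋-refl
    zeroˡ′ {a ∷ p} q e = +ₚ-cong (scale-0 q (at e 0)) (0∷≋[] B.refl (zeroˡ′ q (tail-≋[] e)))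

    zeroʳ′ : ∀ p → p *ₚ [] ≋ []
    zeroʳ′ [] = ≋-refl
    zeroʳ′ (a ∷ p) = 0∷≋[] B.refl (zeroʳ′ p)

    *-∷ : ∀ p b q → p *ₚ (b ∷ q) ≋ map (b *_) p +ₚ (0# ∷ (p *ₚ q))
    *-∷ [] b q = ≋-sym (0∷[] B.refl)
    *-∷ (a ∷ p) b q = ∷-cong (B.+-congʳ (B.*-comm a b))
      (+ₚ-cong ≋-refl (*-∷ p b q) ⟫
       ≋-sym (+ₚ-assoc (map (a *_) q) (map (b *_) p) _) ⟫
       +ₚ-cong (+ₚ-comm (map (a *_) q) (map (b *_) p)) ≋-refl ⟫
       +ₚ-assoc (map (b *_) p) (map (a *_) q) _)

  *ₚ-comm : ∀ p q → p *ₚ q ≋ q *ₚ p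
  *ₚ-comm [] q = ≋-sym (zeroʳ′ q)
  *ₚ-comm (a ∷ p) q = +ₚ-cong ≋-refl (∷-cong B.refl (*ₚ-comm p q)) ⟫ ≋-sym (*-∷ q a p)

  private
    *-congˡ′ : ∀ p {q r} → q ≋ r → p *ₚ q ≋ p *ₚ r
    *-congˡ′ [] e = ≋-refl
    *-congˡ′ (a ∷ p) e = +ₚ-cong (scale-cong B.refl e) (∷-cong B.refl (*-congˡ′ p e))

  *ₚ-cong : ∀ {p q r s} → p ≋ q → r ≋ s → p *ₚ r ≋ q *ₚ s
  *ₚ-cong {p} {q} {r} {s} e f = *-congˡ′ p f ⟫ *ₚ-comm p s ⟫ *-congˡ′ s e ⟫ *ₚ-comm s q

  *ₚ-distribʳ : ∀ r p q → (p +ₚ q) *ₚ r ≋ (p *ₚ r) +ₚ (q *ₚ r)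
  *ₚ-distribʳ r [] q = ≋-refl
  *ₚ-distribʳ r (a ∷ p) [] = ≋-sym (+ₚ-identityʳ _)
  *ₚ-distribʳ r (a ∷ p) (b ∷ q) =
    +ₚ-cong (scale-distrib a b r)
      (∷-cong (B.sym (B.+-identityʳ 0#)) (*ₚ-distribʳ r p q)) ⟫
    +-interchange (map (a *_) r) (map (b *_) r) (0# ∷ (p *ₚ r)) (0# ∷ (q *ₚ r))

  *ₚ-distribˡ : ∀ r p q → r *ₚ (p +ₚ q) ≋ (r *ₚ p) +ₚ (r *ₚ q)
  *ₚ-distribˡ r p q = *ₚ-comm r (p +ₚ q) ⟫ *ₚ-distribʳ r p q ⟫ +ₚ-cong (*ₚ-comm p r) (*ₚ-comm q r)

  scale-* : ∀ a p q → map (a *_) p *ₚ q ≋ map (a *_) (p *ₚ q)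
  scale-* a [] q = ≋-refl
  scale-* a (b ∷ p) q =
    +ₚ-cong (scale-scale a b q) (∷-cong (B.sym (B.zeroʳ a)) (scale-* a p q)) ⟫
    ≋-sym (scale-+ a (map (b *_) q) (0# ∷ (p *ₚ q)))

  0∷-* : ∀ p q → (0# ∷ p) *ₚ q ≋ 0# ∷ (p *ₚ q)
  0∷-* p q = +ₚ-cong (scale-0 q B.refl) ≋-refl

  *ₚ-assoc : ∀ p q r → (p *ₚ q) *ₚ r ≋ p *ₚ (q *ₚ r)
  *ₚ-assoc [] q r = ≋-refl
  *ₚ-assoc (a ∷ p) q r =
    *ₚ-distribʳ r (map (a *_) q) (0# ∷ (p *ₚ q)) ⟫
    +ₚ-cong (scale-* a q r) (0∷-* (p *ₚ q) r ⟫ ∷-cong B.refl (*ₚ-assoc p q r))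

  const-* : ∀ a p → const a *ₚ p ≋ map (a *_) p
  const-* a p = +ₚ-cong ≋-refl (0∷[] B.refl) ⟫ +ₚ-identityʳ _

  *ₚ-identityˡ : ∀ p → const 1# *ₚ p ≋ p
  *ₚ-identityˡ p = const-* 1# p ⟫ scale-1 p

  *ₚ-identityʳ : ∀ p → p *ₚ const 1# ≋ p
  *ₚ-identityʳ p = *ₚ-comm p (const 1#) ⟫ *ₚ-identityˡ p

  abstract
    isCommutativeRingₚ : IsCommutativeRing _≋_ _+ₚ_ _*ₚ_ (map -_) [] (const 1#)
    isCommutativeRingₚ = record
      { isRing = record
        { +-isAbelianGroup = record
          { isGroup = record
            { isMonoid = record
              { isSemigroup = record
                { isMagma = record
                  { isEquivalence = record { refl = ≋-refl ; sym = ≋-sym ; trans = ≋-trans }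
                  ; ∙-cong = +ₚ-cong }
                ; assoc = +ₚ-assoc }
              ; identity = (λ p → ≋-refl) , +ₚ-identityʳ }
            ; inverse = negₚ-inverseˡ , negₚ-inverseʳ
            ; ⁻¹-cong = negₚ-cong }
          ; comm = +ₚ-comm }
        ; *-cong = *ₚ-cong
        ; *-assoc = *ₚ-assoc
        ; *-identity = *ₚ-identityˡ , *ₚ-identityʳ
        ; distrib = *ₚ-distribˡ , *ₚ-distribʳ }
      ; *-comm = *ₚ-comm }

  polynomialRing : CommutativeRing c ℓ
  polynomialRing = record { isCommutativeRing = isCommutativeRingₚ }

  coeff-const* : ∀ a p i → coeff (const a *ₚ p) i ≈ (a * coeff p i)
  coeff-const* a p i = B.trans (at (const-* a p) i) (coeff-scale a p i)

  X* : ∀ p → X *ₚ p ≋ 0# ∷ p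
  X* p = 0∷-* (const 1#) p ⟫ ∷-cong B.refl (*ₚ-identityˡ p)

  ∷≋ : ∀ a p → a ∷ p ≋ const a +ₚ (X *ₚ p)
  ∷≋ a p = ∷-cong (B.sym (B.+-identityʳ a)) ≋-refl ⟫ +ₚ-cong (≋-refl {const a}) (≋-sym (X* p))

module Evaluation {c ℓ₀ ℓ} (R : RawRing c ℓ₀)
  (_≈_ : RawRing.Carrier R → RawRing.Carrier R → Set ℓ) (isCR : IsCommutativeRingOn R _≈_)
  {c′ ℓ′} (S : CommutativeRing c′ ℓ′) (φ : RawRing.Carrier R → CommutativeRing.Carrier S)
  (φ-hom : IsHomomorphism R _≈_ S φ) (α : CommutativeRing.Carrier S) where

  open RawRing R using (Carrier; _+_; _*_; -_; 0#; 1#)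
  private
    module S = CommutativeRing S
  open IsHomomorphism φ-hom
  open PolynomialRing R _≈_ isCR
  open RingSolver S
  open import Relation.Binary.Reasoning.Setoid S.setoid
  open import Algebra.Properties.Ring S.ring using (+-inverseˡ-unique)
  open import Algebra.Properties.Semiring.Exp S.semiring using () renaming (_^_ to _^ˢ_)
  open CommutativeRing polynomialRing using () renaming (semiring to polySemiring)
  open import Algebra.Properties.Semiring.Exp polySemiring using () renaming (_^_ to _^ₚ_)

  ev : Poly → S.Carrier
  ev p = eval R S.rawRing φ p α

  ev-≋[] : ∀ p → p ≋ [] → ev p S.≈ S.0#
  ev-≋[] [] e = S.refl
  ev-≋[] (a ∷ p) e = begin
    φ a S.+ α S.* ev p   ≈⟨ S.+-cong (S.trans (φ-cong (at e 0)) φ-0) (S.*-congˡ (ev-≋[] p (tail-≋[] e))) ⟩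
    S.0# S.+ α S.* S.0#  ≈⟨ S.trans (S.+-identityˡ _) (S.zeroʳ α) ⟩
    S.0#                 ∎

  ev-cong : ∀ {p q} → p ≋ q → ev p S.≈ ev q
  ev-cong {[]} {q} e = S.sym (ev-≋[] q (≋-sym e))
  ev-cong {a ∷ p} {[]} e = ev-≋[] (a ∷ p) e
  ev-cong {a ∷ p} {b ∷ q} e = S.+-cong (φ-cong (at e 0)) (S.*-congˡ (ev-cong (tail-≋ e)))

  ev-+ : ∀ p q → ev (p +ₚ q) S.≈ ev p S.+ ev q
  ev-+ [] q = S.sym (S.+-identityˡ _)
  ev-+ (a ∷ p) [] = S.sym (S.+-identityʳ _)
  ev-+ (a ∷ p) (b ∷ q) = begin
    φ (a + b) S.+ α S.* ev (p +ₚ q)                ≈⟨ S.+-cong (φ-+ a b) (S.*-congˡ (ev-+ p q)) ⟩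
    φ a S.+ φ b S.+ α S.* (ev p S.+ ev q)
      ≈⟨ solve 5 (λ a b x p q → a :+ b :+ x :* (p :+ q) := a :+ x :* p :+ (b :+ x :* q)) S.refl _ _ _ _ _ ⟩
    φ a S.+ α S.* ev p S.+ (φ b S.+ α S.* ev q)    ∎

  ev-scale : ∀ a p → ev (map (a *_) p) S.≈ φ a S.* ev p
  ev-scale a [] = S.sym (S.zeroʳ _)
  ev-scale a (b ∷ p) = begin
    φ (a * b) S.+ α S.* ev (map (a *_) p)      ≈⟨ S.+-cong (φ-* a b) (S.*-congˡ (ev-scale a p)) ⟩
    φ a S.* φ b S.+ α S.* (φ a S.* ev p)
      ≈⟨ solve 4 (λ a b x p → a :* b :+ x :* (a :* p) := a :* (b :+ x :* p)) S.refl _ _ _ _ ⟩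
    φ a S.* (φ b S.+ α S.* ev p)               ∎

  ev-* : ∀ p q → ev (p *ₚ q) S.≈ ev p S.* ev q
  ev-* [] q = S.sym (S.zeroˡ _)
  ev-* (a ∷ p) q = begin
    ev (map (a *_) q +ₚ (0# ∷ (p *ₚ q)))                 ≈⟨ ev-+ (map (a *_) q) _ ⟩
    ev (map (a *_) q) S.+ (φ 0# S.+ α S.* ev (p *ₚ q))
      ≈⟨ S.+-cong (ev-scale a q) (S.+-cong φ-0 (S.*-congˡ (ev-* p q))) ⟩
    φ a S.* ev q S.+ (S.0# S.+ α S.* (ev p S.* ev q))
      ≈⟨ solve 4 (λ a x p q → a :* q :+ (con (+ 0) :+ x :* (p :* q)) := (a :+ x :* p) :* q) S.refl _ _ _ _ ⟩
    (φ a S.+ α S.* ev p) S.* ev q                        ∎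

  ev-const : ∀ a → ev (const a) S.≈ φ a
  ev-const a = S.trans (S.+-congˡ (S.zeroʳ α)) (S.+-identityʳ _)

  ev-X : ev X S.≈ α
  ev-X = begin
    φ 0# S.+ α S.* ev (const 1#)  ≈⟨ S.+-cong φ-0 (S.*-congˡ (S.trans (ev-const 1#) φ-1)) ⟩
    S.0# S.+ α S.* S.1#           ≈⟨ S.trans (S.+-identityˡ _) (S.*-identityʳ α) ⟩
    α                             ∎

  ev-neg : ∀ p → ev (map -_ p) S.≈ S.- ev p
  ev-neg p = +-inverseˡ-unique _ _ (S.trans (S.sym (ev-+ (map -_ p) p)) (ev-≋[] _ (negₚ-inverseˡ p)))

  ev-^ : ∀ p k → ev (p ^ₚ k) S.≈ ev p ^ˢ k
  ev-^ p zero = S.trans (ev-const 1#) φ-1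
  ev-^ p (suc k) = S.trans (ev-* p (p ^ₚ k)) (S.*-congˡ (ev-^ p k))

  ev-homomorphism : IsHomomorphism polyRing _≋_ S ev
  ev-homomorphism = record { φ-cong = ev-cong ; φ-+ = ev-+ ; φ-* = ev-* ; φ-0 = S.refl ; φ-1 = S.trans (ev-const 1#) φ-1 }

-- Degree bounds, division with remainder, derivatives

module PolynomialOperations {c ℓ} (R : RawRing c ℓ) where
  open RawRing R using (0#)
  open Polynomial R

  -- The formal derivative through (a + x p)′ = p + x p′, which avoids integer multiples of
  -- coefficients and so makes sense over a raw ring. ℤ[x] and 𝔽ₚ[x] thus share it.
  𝐷 : Poly → Poly
  𝐷 [] = []
  𝐷 (a ∷ p) = p +ₚ (X *ₚ 𝐷 p)

  shift : ℕ → Poly → Poly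
  shift zero p = p
  shift (suc j) p = 0# ∷ shift j p

module PolynomialProperties {c ℓ₀ ℓ} (R : RawRing c ℓ₀)
  (_≈_ : RawRing.Carrier R → RawRing.Carrier R → Set ℓ) (isCR : IsCommutativeRingOn R _≈_) where

  open RawRing R using (Carrier; _+_; _*_; -_; 0#; 1#)

  open PolynomialRing R _≈_ isCR
  open PolynomialOperations R public
  private
    module B where
      open CommutativeRing base public
      open RingSolver base public
      open import Algebra.Properties.Ring ring public using (-0#≈0#)
    module P where
      open CommutativeRing polynomialRing public
      open RingSolver polynomialRing public
      open import Relation.Binary.Reasoning.Setoid setoid public
      open Divisibility polynomialRing public

  -- A bound in place of the degree, which could be found only by deciding whether coefficients
  -- vanish. Degree at most i reads `Below (suc i)`.
  Below : ℕ → Poly → Set ℓ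
  Below n p = ∀ i → n ℕ.≤ i → coeff p i ≈ 0#

  Below-cong : ∀ {n p q} → p ≋ q → Below n p → Below n q
  Below-cong e z i n≤i = B.trans (B.sym (at e i)) (z i n≤i)

  Below-≤ : ∀ {m n p} → m ℕ.≤ n → Below m p → Below n p
  Below-≤ m≤n z i n≤i = z i (ℕ.≤-trans m≤n n≤i)

  Below-+ : ∀ {n p q} → Below n p → Below n q → Below n (p +ₚ q)
  Below-+ {n} {p} {q} z w i n≤i =
    B.trans (coeff-+ p q i) (B.trans (B.+-cong (z i n≤i) (w i n≤i)) (B.+-identityˡ _))

  Below-scale : ∀ {n p} a → Below n p → Below n (map (a *_) p)
  Below-scale {n} {p} a z i n≤i = B.trans (coeff-scale a p i) (B.trans (B.*-congˡ (z i n≤i)) (B.zeroʳ a))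

  Below-neg : ∀ {n p} → Below n p → Below n (map -_ p)
  Below-neg {n} {p} z i n≤i = B.trans (coeff-neg p i) (B.trans (B.-‿cong (z i n≤i)) B.-0#≈0#)

  Below-∷ : ∀ {n a p} → Below n p → Below (suc n) (a ∷ p)
  Below-∷ z (suc i) (s≤s n≤i) = z i n≤i

  Below-tail : ∀ {n a p} → Below (suc n) (a ∷ p) → Below n p
  Below-tail z i n≤i = z (suc i) (s≤s n≤i)

  Below-0 : ∀ {p} → Below 0 p → p ≋ []
  Below-0 z = coeffwise λ i → z i z≤n

  Below-1 : ∀ {p} → Below 1 p → p ≋ const (coeff p 0)
  Below-1 z = coeffwise λ { zero → B.refl ; (suc i) → z (suc i) (s≤s z≤n) }

  Below-const : ∀ a → Below 1 (const a)
  Below-const a (suc i) _ = B.refl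

  Below-length : ∀ p → ∃[ n ] Below n p
  Below-length [] = 0 , λ i _ → B.refl
  Below-length (a ∷ p) with Below-length p
  ... | n , z = suc n , Below-∷ z

  Below-suc : ∀ {n p} → Below (suc n) p → coeff p n ≈ 0# → Below n p
  Below-suc {n} z e i n≤i with n ℕ.≟ i
  ... | yes ≡.refl = e
  ... | no n≢i = z i (ℕ.≤∧≢⇒< n≤i n≢i)

  leadingCoeff-* : ∀ {i j} p q → Below (suc i) p → Below (suc j) q →
    coeff (p *ₚ q) (i ℕ.+ j) ≈ (coeff p i * coeff q j)
  leadingCoeff-* {i} {j} [] q z w = B.sym (B.zeroˡ _)
  leadingCoeff-* {zero} {j} (a ∷ p) q z w = B.trans (coeff-+ (map (a *_) q) _ j)
    (B.trans (B.+-cong (coeff-scale a q j) (0-tail j)) (B.+-identityʳ _))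
    where
    0-tail : ∀ j → coeff (0# ∷ (p *ₚ q)) j ≈ 0#
    0-tail zero = B.refl
    0-tail (suc j) = at (P.trans (P.*-congʳ {q} (Below-0 {p} (Below-tail z))) P.refl) j
  leadingCoeff-* {suc i} {j} (a ∷ p) q z w = B.trans (coeff-+ (map (a *_) q) _ (suc i ℕ.+ j))
    (B.trans (B.+-cong (Below-scale {p = q} a w _ (s≤s (ℕ.m≤n+m j i))) (leadingCoeff-* p q (Below-tail z) w)) (B.+-identityˡ _))

  Below-* : ∀ {i j} p q → Below (suc i) p → Below (suc j) q → Below (suc (i ℕ.+ j)) (p *ₚ q)
  Below-* [] q z w k _ = B.refl
  Below-* {zero} {j} (a ∷ p) q z w = Below-cong {p = map (a *_) q}
    (P.sym (P.trans (P.+-congˡ {map (a *_) q} (0∷≋[] B.refl (P.*-congʳ {q} (Below-0 {p} (Below-tail z))))) (P.+-identityʳ _)))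
    (Below-scale {p = q} a w)
  Below-* {suc i} {j} (a ∷ p) q z w = Below-+ {p = map (a *_) q}
    (Below-≤ {p = map (a *_) q} (s≤s (ℕ.m≤n+m j (suc i))) (Below-scale {p = q} a w))
    (Below-∷ (Below-* p q (Below-tail z) w))

  coeff-0-* : ∀ p q → coeff (p *ₚ q) 0 ≈ (coeff p 0 * coeff q 0)
  coeff-0-* [] q = B.sym (B.zeroˡ _)
  coeff-0-* (a ∷ p) q = B.trans (coeff-+ (map (a *_) q) _ 0) (B.trans (B.+-identityʳ _) (coeff-scale a q 0))

  Monic : ℕ → Poly → Set ℓ
  Monic n f = coeff f n ≈ 1# × Below (suc n) f

  record Division (n : ℕ) (f p : Poly) : Set (c ⊔ ℓ) where
    field
      quot rem : Poly
      division : p ≋ (quot *ₚ f) +ₚ rem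
      below    : Below n rem

  -- Horner's scheme: if p = q f + r with r of degree less than n, then a + x r has degree at most
  -- n, and subtracting k f, with k its coefficient of xⁿ, removes the top term.
  divide : ∀ {n} f → Monic n f → ∀ p → Division n f p
  divide f _ [] = record { quot = [] ; rem = [] ; division = ≋-refl ; below = λ _ _ → B.refl }
  divide {n} f (f≈1 , z) (a ∷ p) = record
    { quot = const k P.+ X P.* quot
    ; rem = (a ∷ rem) P.- const k P.* f
    ; division = begin
        a ∷ p                              ≈⟨ ∷≋ a p ⟩
        const a P.+ X P.* p                ≈⟨ P.+-congˡ {const a} (P.*-congˡ {X} division) ⟩
        const a P.+ X P.* (quot P.* f P.+ rem)
          ≈⟨ P.solve 6 (λ a x q f r k → a P.:+ x P.:* (q P.:* f P.:+ r) P.:=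
               (k P.:+ x P.:* q) P.:* f P.:+ ((a P.:+ x P.:* r) P.:- k P.:* f)) P.refl (const a) X quot f rem (const k) ⟩
        (const k P.+ X P.* quot) P.* f P.+ ((const a P.+ X P.* rem) P.- const k P.* f)
          ≈⟨ P.+-congˡ {(const k P.+ X P.* quot) P.* f} (P.+-congʳ {P.- (const k P.* f)} (∷≋ a rem)) ⟨
        (const k P.+ X P.* quot) P.* f P.+ ((a ∷ rem) P.- const k P.* f) ∎
    ; below = Below-suc {p = (a ∷ rem) P.- const k P.* f}
        (Below-+ {p = a ∷ rem} {P.- (const k P.* f)} (Below-∷ below) (Below-neg {p = const k P.* f}
          (Below-* (const k) f (Below-const k) z)))
        (B.trans (coeff-+ (a ∷ rem) (P.- (const k P.* f)) n)
        (B.trans (B.+-congˡ (B.trans (coeff-neg (const k P.* f) n) (B.-‿cong (B.trans (coeff-const* k f n)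
          (B.trans (B.*-congˡ f≈1) (B.*-identityʳ k))))))
          (B.-‿inverseʳ k)))
    }
    where
    open P using (begin_; step-≈-⟩; step-≈-⟨; _∎)
    open Division (divide f (f≈1 , z) p)
    k = coeff (a ∷ rem) n

  -- The list of q supplies some bound l + 1. As f has leading coefficient 1, the coefficient of q
  -- at l reappears in f q at n + l; it vanishes as long as l ≥ k, and the bound drops.
  Monic-*-Below : ∀ {n k} f q → Monic n f → Below (n ℕ.+ k) (f *ₚ q) → Below k q
  Monic-*-Below {n} {k} f q (f≈1 , z) w = go _ (proj₂ (Below-length q))
    where
    go : ∀ l → Below l q → Below k q
    go zero v = Below-≤ {p = q} z≤n v
    go (suc l) v with l ℕ.<? k
    ... | yes l<k = Below-≤ {p = q} l<k v
    ... | no l≮k = go l (Below-suc {p = q} v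
      (B.trans (B.sym (B.trans (leadingCoeff-* f q z v) (B.trans (B.*-congʳ f≈1) (B.*-identityˡ _))))
        (w (n ℕ.+ l) (ℕ.+-monoʳ-≤ n (ℕ.≮⇒≥ l≮k)))))

  Monic-∣-Below : ∀ {n f p} → Monic n f → f P.∣ p → Below n p → p ≋ []
  Monic-∣-Below {n} {f} {p} mf (P.divides q e) z = P.trans e (P.trans (P.*-congʳ {f} q≋0) ≋-refl)
    where
    q≋0 : q ≋ []
    q≋0 = Below-0 (Monic-*-Below f q mf
      (≡.subst (λ k → Below k (f *ₚ q)) (≡.sym (ℕ.+-identityʳ n)) (Below-cong (P.trans e (P.*-comm q f)) z)))

  𝐷-≋[] : ∀ p → p ≋ [] → 𝐷 p ≋ []
  𝐷-≋[] [] e = ≋-refl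
  𝐷-≋[] (a ∷ p) e = P.trans (P.+-cong (tail-≋[] e) (P.*-congˡ {X} (𝐷-≋[] p (tail-≋[] e)))) (P.zeroʳ X)

  𝐷-cong : ∀ {p q} → p ≋ q → 𝐷 p ≋ 𝐷 q
  𝐷-cong {[]} {q} e = P.sym (𝐷-≋[] q (P.sym e))
  𝐷-cong {a ∷ p} {[]} e = 𝐷-≋[] (a ∷ p) e
  𝐷-cong {a ∷ p} {b ∷ q} e = P.+-cong (tail-≋ e) (P.*-congˡ {X} (𝐷-cong (tail-≋ e)))

  𝐷-+ : ∀ p q → 𝐷 (p +ₚ q) ≋ 𝐷 p +ₚ 𝐷 q
  𝐷-+ [] q = ≋-refl
  𝐷-+ (a ∷ p) [] = P.sym (P.+-identityʳ _)
  𝐷-+ (a ∷ p) (b ∷ q) = P.trans (P.+-congˡ {p +ₚ q} (P.*-congˡ {X} (𝐷-+ p q)))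
    (P.solve 5 (λ x p q r s → p P.:+ q P.:+ x P.:* (r P.:+ s) P.:= p P.:+ x P.:* r P.:+ (q P.:+ x P.:* s))
      P.refl X p q (𝐷 p) (𝐷 q))

  𝐷-scale : ∀ a p → 𝐷 (map (a *_) p) ≋ const a *ₚ 𝐷 p
  𝐷-scale a [] = P.sym (P.zeroʳ (const a))
  𝐷-scale a (b ∷ p) = P.trans (P.+-cong (P.sym (const-* a p)) (P.*-congˡ {X} (𝐷-scale a p)))
    (P.solve 4 (λ a x p r → a P.:* p P.:+ x P.:* (a P.:* r) P.:= a P.:* (p P.:+ x P.:* r)) P.refl (const a) X p (𝐷 p))

  𝐷-* : ∀ p q → 𝐷 (p *ₚ q) ≋ (𝐷 p *ₚ q) +ₚ (p *ₚ 𝐷 q)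
  𝐷-* [] q = ≋-refl
  𝐷-* (a ∷ p) q = begin
    𝐷 (map (a *_) q +ₚ (0# ∷ (p *ₚ q)))                      ≈⟨ 𝐷-+ (map (a *_) q) _ ⟩
    𝐷 (map (a *_) q) P.+ (p P.* q P.+ X P.* 𝐷 (p P.* q))     ≈⟨ P.+-cong (𝐷-scale a q) (P.+-congˡ {p P.* q} (P.*-congˡ {X} (𝐷-* p q))) ⟩
    const a P.* 𝐷 q P.+ (p P.* q P.+ X P.* (𝐷 p P.* q P.+ p P.* 𝐷 q))
      ≈⟨ P.solve 6 (λ a x p q r s → a P.:* s P.:+ (p P.:* q P.:+ x P.:* (r P.:* q P.:+ p P.:* s)) P.:=
           (p P.:+ x P.:* r) P.:* q P.:+ (a P.:+ x P.:* p) P.:* s) P.refl (const a) X p q (𝐷 p) (𝐷 q) ⟩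
    𝐷 (a ∷ p) P.* q P.+ (const a P.+ X P.* p) P.* 𝐷 q       ≈⟨ P.+-congˡ {𝐷 (a ∷ p) P.* q} (P.*-congʳ {𝐷 q} (∷≋ a p)) ⟨
    𝐷 (a ∷ p) P.* q P.+ (a ∷ p) P.* 𝐷 q                     ∎
    where open P using (begin_; step-≈-⟩; step-≈-⟨; _∎)

  shift≋ : ∀ j p → shift j p ≋ (X P.^ j) *ₚ p
  shift≋ zero p = P.sym (P.*-identityˡ p)
  shift≋ (suc j) p = P.trans (P.sym (X* (shift j p)))
    (P.trans (P.*-congˡ {X} (shift≋ j p)) (P.sym (P.*-assoc X (X P.^ j) p)))

  shift-* : ∀ j p q → shift j p *ₚ q ≋ shift j (p *ₚ q)
  shift-* zero p q = ≋-refl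
  shift-* (suc j) p q = P.trans (0∷-* (shift j p) q) (∷-cong B.refl (shift-* j p q))

  coeff-shift : ∀ j p i → coeff (shift j p) (j ℕ.+ i) ≡ coeff p i
  coeff-shift zero p i = ≡.refl
  coeff-shift (suc j) p i = coeff-shift j p i

-- Greatest common divisors and repeated factors

module Bézout {c ℓ} (R : CommutativeRing c ℓ) where
  open CommutativeRing R
  open RingSolver R
  open Divisibility R
  open import Relation.Binary.Reasoning.Setoid setoid

  -- The Bézout identity is required of the cofactors: from u f + v h = g it would follow only after
  -- cancelling g, which may be zero.
  record GCD (f h : Carrier) : Set (c ⊔ ℓ) where
    field
      g f₁ h₁ u v : Carrier
      f≈  : f ≈ g * f₁
      h≈  : h ≈ g * h₁
      bézout : u * f₁ + v * h₁ ≈ 1#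

  GCD-sym : ∀ {f h} → GCD f h → GCD h f
  GCD-sym G = record { f≈ = h≈ ; h≈ = f≈ ; bézout = trans (+-comm _ _) bézout }
    where open GCD G

  GCD-zero : ∀ {h} → GCD 0# h
  GCD-zero {h} = record
    { g = h ; f₁ = 0# ; h₁ = 1# ; u = 0# ; v = 1#
    ; f≈ = sym (zeroʳ h) ; h≈ = sym (*-identityʳ h)
    ; bézout = trans (+-cong (zeroˡ 0#) (*-identityˡ 1#)) (+-identityˡ 1#) }

  GCD-resp : ∀ {f f′ h h′} → f ≈ f′ → h ≈ h′ → GCD f h → GCD f′ h′
  GCD-resp e e′ G = record { f≈ = trans (sym e) f≈ ; h≈ = trans (sym e′) h≈ ; bézout = bézout }
    where open GCD G

  GCD-* : ∀ {f h} x → GCD f h → GCD (x * f) (x * h)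
  GCD-* x G = record
    { g = x * g ; f≈ = trans (*-congˡ f≈) (sym (*-assoc _ _ _))
    ; h≈ = trans (*-congˡ h≈) (sym (*-assoc _ _ _)) ; bézout = bézout }
    where open GCD G

  -- x may be adjoined because it is comaximal with the cofactor h₁.
  GCD-step : ∀ {f h} x κ (G : GCD f h) → (∃₂ λ s t → s * x + t * GCD.h₁ G ≈ 1#) → GCD (κ * h + x * f) h
  GCD-step {f} {h} x κ G (s , t , st) = record
    { g = g ; f₁ = κ * h₁ + x * f₁ ; h₁ = h₁
    -- Obtained from s x (u f₁ + v h₁) + t h₁ = 1 by writing x f₁ as the new cofactor minus κ h₁.
    ; u = s * u ; v = t + s * x * v - s * u * κ
    ; f≈ = trans (+-cong (*-congˡ h≈) (*-congˡ f≈))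
        (solve 5 (λ k g h x f → k :* (g :* h) :+ x :* (g :* f) := g :* (k :* h :+ x :* f)) refl κ g h₁ x f₁)
    ; h≈ = h≈
    ; bézout = begin
        s * u * (κ * h₁ + x * f₁) + (t + s * x * v - s * u * κ) * h₁
          ≈⟨ solve 8 (λ s t u v k h x f → s :* u :* (k :* h :+ x :* f) :+ (t :+ s :* x :* v :- s :* u :* k) :* h
               := s :* x :* (u :* f :+ v :* h) :+ t :* h) refl s t u v κ h₁ x f₁ ⟩
        s * x * (u * f₁ + v * h₁) + t * h₁   ≈⟨ +-congʳ (trans (*-congˡ bézout) (*-identityʳ _)) ⟩
        s * x + t * h₁                       ≈⟨ st ⟩
        1#                                   ∎ }
    where open GCD G

  -- The factors h disappear one by one: multiplying a hᵏ by u f + v h = 1 turns f ∣ a hᵏ⁺¹ into f ∣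
  -- a hᵏ.
  ∣-coprime : ∀ {f h u v} a k → u * f + v * h ≈ 1# → f ∣ a * h ^ k → f ∣ a
  ∣-coprime a zero uv d = ∣-respʳ (*-identityʳ a) d
  ∣-coprime {f} {h} {u} {v} a (suc k) uv d = ∣-coprime a k uv
    (∣-respʳ (begin
      a * h ^ k * u * f + v * (a * (h * h ^ k))
        ≈⟨ solve 6 (λ a p u f v h → a :* p :* u :* f :+ v :* (a :* (h :* p)) := (u :* f :+ v :* h) :* (a :* p)) refl a (h ^ k) u f v h ⟩
      (u * f + v * h) * (a * h ^ k)   ≈⟨ trans (*-congʳ uv) (*-identityˡ _) ⟩
      a * h ^ k  ∎)
      (∣-+ (∣-*ˡ (a * h ^ k * u) ∣-refl) (∣-*ˡ v d)))

  Regular : Carrier → Set (c ⊔ ℓ)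
  Regular x = ∀ y → x * y ≈ 0# → y ≈ 0#

  Regular-factorˡ : ∀ x y → Regular (x * y) → Regular x
  Regular-factorˡ x y r z e = r z (begin
    x * y * z    ≈⟨ solve 3 (λ x y z → x :* y :* z := y :* (x :* z)) refl x y z ⟩
    y * (x * z)  ≈⟨ trans (*-congˡ e) (zeroʳ y) ⟩
    0#           ∎)

  Regular-resp : ∀ {x y} → x ≈ y → Regular x → Regular y
  Regular-resp e r z f = r z (trans (*-congʳ e) f)

  Regular-cancel : ∀ {x y z} → Regular x → x * y ≈ x * z → y ≈ z
  Regular-cancel {x} {y} {z} r e = begin
    y              ≈⟨ solve 2 (λ y z → y := (y :- z) :+ z) refl y z ⟩
    (y - z) + z    ≈⟨ +-congʳ (r (y - z) (begin
      x * (y - z)    ≈⟨ solve 3 (λ x y z → x :* (y :- z) := x :* y :- x :* z) refl x y z ⟩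
      x * y - x * z  ≈⟨ +-congʳ e ⟩
      x * z - x * z  ≈⟨ -‿inverseʳ _ ⟩
      0#             ∎)) ⟩
    0# + z         ≈⟨ +-identityˡ z ⟩
    z              ∎

  -- In terms of the prime factorisation of f: f′/f has simple poles only, and h
  -- vanishes at all of them.
  module _ (D : Carrier → Carrier) (D-cong : ∀ {x y} → x ≈ y → D x ≈ D y)
           (D-* : ∀ x y → D (x * y) ≈ D x * y + x * D y)
           (gcd : ∀ f h → GCD f h) where

    ∣^⇒∣D* : ∀ k f h → Regular f → f ∣ h ^ k → f ∣ D f * h
    ∣^⇒∣D* zero f h r (divides q e) = ∣-respʳ (*-identityʳ _) (∣-*ˡ (D f * h) (divides q e))
    -- The exponent drops on passing to f₁ and g: cancelling g leaves f₁ ∣ h₁ hᵏ, and f₁ is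
    -- comaximal with h₁, so f₁ ∣ gᵏ. By the product rule D f h is a multiple of f plus h₁ g (D f₁
    -- g), and f₁ ∣ D f₁ g by induction.
    ∣^⇒∣D* (suc k) f h r (divides q e) = ∣-respʳ (sym Df*h)
      (∣-+ (∣-*ˡ (D g * h₁) ∣-refl) (divides (f₂ * h₁) (begin
        h₁ * g * (D f₁ * g)     ≈⟨ *-congˡ f₂-eq ⟩
        h₁ * g * (f₂ * f₁)      ≈⟨ solve 4 (λ a b c d → a :* b :* (c :* d) := c :* a :* (b :* d)) refl h₁ g f₂ f₁ ⟩
        f₂ * h₁ * (g * f₁)      ≈⟨ *-congˡ f≈ ⟨
        f₂ * h₁ * f             ∎)))
      where
      open GCD (gcd f h)
      Regular-gf₁ = Regular-resp f≈ r
      cancelled : q * f₁ ≈ h₁ * h ^ k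
      cancelled = Regular-cancel (Regular-factorˡ g f₁ Regular-gf₁) (begin
        g * (q * f₁)      ≈⟨ solve 3 (λ a b c → a :* (b :* c) := b :* (a :* c)) refl g q f₁ ⟩
        q * (g * f₁)      ≈⟨ *-congˡ f≈ ⟨
        q * f             ≈⟨ e ⟨
        h * h ^ k         ≈⟨ *-congʳ h≈ ⟩
        g * h₁ * h ^ k    ≈⟨ *-assoc _ _ _ ⟩
        g * (h₁ * h ^ k)  ∎)
      f₁∣g^k : f₁ ∣ g ^ k
      f₁∣g^k = ∣-coprime (g ^ k) (suc k) bézout (divides q (begin
        g ^ k * (h₁ * h₁ ^ k)   ≈⟨ solve 3 (λ a b c → a :* (b :* c) := b :* (a :* c)) refl (g ^ k) h₁ (h₁ ^ k) ⟩
        h₁ * (g ^ k * h₁ ^ k)   ≈⟨ *-congˡ (^-distrib-* g h₁ k) ⟨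
        h₁ * (g * h₁) ^ k       ≈⟨ *-congˡ (^-congˡ k h≈) ⟨
        h₁ * h ^ k              ≈⟨ cancelled ⟨
        q * f₁                  ∎))
      rec : f₁ ∣ D f₁ * g
      rec = ∣^⇒∣D* k f₁ g (Regular-factorˡ f₁ g (Regular-resp (*-comm g f₁) Regular-gf₁)) f₁∣g^k
      f₂ = quotient rec
      f₂-eq = equality rec
      Df*h : D f * h ≈ D g * h₁ * f + h₁ * g * (D f₁ * g)
      Df*h = begin
        D f * h                                  ≈⟨ *-cong (trans (D-cong f≈) (D-* g f₁)) h≈ ⟩
        (D g * f₁ + g * D f₁) * (g * h₁)
          ≈⟨ solve 5 (λ a f g b h → (a :* f :+ g :* b) :* (g :* h) := a :* h :* (g :* f) :+ h :* g :* (b :* g)) refl (D g) f₁ g (D f₁) h₁ ⟩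
        D g * h₁ * (g * f₁) + h₁ * g * (D f₁ * g)  ≈⟨ +-congʳ (*-congˡ f≈) ⟨
        D g * h₁ * f + h₁ * g * (D f₁ * g)         ∎

module PolynomialsOverDomain {c ℓ₀ ℓ} (R : RawRing c ℓ₀)
  (_≈_ : RawRing.Carrier R → RawRing.Carrier R → Set ℓ) (isCR : IsCommutativeRingOn R _≈_)
  (_≟0 : ∀ a → Dec (a ≈ RawRing.0# R))
  (zero-product : ∀ a b → RawRing._*_ R a b ≈ RawRing.0# R → a ≈ RawRing.0# R ⊎ b ≈ RawRing.0# R) where

  open RawRing R using (Carrier; _+_; _*_; -_; 0#; 1#)
  open PolynomialRing R _≈_ isCR
  open PolynomialProperties R _≈_ isCR
  module P where
    open CommutativeRing polynomialRing public
    open RingSolver polynomialRing public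
    open Divisibility polynomialRing public

  private
    module B where
      open CommutativeRing base public

  zero-or-leading : ∀ p → p ≋ [] ⊎ (∃[ i ] Below (suc i) p × ¬ coeff p i ≈ 0#)
  zero-or-leading p = go _ (proj₂ (Below-length p))
    where
    go : ∀ l → Below l p → p ≋ [] ⊎ (∃[ i ] Below (suc i) p × ¬ coeff p i ≈ 0#)
    go zero z = inj₁ (Below-0 z)
    go (suc l) z with coeff p l ≟0
    ... | yes e = go l (Below-suc {p = p} z e)
    ... | no ne = inj₂ (l , z , ne)

  zero-productₚ : ∀ p q → p *ₚ q ≋ [] → p ≋ [] ⊎ q ≋ []
  zero-productₚ p q e with zero-or-leading p | zero-or-leading q
  ... | inj₁ z | _ = inj₁ z
  ... | inj₂ _ | inj₁ z = inj₂ z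
  ... | inj₂ (i , z , ne) | inj₂ (j , w , ne′) =
    ⊥-elim ([ ne , ne′ ]′ (zero-product _ _ (B.trans (B.sym (leadingCoeff-* p q z w)) (at e (i ℕ.+ j)))))

  zero-or-trailing : ∀ p → p ≋ [] ⊎ (∃₂ λ j p₁ → p ≋ shift j p₁ × ¬ coeff p₁ 0 ≈ 0#)
  zero-or-trailing [] = inj₁ ≋-refl
  zero-or-trailing (a ∷ p) with a ≟0
  ... | no ne = inj₂ (0 , a ∷ p , ≋-refl , ne)
  ... | yes e with zero-or-trailing p
  ...   | inj₁ z = inj₁ (0∷≋[] e z)
  ...   | inj₂ (j , p₁ , f , ne) = inj₂ (suc j , p₁ , ∷-cong e f , ne)

  regular : ∀ f → ¬ coeff f 0 ≈ 0# → Bézout.Regular polynomialRing f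
  regular f ne p e with zero-productₚ f p e
  ... | inj₁ z = ⊥-elim (ne (at z 0))
  ... | inj₂ z = z

  module _ (inverse : ∀ a → ¬ a ≈ 0# → ∃[ a⁻¹ ] (a⁻¹ * a) ≈ 1#) where
    open Bézout polynomialRing
    open import Relation.Binary.Reasoning.Setoid P.setoid

    -- Modulo `X` the polynomial p is its constant term, which is a unit.
    X-comaximal : ∀ p → ¬ coeff p 0 ≈ 0# → ∃₂ λ s t → (s *ₚ X) +ₚ (t *ₚ p) ≋ const 1#
    X-comaximal [] ne = ⊥-elim (ne B.refl)
    X-comaximal (a ∷ p) ne with inverse a ne
    ... | a⁻¹ , e = P.- (const a⁻¹ P.* p) , const a⁻¹ , (begin
      P.- (const a⁻¹ P.* p) P.* X P.+ const a⁻¹ P.* (a ∷ p)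
        ≈⟨ P.+-congˡ {P.- (const a⁻¹ P.* p) P.* X} (P.*-congˡ {const a⁻¹} (∷≋ a p)) ⟩
      P.- (const a⁻¹ P.* p) P.* X P.+ const a⁻¹ P.* (const a P.+ X P.* p)
        ≈⟨ P.solve 4 (λ b a x p → P.:- (b P.:* p) P.:* x P.:+ b P.:* (a P.:+ x P.:* p) P.:= b P.:* a) P.refl (const a⁻¹) (const a) X p ⟩
      const a⁻¹ P.* const a    ≈⟨ const-* a⁻¹ (const a) ⟩
      const (a⁻¹ * a)          ≈⟨ ∷-cong e ≋-refl ⟩
      const 1#                 ∎)

    private
      cofactor-unit : ∀ {f h} (G : GCD f h) → ¬ coeff h 0 ≈ 0# → ¬ coeff (GCD.h₁ G) 0 ≈ 0#
      cofactor-unit G ne e = ne (B.trans (at h≈ 0) (B.trans (coeff-0-* g h₁) (B.trans (B.*-congˡ e) (B.zeroʳ _))))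
        where open GCD G

      step : ∀ {f h} κ → ¬ coeff h 0 ≈ 0# → GCD f h → GCD (κ P.* h P.+ X P.* f) h
      step κ ne G = GCD-step X κ G (X-comaximal (GCD.h₁ G) (cofactor-unit G ne))

      eliminate : ∀ {a b} p q → ¬ b ≈ 0# → ∃[ κ ]
        (const κ P.* (b ∷ q)) P.+ X P.* (p +ₚ map (- κ *_) q) ≋ a ∷ p
      eliminate {a} {b} p q ne with inverse b ne
      ... | b⁻¹ , e = a * b⁻¹ , (begin
        K P.* (b ∷ q) P.+ X P.* (p P.+ map (- (a * b⁻¹) *_) q)
          ≈⟨ P.+-cong (P.*-congˡ {K} (∷≋ b q)) (P.*-congˡ {X} (P.+-congˡ {p} (P.sym (const-* (- (a * b⁻¹)) q)))) ⟩
        K P.* (const b P.+ X P.* q) P.+ X P.* (p P.+ (P.- K) P.* q)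
          ≈⟨ P.solve 5 (λ k b x q p → k P.:* (b P.:+ x P.:* q) P.:+ x P.:* (p P.:+ (P.:- k) P.:* q) P.:= k P.:* b P.:+ x P.:* p) P.refl K (const b) X q p ⟩
        K P.* const b P.+ X P.* p    ≈⟨ P.+-congʳ {X P.* p} (const-* (a * b⁻¹) (const b)) ⟩
        const (a * b⁻¹ * b) P.+ X P.* p
          ≈⟨ P.+-congʳ {X P.* p} (∷-cong {p = []} (B.trans (B.*-assoc _ _ _) (B.trans (B.*-congˡ e) (B.*-identityʳ a))) ≋-refl) ⟩
        const a P.+ X P.* p          ≈⟨ ∷≋ a p ⟨
        a ∷ p                        ∎)
        where K = const (a * b⁻¹)

    length-+ₚ : ∀ {n} p q → length p ℕ.≤ n → length q ℕ.≤ n → length (p +ₚ q) ℕ.≤ n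
    length-+ₚ [] q l m = m
    length-+ₚ (a ∷ p) [] l m = l
    length-+ₚ (a ∷ p) (b ∷ q) (s≤s l) (s≤s m) = s≤s (length-+ₚ p q l m)

    -- Euclid's algorithm from the constant term: instead of lowering the
    -- degree, make the constant term vanish and divide by X.
    gcd-fuel : ∀ k p q → length p ℕ.+ length q ℕ.≤ k → GCD p q
    gcd-fuel k [] q l = GCD-zero
    gcd-fuel k (a ∷ p) [] l = GCD-sym GCD-zero
    gcd-fuel (suc k) (a ∷ p) (b ∷ q) (s≤s l) with a ≟0 | b ≟0
    ... | yes a≈0 | yes b≈0 = GCD-resp (shifted a≈0) (shifted b≈0)
      (GCD-* X (gcd-fuel k p q (ℕ.≤-trans (ℕ.+-monoʳ-≤ (length p) (ℕ.n≤1+n _)) l)))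
      where
      shifted : ∀ {a p} → a ≈ 0# → X P.* p ≋ a ∷ p
      shifted {a} {p} e = P.trans (X* p) (∷-cong (B.sym e) ≋-refl)
    ... | yes a≈0 | no b≉0 = GCD-resp (P.trans (X* p) (∷-cong (B.sym a≈0) ≋-refl)) P.refl (step P.0# b≉0 (gcd-fuel k p (b ∷ q) l))
    ... | no a≉0 | yes b≈0 = GCD-resp P.refl (P.trans (X* q) (∷-cong (B.sym b≈0) ≋-refl)) (GCD-sym (step P.0# a≉0
      (gcd-fuel k q (a ∷ p) (≡.subst (ℕ._≤ k) (≡.trans (ℕ.+-comm (length p) (suc (length q))) (≡.sym (ℕ.+-suc (length q) (length p)))) l))))
    -- A multiple of the list that is not longer is subtracted from the other one; the division by
    -- `X` then lowers the total length by one.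
    ... | no a≉0 | no b≉0 with length q ℕ.≤? length p
    ...   | yes q≤p = let κ , e = eliminate p q b≉0 in GCD-resp e P.refl (step (const κ) b≉0 (gcd-fuel k (p +ₚ map (- κ *_) q) (b ∷ q)
            (ℕ.≤-trans (ℕ.+-monoˡ-≤ (suc (length q)) (length-+ₚ p _ ℕ.≤-refl (≡.subst (ℕ._≤ length p) (≡.sym (List.length-map _ q)) q≤p))) l)))
    ...   | no q≰p = let κ , e = eliminate q p a≉0 in GCD-resp P.refl e (GCD-sym (step (const κ) a≉0 (gcd-fuel k (q +ₚ map (- κ *_) p) (a ∷ p)
            (ℕ.≤-trans (ℕ.+-monoˡ-≤ (suc (length p)) (length-+ₚ q _ ℕ.≤-refl (≡.subst (ℕ._≤ length q) (≡.sym (List.length-map _ p)) (ℕ.≰⇒≥ q≰p))))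
              (≡.subst (ℕ._≤ k) (≡.trans (ℕ.+-comm (length p) (suc (length q))) (≡.sym (ℕ.+-suc (length q) (length p)))) l)))))

    ∣^⇒∣𝐷* : ∀ k f h → ¬ coeff f 0 ≈ 0# → f P.∣ h P.^ k → f P.∣ 𝐷 f P.* h
    ∣^⇒∣𝐷* k f h ne = ∣^⇒∣D* 𝐷 𝐷-cong 𝐷-* (λ p q → gcd-fuel _ p q ℕ.≤-refl) k f h (regular f ne)

    ∣*X^⇒∣ : ∀ k f g → ¬ coeff f 0 ≈ 0# → f P.∣ g P.* X P.^ k → f P.∣ g
    ∣*X^⇒∣ k f g ne = cancel (X-comaximal f ne)
      where
      cancel : (∃₂ λ s t → (s *ₚ X) +ₚ (t *ₚ f) ≋ const 1#) → f P.∣ g P.* X P.^ k → f P.∣ g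
      cancel (s , t , e) = ∣-coprime {u = t} {s} g k (P.trans (P.+-comm (t *ₚ f) (s *ₚ X)) e)

-- Integers, residues and rationals

module ℤ∣ = Divisibility ℤ.+-*-commutativeRing
open ℤ∣ using () renaming (_∣_ to _∣ᶻ_) public

∣ᶻ⇒∣ : ∀ {x y} → x ∣ᶻ y → ∣ x ∣ ℕ.∣ ∣ y ∣
∣ᶻ⇒∣ (ℤ∣.divides q e) = Signed.∣⇒∣ᵤ (Signed.divides q e)

∣⇒∣ᶻ : ∀ {x y} → ∣ x ∣ ℕ.∣ ∣ y ∣ → x ∣ᶻ y
∣⇒∣ᶻ d with Signed.∣ᵤ⇒∣ d
... | Signed.divides q e = ℤ∣.divides q e

infix 4 _∣ᶻ?_
_∣ᶻ?_ : ∀ x y → Dec (x ∣ᶻ y)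
x ∣ᶻ? y = map′ ∣⇒∣ᶻ ∣ᶻ⇒∣ (∣ x ∣ ℕ.∣? ∣ y ∣)

module ℤ[x]′ where
  open PolynomialRing ℤ.+-*-rawRing _≡_ ℤ.+-*-isCommutativeRing public
  open PolynomialProperties ℤ.+-*-rawRing _≡_ ℤ.+-*-isCommutativeRing public

ℤ[x]ᴿ : CommutativeRing 0ℓ 0ℓ
ℤ[x]ᴿ = ℤ[x]′.polynomialRing

module ℚ[x]′ where
  open PolynomialRing ℚ.+-*-rawRing _≡_ ℚ.+-*-isCommutativeRing public
  open PolynomialProperties ℚ.+-*-rawRing _≡_ ℚ.+-*-isCommutativeRing public

ℚ[x]ᴿ : CommutativeRing 0ℓ 0ℓ
ℚ[x]ᴿ = ℚ[x]′.polynomialRing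

module Modulo (k : ℕ) where
  open Quotient ℤ.+-*-commutativeRing (+ k) public

  module 𝔽[x] where
    open PolynomialRing ℤ.+-*-rawRing _~_ isCommutativeRing/ public
    open PolynomialProperties ℤ.+-*-rawRing _~_ isCommutativeRing/ public

  open ℤ[x]′ using (_≋_; coeffwise)

  ≋⇒≋ₖ : ∀ {p q} → p ≋ q → p 𝔽[x].≋ q
  ≋⇒≋ₖ e = 𝔽[x].coeffwise λ i → ≈⇒~ (ℤ[x]′.at e i)

  const*-≋ₖ[] : ∀ r → ℤ[x]′.const (+ k) ℤ[x]′.*ₚ r 𝔽[x].≋ []
  const*-≋ₖ[] r = 𝔽[x].coeffwise λ i → congruent (ℤ[x]′.coeff r i)
    (≡.trans (ℤ[x]′.coeff-const* (+ k) r i) (≡.trans (ℤ.*-comm (+ k) _) (≡.sym (ℤ.+-identityˡ _))))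

  ≋ₖ[]⇒const* : ∀ p → p 𝔽[x].≋ [] → ∃[ r ] p ≋ ℤ[x]′.const (+ k) ℤ[x]′.*ₚ r
  ≋ₖ[]⇒const* p e = divided p e , coeffwise λ i → ≡.trans (coeffs p e i) (≡.sym (ℤ[x]′.coeff-const* (+ k) (divided p e) i))
    where
    divided : ∀ p → p 𝔽[x].≋ [] → ℤ[x]′.Poly
    divided [] e = []
    divided (a ∷ p) e = factor (𝔽[x].at e 0) ∷ divided p (𝔽[x].tail-≋[] e)
    coeffs : ∀ p e i → ℤ[x]′.coeff p i ≡ + k ℤ.* ℤ[x]′.coeff (divided p e) i
    coeffs [] e i = ≡.sym (ℤ.*-zeroʳ (+ k))
    coeffs (a ∷ p) e zero = ≡.trans (equation (𝔽[x].at e 0)) (≡.trans (ℤ.+-identityˡ _) (ℤ.*-comm _ (+ k)))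
    coeffs (a ∷ p) e (suc i) = coeffs p (𝔽[x].tail-≋[] e) i

  ~0? : ∀ a → Dec (a ~ + 0)
  ~0? a = map′ ∣⇒~0 ~0⇒∣ (+ k ∣ᶻ? a)

module ModuloPrime {p : ℕ} (p-prime : Prime p) where
  open Modulo p public

  prime-∣* : ∀ a b → + p ∣ᶻ a ℤ.* b → + p ∣ᶻ a ⊎ + p ∣ᶻ b
  prime-∣* a b d = Sum.map ∣⇒∣ᶻ ∣⇒∣ᶻ
    (euclidsLemma ∣ a ∣ ∣ b ∣ p-prime (≡.subst (p ℕ.∣_) (ℤ.abs-* a b) (∣ᶻ⇒∣ d)))

  prime-∣^ : ∀ a j → + p ∣ᶻ a ℤ∣.^ j → + p ∣ᶻ a
  prime-∣^ a zero d = ⊥-elim (¬prime[1] (≡.subst Prime (ℕ.∣1⇒≡1 (∣ᶻ⇒∣ d)) p-prime))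
  prime-∣^ a (suc j) d = [ id , prime-∣^ a j ]′ (prime-∣* a (a ℤ∣.^ j) d)

  ∤1 : ¬ (+ p ∣ᶻ + 1)
  ∤1 d = ¬prime[1] (≡.subst Prime (ℕ.∣1⇒≡1 (∣ᶻ⇒∣ d)) p-prime)

  ~0-product : ∀ a b → a ℤ.* b ~ + 0 → a ~ + 0 ⊎ b ~ + 0
  ~0-product a b e = Sum.map ∣⇒~0 ∣⇒~0 (prime-∣* a b (~0⇒∣ e))

  private
    coprime : ∀ a → ¬ a ~ + 0 → Coprimality.Coprime p ∣ a ∣
    coprime a a≁0 {i} (i∣p , i∣a) with prime⇒irreducible p-prime i∣p
    ... | inj₁ i≡1 = i≡1
    ... | inj₂ ≡.refl = ⊥-elim (a≁0 (∣⇒~0 (∣⇒∣ᶻ i∣a)))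

    sign-inverse : ∀ a b → b ℤ.* + ∣ a ∣ ~ + 1 → ∃[ c ] c ℤ.* a ~ + 1
    sign-inverse (+ n) b e = b , e
    sign-inverse -[1+ n ] b e = ℤ.- b , ≡.subst (_~ + 1)
      (≡.trans (≡.sym (ℤ.neg-involutive _)) (≡.trans (≡.cong ℤ.-_ (ℤ.neg-distribʳ-* b (+ suc n))) (ℤ.neg-distribˡ-* b -[1+ n ]))) e

    cast : ∀ x y z w → 1 ℕ.+ x ℕ.* y ≡ z ℕ.* w → + 1 ℤ.+ + x ℤ.* + y ≡ + z ℤ.* + w
    cast x y z w e = ≡.trans (≡.cong (λ z → + 1 ℤ.+ z) (≡.sym (ℤ.pos-* x y))) (≡.trans (≡.cong +_ e) (ℤ.pos-* z w))

  ~-inverse : ∀ a → ¬ a ~ + 0 → ∃[ b ] b ℤ.* a ~ + 1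
  ~-inverse a a≁0 with Coprimality.coprime-Bézout (coprime a a≁0)
  ... | Bézoutℕ.-+ x y eq = sign-inverse a (+ y) (congruent (+ x) (≡.sym (cast x p y ∣ a ∣ eq)))
  ... | Bézoutℕ.+- x y eq = sign-inverse a (ℤ.- (+ y)) (congruent (ℤ.- (+ x))
    (≡.trans (lemma (+ y) (+ ∣ a ∣)) (≡.trans (≡.cong (λ z → + 1 ℤ.+ ℤ.- z) (cast y ∣ a ∣ x p eq)) (≡.cong (λ z → + 1 ℤ.+ z) (ℤ.neg-distribˡ-* (+ x) (+ p))))))
    where
    lemma : ∀ y a → (ℤ.- y) ℤ.* a ≡ + 1 ℤ.+ ℤ.- (+ 1 ℤ.+ y ℤ.* a)
    lemma = solve-∀

  open PolynomialsOverDomain ℤ.+-*-rawRing _~_ isCommutativeRing/ ~0? ~0-product public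

ι : ℤ → ℚ
ι a = a ℚ./ 1

private
  toℚᵘ-ι : ∀ a → toℚᵘ (ι a) ℚᵘ.≃ mkℚᵘ a 0
  toℚᵘ-ι a = ℚ.toℚᵘ-fromℚᵘ (mkℚᵘ a 0)

ι-+ : ∀ a b → ι (a ℤ.+ b) ≡ ι a ℚ.+ ι b
ι-+ a b = ℚ.toℚᵘ-injective (begin
  toℚᵘ (ι (a ℤ.+ b))               ≈⟨ toℚᵘ-ι (a ℤ.+ b) ⟩
  mkℚᵘ (a ℤ.+ b) 0                 ≈⟨ *≡* (≡.cong (ℤ._* + 1) (≡.sym (≡.cong₂ ℤ._+_ (ℤ.*-identityʳ a) (ℤ.*-identityʳ b)))) ⟩
  mkℚᵘ a 0 ℚᵘ.+ mkℚᵘ b 0           ≈⟨ ℚᵘ.+-cong (toℚᵘ-ι a) (toℚᵘ-ι b) ⟨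
  toℚᵘ (ι a) ℚᵘ.+ toℚᵘ (ι b)       ≈⟨ ℚ.toℚᵘ-homo-+ (ι a) (ι b) ⟨
  toℚᵘ (ι a ℚ.+ ι b)               ∎)
  where open ℚᵘ.≃-Reasoning

ι-* : ∀ a b → ι (a ℤ.* b) ≡ ι a ℚ.* ι b
ι-* a b = ℚ.toℚᵘ-injective (begin
  toℚᵘ (ι (a ℤ.* b))               ≈⟨ toℚᵘ-ι (a ℤ.* b) ⟩
  mkℚᵘ (a ℤ.* b) 0                 ≈⟨ *≡* ≡.refl ⟩
  mkℚᵘ a 0 ℚᵘ.* mkℚᵘ b 0           ≈⟨ ℚᵘ.*-cong (toℚᵘ-ι a) (toℚᵘ-ι b) ⟨
  toℚᵘ (ι a) ℚᵘ.* toℚᵘ (ι b)       ≈⟨ ℚ.toℚᵘ-homo-* (ι a) (ι b) ⟨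
  toℚᵘ (ι a ℚ.* ι b)               ∎)
  where open ℚᵘ.≃-Reasoning

ι-injective : ∀ {a b} → ι a ≡ ι b → a ≡ b
ι-injective {a} {b} e with ℚᵘ.≃-trans (ℚᵘ.≃-sym (toℚᵘ-ι a)) (ℚᵘ.≃-trans (ℚᵘ.≃-reflexive (≡.cong toℚᵘ e)) (toℚᵘ-ι b))
... | *≡* f = ≡.trans (≡.sym (ℤ.*-identityʳ a)) (≡.trans f (ℤ.*-identityʳ b))

↧*≡↥ : ∀ q → ι (↧ q) ℚ.* q ≡ ι (↥ q)
↧*≡↥ q@(mkℚ n d-1 _) = ℚ.toℚᵘ-injective (begin
  toℚᵘ (ι (↧ q) ℚ.* q)             ≈⟨ ℚ.toℚᵘ-homo-* (ι (↧ q)) q ⟩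
  toℚᵘ (ι (↧ q)) ℚᵘ.* toℚᵘ q       ≈⟨ ℚᵘ.*-congʳ (toℚᵘ-ι (↧ q)) ⟩
  mkℚᵘ (+ suc d-1) 0 ℚᵘ.* mkℚᵘ n d-1
    ≈⟨ *≡* (≡.trans (ℤ.*-identityʳ _) (≡.trans (ℤ.*-comm (+ suc d-1) n) (≡.cong (λ k → n ℤ.* + suc k) (≡.sym (ℕ.+-identityʳ d-1))))) ⟩
  mkℚᵘ n 0                         ≈⟨ toℚᵘ-ι n ⟨
  toℚᵘ (ι n)                       ∎)
  where open ℚᵘ.≃-Reasoning

ℚ-inverse : ∀ a → a ≢ ℚ.0ℚ → ∃[ b ] b ℚ.* a ≡ ℚ.1ℚ
ℚ-inverse a a≢0 = (ℚ.1/ a) {{ℚ.≢-nonZero a≢0}} , ℚ.*-inverseˡ a {{ℚ.≢-nonZero a≢0}}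

ℚ-zero-product : ∀ a b → a ℚ.* b ≡ ℚ.0ℚ → a ≡ ℚ.0ℚ ⊎ b ≡ ℚ.0ℚ
ℚ-zero-product a b e with a ℚ.≟ ℚ.0ℚ
... | yes a≡0 = inj₁ a≡0
... | no a≢0 with ℚ-inverse a a≢0
...   | a⁻¹ , f = inj₂ (≡.trans (≡.sym (ℚ.*-identityˡ b)) (≡.trans (≡.cong (ℚ._* b) (≡.sym f))
                    (≡.trans (ℚ.*-assoc a⁻¹ a b) (≡.trans (≡.cong (a⁻¹ ℚ.*_) e) (ℚ.*-zeroʳ a⁻¹)))))

module ℤDomain = PolynomialsOverDomain ℤ.+-*-rawRing _≡_ ℤ.+-*-isCommutativeRing (ℤ._≟ + 0) (λ a b → ℤ.i*j≡0⇒i≡0∨j≡0 a)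

coeff-toℚ : ∀ p i → ℚ[x].coeff (toℚ[x] p) i ≡ ι (ℤ[x].coeff p i)
coeff-toℚ [] i = ≡.refl
coeff-toℚ (a ∷ p) zero = ≡.refl
coeff-toℚ (a ∷ p) (suc i) = coeff-toℚ p i

toℚ-+ : ∀ p q → toℚ[x] (p ℤ[x].+ₚ q) ≡ toℚ[x] p ℚ[x].+ₚ toℚ[x] q
toℚ-+ [] q = ≡.refl
toℚ-+ (a ∷ p) [] = ≡.refl
toℚ-+ (a ∷ p) (b ∷ q) = ≡.cong₂ _∷_ (ι-+ a b) (toℚ-+ p q)

toℚ-scale : ∀ a q → toℚ[x] (map (a ℤ.*_) q) ≡ map (ι a ℚ.*_) (toℚ[x] q)
toℚ-scale a [] = ≡.refl
toℚ-scale a (b ∷ q) = ≡.cong₂ _∷_ (ι-* a b) (toℚ-scale a q)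

toℚ-* : ∀ p q → toℚ[x] (p ℤ[x].*ₚ q) ≡ toℚ[x] p ℚ[x].*ₚ toℚ[x] q
toℚ-* [] q = ≡.refl
toℚ-* (a ∷ p) q = ≡.trans (toℚ-+ (map (a ℤ.*_) q) _)
  (≡.cong₂ ℚ[x]._+ₚ_ (toℚ-scale a q) (≡.cong (ℚ.0ℚ ∷_) (toℚ-* p q)))

toℚ-≋ : ∀ {p q} → p ℤ[x]′.≋ q → toℚ[x] p ℚ[x]′.≋ toℚ[x] q
toℚ-≋ {p} {q} e = ℚ[x]′.coeffwise λ i →
  ≡.trans (coeff-toℚ p i) (≡.trans (≡.cong ι (ℤ[x]′.at e i)) (≡.sym (coeff-toℚ q i)))

toℚ-injective : ∀ {p q} → toℚ[x] p ℚ[x]′.≋ toℚ[x] q → p ℤ[x]′.≋ q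
toℚ-injective {p} {q} e = ℤ[x]′.coeffwise λ i →
  ι-injective (≡.trans (≡.sym (coeff-toℚ p i)) (≡.trans (ℚ[x]′.at e i) (coeff-toℚ q i)))

toℚ-Below : ∀ {n p} → ℤ[x]′.Below n p → ℚ[x]′.Below n (toℚ[x] p)
toℚ-Below {p = p} z i n≤i = ≡.trans (coeff-toℚ p i) (≡.cong ι (z i n≤i))

toℚ-Monic : ∀ {n p} → ℤ[x]′.Monic n p → ℚ[x]′.Monic n (toℚ[x] p)
toℚ-Monic {n} {p} (e , z) = ≡.trans (coeff-toℚ p n) (≡.cong ι e) , toℚ-Below {p = p} z

clear-denominators : ∀ q → ∃₂ λ N H → toℚ[x] H ℚ[x]′.≋ ℚ[x].const (ι (+ suc N)) ℚ[x].*ₚ q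
clear-denominators [] = 0 , [] , ℚ[x]′.≋-sym (ℚ[x]′.0∷[] ≡.refl)
clear-denominators (a@(mkℚ n d-1 _) ∷ q) with clear-denominators q
-- The successor of `d-1 + N * suc d-1` computes to `suc N * suc d-1`, the previous common
-- denominator times the new one.
... | N , H , e = d-1 ℕ.+ N ℕ.* suc d-1 , ((+ suc N) ℤ.* n) ∷ map ((+ suc d-1) ℤ.*_) H ,
  ℚ[x]′.≋-trans (ℚ[x]′.∷-cong head≡ tail≋) (ℚ[x]′.≋-sym (ℚ[x]′.const-* (ι (+ suc (d-1 ℕ.+ N ℕ.* suc d-1))) (a ∷ q)))
  where
  N*d : ι (+ suc (d-1 ℕ.+ N ℕ.* suc d-1)) ≡ ι (+ suc N) ℚ.* ι (+ suc d-1)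
  N*d = ≡.trans (≡.cong ι (ℤ.pos-* (suc N) (suc d-1))) (ι-* (+ suc N) (+ suc d-1))
  head≡ : ι (+ suc N ℤ.* n) ≡ ι (+ suc (d-1 ℕ.+ N ℕ.* suc d-1)) ℚ.* a
  head≡ = ≡.trans (ι-* (+ suc N) n) (≡.trans (≡.cong (ι (+ suc N) ℚ.*_) (≡.sym (↧*≡↥ a)))
    (≡.trans (≡.sym (ℚ.*-assoc (ι (+ suc N)) (ι (+ suc d-1)) a)) (≡.cong (ℚ._* a) (≡.sym N*d))))
  tail≋ : toℚ[x] (map ((+ suc d-1) ℤ.*_) H) ℚ[x]′.≋ map (ι (+ suc (d-1 ℕ.+ N ℕ.* suc d-1)) ℚ.*_) q
  tail≋ = ℚ[x]′.coeffwise λ i →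
    ≡.trans (≡.cong (λ r → ℚ[x].coeff r i) (toℚ-scale (+ suc d-1) H))
    (≡.trans (ℚ[x]′.coeff-scale (ι (+ suc d-1)) (toℚ[x] H) i)
    (≡.trans (≡.cong (ι (+ suc d-1) ℚ.*_) (≡.trans (ℚ[x]′.at e i) (ℚ[x]′.coeff-const* (ι (+ suc N)) q i)))
    (≡.trans (≡.sym (ℚ.*-assoc (ι (+ suc d-1)) (ι (+ suc N)) _))
    (≡.trans (≡.cong (ℚ._* ℚ[x].coeff q i) (≡.trans (ℚ.*-comm (ι (+ suc d-1)) _) (≡.sym N*d)))
    (≡.sym (ℚ[x]′.coeff-scale (ι (+ suc (d-1 ℕ.+ N ℕ.* suc d-1))) q i))))))

prime≢0 : ∀ {p} → Prime p → + p ≢ + 0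
prime≢0 {p} p-prime e = ℕ.≢-nonZero⁻¹ p {{prime⇒nonZero p-prime}} (ℤ.+-injective e)

-- Integral elements of ℚ(θ)

module Zx where
  open CommutativeRing ℤ[x]ᴿ public
  open RingSolver ℤ[x]ᴿ public
  open Divisibility ℤ[x]ᴿ public

module Qx where
  open CommutativeRing ℚ[x]ᴿ public
  open RingSolver ℚ[x]ᴿ public
  open Divisibility ℚ[x]ᴿ public

-- eval at a variable g mentions the equality of S, so this does not hold by refl.
eval-cong-raw : ∀ {c ℓ c′ ℓ₁ ℓ₂} (R : RawRing c ℓ) (S : RawRing c′ ℓ₁) (_~_ : RawRing.Carrier S → RawRing.Carrier S → Set ℓ₂) φ g α →
  eval R S φ g α ≡ eval R (record { RawRing S hiding (_≈_) ; _≈_ = _~_ }) φ g α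
eval-cong-raw R S _~_ φ [] α = ≡.refl
eval-cong-raw R S _~_ φ (a ∷ g) α = ≡.cong (λ z → φ a + α * z) (eval-cong-raw R S _~_ φ g α)
  where open RawRing S

module Integral (f : ℤ[x].Poly) {n : ℕ} (f-monic : ℤ[x]′.Monic n f) where

  private
    module N = NumberField f
    module ℤP = ℤ[x]′
    module ℚP = ℚ[x]′

  open Quotient ℚ[x]ᴿ (toℚ[x] f) public

  K : CommutativeRing 0ℓ 0ℓ
  K = quotientRing

  module K where
    open CommutativeRing K public
    open RingSolver K public
    open import Relation.Binary.Reasoning.Setoid setoid public

  ≈⇒~′ : ∀ {α β} → α N.≈ β → α ~ β
  ≈⇒~′ {α} {β} (q ∣ʳ, e) = congruent q (Qx.trans
    (Qx.solve 2 (λ a b → a Qx.:= b Qx.:+ (a Qx.:- b)) Qx.refl α β)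
    (Qx.+-congˡ {β} (Qx.sym (ℚP.coeffwise e))))

  ~⇒≈ : ∀ {α β} → α ~ β → α N.≈ β
  ~⇒≈ {α} {β} (congruent q e) = q ∣ʳ, ℚP.at (Qx.sym (Qx.trans (Qx.+-congʳ {Qx.- β} e)
    (Qx.solve 2 (λ b x → b Qx.:+ x Qx.:- b Qx.:= x) Qx.refl β (q Qx.* toℚ[x] f))))

  toK-cong : ∀ {p q} → p Zx.≈ q → toℚ[x] p ~ toℚ[x] q
  toK-cong e = ≈⇒~ (toℚ-≋ e)

  toK-+ : ∀ p q → toℚ[x] (p Zx.+ q) ~ toℚ[x] p K.+ toℚ[x] q
  toK-+ p q = K.reflexive (toℚ-+ p q)

  toK-* : ∀ p q → toℚ[x] (p Zx.* q) ~ toℚ[x] p K.* toℚ[x] q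
  toK-* p q = K.reflexive (toℚ-* p q)

  fromℤ-+ : ∀ a b → N.fromℤ (a ℤ.+ b) ~ N.fromℤ a K.+ N.fromℤ b
  fromℤ-+ a b = K.reflexive (≡.cong ℚ[x].const (ι-+ a b))

  fromℤ-* : ∀ a b → N.fromℤ (a ℤ.* b) ~ N.fromℤ a K.* N.fromℤ b
  fromℤ-* a b = ≈⇒~ (Qx.trans (ℚP.∷-cong (ι-* a b) ℚP.≋-refl) (Qx.sym (ℚP.const-* (ι a) (N.fromℤ b))))

  fromℤ-homomorphism : IsHomomorphism ℤ.+-*-rawRing _≡_ K N.fromℤ
  fromℤ-homomorphism = record
    { φ-cong = λ { ≡.refl → K.refl } ; φ-+ = fromℤ-+ ; φ-* = fromℤ-* ; φ-0 = ≈⇒~ (ℚP.0∷[] ≡.refl) ; φ-1 = K.refl }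

  module At (α : N.Carrier) = Evaluation ℤ.+-*-rawRing _≡_ ℤ.+-*-isCommutativeRing K N.fromℤ fromℤ-homomorphism α

  eval≡ev : ∀ g α → eval ℤ.+-*-rawRing N.ℚ⟨θ⟩ N.fromℤ g α ≡ At.ev α g
  eval≡ev g α = eval-cong-raw ℤ.+-*-rawRing N.ℚ⟨θ⟩ _~_ N.fromℤ g α

  remainder-unique : ∀ {p q} → ℚP.Below n p → ℚP.Below n q → p ~ q → p ℚP.≋ q
  remainder-unique {p} {q} z w (congruent k e) = Qx.trans
    (Qx.solve 2 (λ p q → p Qx.:= q Qx.:+ (p Qx.:- q)) Qx.refl p q)
    (Qx.trans (Qx.+-congˡ {q} (ℚP.Monic-∣-Below (toℚ-Monic {p = f} f-monic) (Qx.divides k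
      (Qx.trans (Qx.+-congʳ {Qx.- q} e) (Qx.solve 2 (λ q x → q Qx.:+ x Qx.:- q Qx.:= x) Qx.refl q (k Qx.* toℚ[x] f))))
      (ℚP.Below-+ {p = p} z (ℚP.Below-neg {p = q} w))))
      (Qx.+-identityʳ q))

  ∣⇒toK~0 : ∀ {p} → f Zx.∣ p → toℚ[x] p ~ K.0#
  ∣⇒toK~0 {p} (Zx.divides q e) = congruent (toℚ[x] q) (Qx.trans (toℚ-≋ e) (Qx.reflexive (toℚ-* q f)))

  record Reduced (p : ℤ[x].Poly) : Set where
    field
      rem   : ℤ[x].Poly
      below : ℤP.Below n rem
      cong  : toℚ[x] p ~ toℚ[x] rem
      div   : f Zx.∣ p Zx.- rem

  reduce : ∀ p → Reduced p
  reduce p = record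
    { rem = rem ; below = below
    ; cong = K.trans (toK-cong division) (K.trans (toK-+ (quot Zx.* f) rem)
        (K.trans (K.+-congʳ (∣⇒toK~0 (Zx.divides quot Zx.refl))) (K.+-identityˡ _)))
    ; div = Zx.divides quot (Zx.trans (Zx.+-congʳ {Zx.- rem} division)
        (Zx.solve 2 (λ x r → x Zx.:+ r Zx.:- r Zx.:= x) Zx.refl (quot Zx.* f) rem)) }
    where open ℤP.Division (ℤP.divide f f-monic p)

  -- Divisibility by f descends from ℚ[x] to ℤ[x] because f is monic: the remainder computed over ℤ
  -- is also the remainder over ℚ, hence zero.
  toK~0⇒∣ : ∀ p → toℚ[x] p ~ K.0# → f Zx.∣ p
  toK~0⇒∣ p e = Zx.∣-respʳ (Zx.trans (Zx.+-congˡ {p} (Zx.-‿cong rem≋0)) (Zx.+-identityʳ p)) div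
    where
    open Reduced (reduce p)
    rem≋0 : rem ℤP.≋ []
    rem≋0 = toℚ-injective (remainder-unique (toℚ-Below {p = rem} below) (λ _ _ → ≡.refl) (K.trans (K.sym cong) e))

  const-cancel : ∀ {c α β} → c ≢ ℚ.0ℚ → ℚ[x].const c K.* α ~ ℚ[x].const c K.* β → α ~ β
  const-cancel {c} {α} {β} c≢0 e = K.trans (K.sym (undo α)) (K.trans (K.*-congˡ {ℚ[x].const c⁻¹} e) (undo β))
    where
    c⁻¹ = proj₁ (ℚ-inverse c c≢0)
    c⁻¹c≡1 = proj₂ (ℚ-inverse c c≢0)
    undo : ∀ γ → ℚ[x].const c⁻¹ K.* (ℚ[x].const c K.* γ) ~ γ
    undo γ = K.trans (K.sym (K.*-assoc (ℚ[x].const c⁻¹) (ℚ[x].const c) γ))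
      (K.trans (K.*-congʳ (≈⇒~ (Qx.trans (ℚP.const-* c⁻¹ (ℚ[x].const c)) (ℚP.∷-cong c⁻¹c≡1 ℚP.≋-refl)))) (K.*-identityˡ γ))

  fromℤ-cancel : ∀ {a α β} → a ≢ + 0 → N.fromℤ a K.* α ~ N.fromℤ a K.* β → α ~ β
  fromℤ-cancel a≢0 = const-cancel (a≢0 ∘ ι-injective)

  -- Homogenising an integral equation of α = r/s.
  module _ {α} s r (αs~r : α K.* toℚ[x] s ~ toℚ[x] r) where

    homogenise : ∀ k g → ℤP.Below (suc k) g →
      ∃[ w ] At.ev α g K.* toℚ[x] (s Zx.^ k) ~ toℚ[x] (ℤ[x].const (ℤ[x].coeff g k) Zx.* r Zx.^ k Zx.+ s Zx.* w)
    homogenise k [] z = [] , K.trans (K.zeroˡ (toℚ[x] (s Zx.^ k))) (K.sym (toK-cong {ℤ[x].const (+ 0) Zx.* r Zx.^ k Zx.+ s Zx.* []} {[]} (Zx.trans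
      (Zx.+-cong (Zx.*-congʳ {r Zx.^ k} {ℤ[x].const (+ 0)} {[]} (ℤP.0∷[] ≡.refl)) (Zx.zeroʳ s)) Zx.refl)))
    homogenise zero (a ∷ g) z = [] , K.trans (K.*-identityʳ _) (K.trans
      (K.+-congˡ {ℚ[x].const (ι a)} (K.trans (K.*-congˡ {α} (At.ev-≋[] α g (ℤP.Below-0 (ℤP.Below-tail z)))) (K.zeroʳ α)))
      (K.trans (K.+-identityʳ _) (K.sym (toK-cong {q = ℤ[x].const a} (Zx.trans (Zx.+-cong (Zx.*-identityʳ (ℤ[x].const a)) (Zx.zeroʳ s)) (Zx.+-identityʳ _))))))
    -- In (a + α γ) s sᵏ the relation α s = r consumes one s in the second term, while the first
    -- keeps it. Only the leading coefficient times rᵏ⁺¹ escapes divisibility by s.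
    homogenise (suc k) (a ∷ g) z = A Zx.* S Zx.+ r Zx.* w , (begin
      (toℚ[x] A K.+ α K.* γ) K.* toℚ[x] (s Zx.* S)       ≈⟨ K.*-congˡ {toℚ[x] A K.+ α K.* γ} (toK-* s S) ⟩
      (toℚ[x] A K.+ α K.* γ) K.* (toℚ[x] s K.* toℚ[x] S)
        ≈⟨ K.solve 5 (λ a x y s t → (a K.:+ x K.:* y) K.:* (s K.:* t) K.:= s K.:* (a K.:* t) K.:+ x K.:* s K.:* (y K.:* t)) K.refl (toℚ[x] A) α γ (toℚ[x] s) (toℚ[x] S) ⟩
      toℚ[x] s K.* (toℚ[x] A K.* toℚ[x] S) K.+ α K.* toℚ[x] s K.* (γ K.* toℚ[x] S)
        ≈⟨ K.+-cong (K.*-congˡ {toℚ[x] s} (K.sym (toK-* A S))) (K.*-cong αs~r e) ⟩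
      toℚ[x] s K.* toℚ[x] (A Zx.* S) K.+ toℚ[x] r K.* toℚ[x] (L Zx.* r Zx.^ k Zx.+ s Zx.* w)
        ≈⟨ K.+-cong (toK-* s (A Zx.* S)) (toK-* r (L Zx.* r Zx.^ k Zx.+ s Zx.* w)) ⟨
      toℚ[x] (s Zx.* (A Zx.* S)) K.+ toℚ[x] (r Zx.* (L Zx.* r Zx.^ k Zx.+ s Zx.* w))
        ≈⟨ toK-+ (s Zx.* (A Zx.* S)) _ ⟨
      toℚ[x] (s Zx.* (A Zx.* S) Zx.+ r Zx.* (L Zx.* r Zx.^ k Zx.+ s Zx.* w))
        ≈⟨ toK-cong (Zx.solve 6 (λ s a r l q w → s Zx.:* a Zx.:+ r Zx.:* (l Zx.:* q Zx.:+ s Zx.:* w) Zx.:= l Zx.:* (r Zx.:* q) Zx.:+ s Zx.:* (a Zx.:+ r Zx.:* w)) Zx.refl s (A Zx.* S) r L (r Zx.^ k) w) ⟩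
      toℚ[x] (L Zx.* (r Zx.* r Zx.^ k) Zx.+ s Zx.* (A Zx.* S Zx.+ r Zx.* w)) ∎)
      where
      open K using (begin_; step-≈-⟩; step-≈-⟨; _∎)
      w = proj₁ (homogenise k g (ℤP.Below-tail z))
      e = proj₂ (homogenise k g (ℤP.Below-tail z))
      A = ℤ[x].const a
      S = s Zx.^ k
      γ = At.ev α g
      L = ℤ[x].const (ℤ[x].coeff g k)

    -- Integrality enters the removal of denominators only through this: a power of the numerator
    -- lies in the ideal (s, f) of ℤ[x], so the numerator vanishes wherever the denominator and f
    -- both do.
    integral⇒∣ : N.IsIntegral α → ∃₂ λ k w → f Zx.∣ r Zx.^ k Zx.+ s Zx.* w
    integral⇒∣ (g , (k , lead , z) , root) = k , w , toK~0⇒∣ (r Zx.^ k Zx.+ s Zx.* w) (begin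
      toℚ[x] (r Zx.^ k Zx.+ s Zx.* w)
        ≈⟨ toK-cong {ℤ[x].const (ℤ[x].coeff g k) Zx.* r Zx.^ k Zx.+ s Zx.* w} (Zx.+-congʳ {s Zx.* w} (Zx.trans
             (Zx.*-congʳ {r Zx.^ k} (ℤP.∷-cong lead (ℤP.≋-refl {[]}))) (Zx.*-identityˡ (r Zx.^ k)))) ⟨
      toℚ[x] (ℤ[x].const (ℤ[x].coeff g k) Zx.* r Zx.^ k Zx.+ s Zx.* w)  ≈⟨ e ⟨
      At.ev α g K.* toℚ[x] (s Zx.^ k)   ≈⟨ K.*-congʳ (≡.subst (_~ K.0#) (eval≡ev g α) (≈⇒~′ root)) ⟩
      K.0# K.* toℚ[x] (s Zx.^ k)        ≈⟨ K.zeroˡ (toℚ[x] (s Zx.^ k)) ⟩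
      K.0#                              ∎)
      where
      open K using (begin_; step-≈-⟩; step-≈-⟨; _∎)
      w = proj₁ (homogenise k g z)
      e = proj₂ (homogenise k g z)

  module _ {α} (removable : ∀ {p} → Prime p → ∀ s H → ℤP.Below n H →
                N.fromℤ (+ p ℤ.* s) K.* α ~ toℚ[x] H → Modulo.𝔽[x]._≋_ p H []) where

    -- By `removable` the first prime divides every coefficient of the numerator and can be
    -- cancelled; the product of the remaining primes serves as s.
    remove-primes : ∀ ps → All Prime ps → ∀ H → ℤP.Below n H →
      N.fromℤ (+ product ps) K.* α ~ toℚ[x] H → ∃[ H′ ] ℤP.Below n H′ × α ~ toℚ[x] H′
    remove-primes [] [] H z e = H , z , K.trans (K.sym (K.*-identityˡ α)) e
    remove-primes (p ∷ ps) (p-prime ∷ ps-prime) H z e = remove-primes ps ps-prime H₁ z₁ (fromℤ-cancel (prime≢0 p-prime) (begin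
      N.fromℤ (+ p) K.* (N.fromℤ (+ product ps) K.* α)   ≈⟨ K.*-assoc (N.fromℤ (+ p)) (N.fromℤ (+ product ps)) α ⟨
      N.fromℤ (+ p) K.* N.fromℤ (+ product ps) K.* α
        ≈⟨ K.*-congʳ (K.trans (K.reflexive (≡.cong N.fromℤ (ℤ.pos-* p (product ps)))) (fromℤ-* (+ p) (+ product ps))) ⟨
      N.fromℤ (+ product (p ∷ ps)) K.* α                 ≈⟨ e ⟩
      toℚ[x] H                                           ≈⟨ toK-cong H≋pH₁ ⟩
      toℚ[x] (ℤ[x].const (+ p) Zx.* H₁)                  ≈⟨ toK-* (ℤ[x].const (+ p)) H₁ ⟩
      N.fromℤ (+ p) K.* toℚ[x] H₁                        ∎))
      where
      open K using (begin_; step-≈-⟩; step-≈-⟨; _∎)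
      divided = Modulo.≋ₖ[]⇒const* p H (removable p-prime (+ product ps) H z
        (≡.subst (λ k → N.fromℤ k K.* α ~ toℚ[x] H) (ℤ.pos-* p (product ps)) e))
      H₁ = proj₁ divided
      H≋pH₁ = proj₂ divided
      z₁ : ℤP.Below n H₁
      z₁ i n≤i = ℤ.*-cancelˡ-≡ (+ p) _ (+ 0) {{ℤ.≢-nonZero (prime≢0 p-prime)}} (≡.trans
        (≡.sym (≡.trans (ℤP.at H≋pH₁ i) (ℤP.coeff-const* (+ p) H₁ i))) (≡.trans (z i n≤i) (≡.sym (ℤ.*-zeroʳ (+ p)))))

    ∈ℤ[θ] : ∃[ H ] ℤP.Below n H × α ~ toℚ[x] H
    ∈ℤ[θ] = remove-primes factors factorsPrime rem below (begin
      N.fromℤ (+ product factors) K.* α   ≡⟨ ≡.cong (λ k → N.fromℤ (+ k) K.* α) (≡.sym isFactorisation) ⟩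
      N.fromℤ (+ suc N) K.* α             ≈⟨ ≈⇒~ e ⟨
      toℚ[x] H                            ≈⟨ cong ⟩
      toℚ[x] rem                          ∎)
      where
      open K using (begin_; step-≈-⟩; step-≈-⟨; step-≡-⟩; _∎)
      N = proj₁ (clear-denominators α)
      H = proj₁ (proj₂ (clear-denominators α))
      e = proj₂ (proj₂ (clear-denominators α))
      open PrimeFactorisation (factorise (suc N))
      open Reduced (reduce H)

-- Coordinates with respect to powers of x

module Expansion {c ℓ₀ ℓ} (R : RawRing c ℓ₀)
  (_≈_ : RawRing.Carrier R → RawRing.Carrier R → Set ℓ) (isCR : IsCommutativeRingOn R _≈_) where

  open RawRing R using (Carrier; _+_; _*_; -_; 0#; 1#)

  open PolynomialRing R _≈_ isCR
  open PolynomialProperties R _≈_ isCR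
  private
    module P where
      open CommutativeRing polynomialRing public
      open RingSolver polynomialRing public
      open Divisibility polynomialRing public
      open import Algebra.Properties.Semiring.Sum semiring public
        using (sum; sum-cong-≋; *-distribˡ-sum)

  tail : Poly → Poly
  tail [] = []
  tail (a ∷ p) = p

  coeff-tail : ∀ p i → coeff (tail p) i ≡ coeff p (suc i)
  coeff-tail [] i = ≡.refl
  coeff-tail (a ∷ p) i = ≡.refl

  head-tail : ∀ p → p ≋ const (coeff p 0) +ₚ (X *ₚ tail p)
  head-tail [] = P.trans (P.sym (0∷[] (CommutativeRing.refl base))) (∷≋ 0# [])
  head-tail (a ∷ p) = ∷≋ a p

  expansion : ∀ n p → Below n p → p ≋ P.sum {n} (λ i → const (coeff p (toℕ i)) *ₚ (X P.^ toℕ i))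
  expansion zero p z = Below-0 z
  expansion (suc n) p z = P.trans (head-tail p) (P.+-cong
    (P.sym (P.*-identityʳ (const (coeff p 0))))
    (P.trans (P.*-congˡ {X} (expansion n (tail p)
        (λ i n≤i → ≡.subst (_≈ 0#) (≡.sym (coeff-tail p i)) (z (suc i) (s≤s n≤i)))))
      (P.trans (P.*-distribˡ-sum {n} X (λ i → const (coeff (tail p) (toℕ i)) *ₚ (X P.^ toℕ i)))
      (P.sum-cong-≋ {n} (λ i → P.trans
        (P.solve 3 (λ x c y → x P.:* (c P.:* y) P.:= c P.:* (x P.:* y)) P.refl X (const (coeff (tail p) (toℕ i))) (X P.^ toℕ i))
        (P.reflexive (≡.cong (λ c → const c *ₚ (X *ₚ (X P.^ toℕ i))) (coeff-tail p (toℕ i)))))))))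

-- Monic annihilators by elimination

module Elimination {c ℓ} (S : CommutativeRing c ℓ) (ev : ℤ[x].Poly → CommutativeRing.Carrier S)
  (ev-hom : IsHomomorphism ℤ[x].polyRing ℤ[x]′._≋_ S ev) where

  private
    module S = CommutativeRing S
  open IsHomomorphism ev-hom renaming (φ-cong to ev-cong; φ-+ to ev-+; φ-* to ev-*; φ-0 to ev-0; φ-1 to ev-1)
  open RingSolver S
  open ℤ[x]′ using (Monic; Below; Below-*; Below-+; Below-neg; Below-≤; leadingCoeff-*; coeff-+; coeff-neg)
  open import Algebra.Properties.Semiring.Sum S.semiring using (sum; sum-cong-≋; *-distribˡ-sum)
  open import Algebra.Properties.CommutativeMonoid.Sum S.+-commutativeMonoid using (∑-distrib-+)
  open import Relation.Binary.Reasoning.Setoid S.setoid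
  open import Algebra.Properties.Ring S.ring using (+-inverseˡ-unique)

  open import Data.Fin.Base using (zero; suc)

  ev-neg : ∀ p → ev (Zx.- p) S.≈ S.- ev p
  ev-neg p = +-inverseˡ-unique (ev (Zx.- p)) (ev p)
    (S.trans (S.sym (ev-+ (Zx.- p) p)) (S.trans (ev-cong (Zx.-‿inverseˡ p)) ev-0))

  Matrix : ℕ → Set
  Matrix n = Fin n → Fin n → ℤ[x].Poly

  -- Every permutation other than the identity contributes less than the
  -- diagonal to the degree of the determinant.
  record Dominant {n} (d : ℕ) (M : Matrix n) : Set where
    field
      diagonal    : ∀ i → Monic (suc d) (M i i)
      offDiagonal : ∀ {i j} → i ≢ j → Below (suc d) (M i j)

  Kills : ∀ {n} → Matrix n → (Fin n → S.Carrier) → Set ℓ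
  Kills M v = ∀ i → sum (λ j → ev (M i j) S.* v j) S.≈ S.0#

  private
    -- Index 1 is eliminated instead of 0, to end with an equation for v zero.
    ρ : ∀ {n} → Fin (suc n) → Fin (suc (suc n))
    ρ zero = zero
    ρ (suc i) = suc (suc i)

    ρ-injective : ∀ {n} {i j : Fin (suc n)} → ρ i ≡ ρ j → i ≡ j
    ρ-injective {i = zero} {zero} e = ≡.refl
    ρ-injective {i = suc i} {suc .i} ≡.refl = ≡.refl

    ρ≢1 : ∀ {n} (i : Fin (suc n)) → ρ i ≢ suc zero
    ρ≢1 zero ()
    ρ≢1 (suc i) ()

    -- Fraction-free elimination with the pivot in row and column 1: cross-multiplication keeps the
    -- entries polynomial.
    eliminated : ∀ {n} → Matrix (suc (suc n)) → Matrix (suc n)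
    eliminated M i j = M (suc zero) (suc zero) Zx.* M (ρ i) (ρ j) Zx.- M (ρ i) (suc zero) Zx.* M (suc zero) (ρ j)

    degrees : ∀ d → ℕ.suc (ℕ.suc d ℕ.+ d) ≡ ℕ.suc (d ℕ.+ ℕ.suc d)
    degrees d = ≡.cong ℕ.suc (≡.sym (ℕ.+-suc d d))

  -- A new diagonal entry is a product of two old ones, monic of degree 2d + 2, minus a product of
  -- two off-diagonal entries, of degree at most 2d. Off the diagonal each product has at most one
  -- diagonal factor, hence degree at most 2d + 1.
  eliminated-dominant : ∀ {n d} {M : Matrix (suc (suc n))} → Dominant d M → Dominant (d ℕ.+ suc d) (eliminated M)
  eliminated-dominant {n} {d} {M} D = record
    { diagonal = λ i →
        let p = M (suc zero) (suc zero) ; q = M (ρ i) (ρ i)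
            r = M (ρ i) (suc zero) ; s = M (suc zero) (ρ i)
            small = Below-neg {p = r Zx.* s} (product-small i i)
        in ≡.trans (coeff-+ (p Zx.* q) _ (suc d ℕ.+ suc d))
             (≡.trans (≡.cong₂ ℤ._+_ (≡.trans (leadingCoeff-* p q (proj₂ (diagonal (suc zero))) (proj₂ (diagonal (ρ i))))
                 (≡.cong₂ ℤ._*_ (proj₁ (diagonal (suc zero))) (proj₁ (diagonal (ρ i)))))
               (small _ ℕ.≤-refl)) ≡.refl)
         , Below-+ {p = p Zx.* q} (Below-* p q (proj₂ (diagonal (suc zero))) (proj₂ (diagonal (ρ i))))
             (Below-≤ {p = Zx.- (r Zx.* s)} (ℕ.n≤1+n _) small)
    ; offDiagonal = λ {i} {j} i≢j → Below-+ {p = M (suc zero) (suc zero) Zx.* M (ρ i) (ρ j)}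
        (≡.subst (λ k → Below k (M (suc zero) (suc zero) Zx.* M (ρ i) (ρ j))) (degrees d)
          (Below-* (M (suc zero) (suc zero)) (M (ρ i) (ρ j)) (proj₂ (diagonal (suc zero))) (offDiagonal (i≢j ∘ ρ-injective))))
        (Below-neg {p = M (ρ i) (suc zero) Zx.* M (suc zero) (ρ j)} (product-small i j))
    }
    where
    open Dominant D
    product-small : ∀ i j → Below (suc (d ℕ.+ suc d)) (M (ρ i) (suc zero) Zx.* M (suc zero) (ρ j))
    product-small i j = Below-≤ {p = M (ρ i) (suc zero) Zx.* M (suc zero) (ρ j)} (s≤s (ℕ.+-monoʳ-≤ d (ℕ.n≤1+n d)))
      (Below-* (M (ρ i) (suc zero)) (M (suc zero) (ρ j)) (offDiagonal (ρ≢1 i)) (offDiagonal (ρ≢1 j ∘ ≡.sym)))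

  eliminated-kills : ∀ {n} (M : Matrix (suc (suc n))) v → Kills M v → Kills (eliminated M) (v ∘ ρ)
  eliminated-kills M v kills i = begin
    sum (λ j → ev (eliminated M i j) S.* v (ρ j))
      ≈⟨ sum-cong-≋ (λ j → S.trans (S.*-congʳ (entry j))
           (solve 5 (λ p q r s v → (p :* q :+ (:- (r :* s))) :* v := p :* (q :* v) :+ (:- r) :* (s :* v)) S.refl p (ev (M (ρ i) (ρ j))) r (ev (M (suc zero) (ρ j))) (v (ρ j)))) ⟩
    sum (λ j → p S.* (ev (M (ρ i) (ρ j)) S.* v (ρ j)) S.+ (S.- r) S.* (ev (M (suc zero) (ρ j)) S.* v (ρ j)))
      ≈⟨ ∑-distrib-+ (λ j → p S.* (ev (M (ρ i) (ρ j)) S.* v (ρ j))) (λ j → (S.- r) S.* (ev (M (suc zero) (ρ j)) S.* v (ρ j))) ⟩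
    sum (λ j → p S.* (ev (M (ρ i) (ρ j)) S.* v (ρ j))) S.+ sum (λ j → (S.- r) S.* (ev (M (suc zero) (ρ j)) S.* v (ρ j)))
      ≈⟨ S.+-cong (*-distribˡ-sum p (λ j → ev (M (ρ i) (ρ j)) S.* v (ρ j))) (*-distribˡ-sum (S.- r) (λ j → ev (M (suc zero) (ρ j)) S.* v (ρ j))) ⟨
    p S.* sum (λ j → ev (M (ρ i) (ρ j)) S.* v (ρ j)) S.+ (S.- r) S.* sum (λ j → ev (M (suc zero) (ρ j)) S.* v (ρ j))
      ≈⟨ S.+-cong (S.*-congˡ (isolated (ρ i))) (S.*-congˡ (isolated (suc zero))) ⟩
    p S.* (S.- (r S.* v (suc zero))) S.+ (S.- r) S.* (S.- (p S.* v (suc zero)))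
      ≈⟨ solve 3 (λ p r v → p :* (:- (r :* v)) :+ (:- r) :* (:- (p :* v)) := con (+ 0)) S.refl p r (v (suc zero)) ⟩
    S.0#  ∎
    where
    p = ev (M (suc zero) (suc zero))
    r = ev (M (ρ i) (suc zero))
    entry : ∀ j → ev (eliminated M i j) S.≈ p S.* ev (M (ρ i) (ρ j)) S.+ (S.- (r S.* ev (M (suc zero) (ρ j))))
    entry j = S.trans (ev-+ (M (suc zero) (suc zero) Zx.* M (ρ i) (ρ j)) _) (S.+-cong (ev-* (M (suc zero) (suc zero)) (M (ρ i) (ρ j)))
      (S.trans (ev-neg (M (ρ i) (suc zero) Zx.* M (suc zero) (ρ j))) (S.-‿cong (ev-* (M (ρ i) (suc zero)) (M (suc zero) (ρ j))))))
    isolated : ∀ k → sum (λ j → ev (M k (ρ j)) S.* v (ρ j)) S.≈ S.- (ev (M k (suc zero)) S.* v (suc zero))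
    isolated k = S.trans
      (solve 3 (λ a b c → a :+ c := a :+ (b :+ c) :- b) S.refl _ (ev (M k (suc zero)) S.* v (suc zero)) _)
      (S.trans (S.+-congʳ (kills k)) (S.+-identityˡ _))

  -- When only index 0 is left, the system is a single equation, whose coefficient is a diagonal
  -- entry and therefore monic.
  monic-annihilator : ∀ {n d} (M : Matrix (suc n)) v → Dominant d M → Kills M v →
    ∃[ P ] (∃[ k ] Monic k P) × ev P S.* v zero S.≈ S.0#
  monic-annihilator {zero} {d} M v D kills =
    M zero zero , (suc d , Dominant.diagonal D zero) , S.trans (S.sym (S.+-identityʳ _)) (kills zero)
  monic-annihilator {suc n} M v D kills =
    monic-annihilator (eliminated M) (v ∘ ρ) (eliminated-dominant D) (eliminated-kills M v kills)

  δ : ∀ {n} → Matrix n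
  δ zero zero = ℤ[x].const (+ 1)
  δ zero (suc j) = []
  δ (suc i) zero = []
  δ (suc i) (suc j) = δ i j

  δ-diagonal : ∀ {n} (i : Fin n) → δ i i ≡ ℤ[x].const (+ 1)
  δ-diagonal zero = ≡.refl
  δ-diagonal (suc i) = δ-diagonal i

  δ-offDiagonal : ∀ {n} {i j : Fin n} → i ≢ j → δ i j ≡ []
  δ-offDiagonal {i = zero} {zero} i≢j = ⊥-elim (i≢j ≡.refl)
  δ-offDiagonal {i = zero} {suc j} i≢j = ≡.refl
  δ-offDiagonal {i = suc i} {zero} i≢j = ≡.refl
  δ-offDiagonal {i = suc i} {suc j} i≢j = δ-offDiagonal (i≢j ∘ ≡.cong suc)

  sum-zero : ∀ {n} (t : Fin n → S.Carrier) → (∀ i → t i S.≈ S.0#) → sum t S.≈ S.0#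
  sum-zero {zero} t z = S.refl
  sum-zero {suc n} t z = S.trans (S.+-cong (z zero) (sum-zero (t ∘ suc) (z ∘ suc))) (S.+-identityˡ _)

  sum-δ : ∀ {n} (i : Fin n) (t : Fin n → S.Carrier) → sum (λ j → ev (δ i j) S.* t j) S.≈ t i
  sum-δ {suc n} zero t = S.trans (S.+-cong (S.trans (S.*-congʳ ev-1) (S.*-identityˡ _))
    (sum-zero {n} (λ j → ev [] S.* t (suc j)) (λ j → S.trans (S.*-congʳ ev-0) (S.zeroˡ _)))) (S.+-identityʳ _)
  sum-δ (suc i) t = S.trans (S.+-cong (S.trans (S.*-congʳ ev-0) (S.zeroˡ _)) (sum-δ i (t ∘ suc))) (S.+-identityˡ _)

  -- Cayley–Hamilton, with the determinant replaced by elimination.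
  module _ {n} (A : Fin (suc n) → Fin (suc n) → ℤ) (v : Fin (suc n) → S.Carrier)
    (stable : ∀ i → ev ℤ[x].X S.* v i S.≈ sum (λ j → ev (ℤ[x].const (A i j)) S.* v j)) where

    private
      y = ev ℤ[x].X

      characteristic : Matrix (suc n)
      characteristic i j = δ i j Zx.* ℤ[x].X Zx.- ℤ[x].const (A i j)

      characteristic-dominant : Dominant 0 characteristic
      characteristic-dominant = record { diagonal = diagonal ; offDiagonal = offDiagonal }
        where
        diagonal : ∀ i → Monic 1 (characteristic i i)
        diagonal i rewrite δ-diagonal i = ≡.refl , λ { (suc (suc k)) _ → ≡.refl ; (suc zero) (s≤s ()) }
        offDiagonal : ∀ {i j} → i ≢ j → Below 1 (characteristic i j)
        offDiagonal {i} {j} i≢j rewrite δ-offDiagonal i≢j = λ { (suc k) _ → ≡.refl }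

      characteristic-kills : Kills characteristic v
      characteristic-kills i = begin
        sum (λ j → ev (characteristic i j) S.* v j)
          ≈⟨ sum-cong-≋ (λ j → S.trans (S.*-congʳ (S.trans (ev-+ (δ i j Zx.* ℤ[x].X) _) (S.+-cong (ev-* (δ i j) ℤ[x].X) (ev-neg (ℤ[x].const (A i j))))))
               (solve 4 (λ d y a v → (d :* y :+ (:- a)) :* v := d :* (y :* v) :+ (:- con (+ 1)) :* (a :* v)) S.refl (ev (δ i j)) y (ev (ℤ[x].const (A i j))) (v j))) ⟩
        sum (λ j → ev (δ i j) S.* (y S.* v j) S.+ m S.* (ev (ℤ[x].const (A i j)) S.* v j))
          ≈⟨ ∑-distrib-+ (λ j → ev (δ i j) S.* (y S.* v j)) (λ j → m S.* (ev (ℤ[x].const (A i j)) S.* v j)) ⟩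
        sum (λ j → ev (δ i j) S.* (y S.* v j)) S.+ sum (λ j → m S.* (ev (ℤ[x].const (A i j)) S.* v j))
          ≈⟨ S.+-cong (sum-δ i (λ j → y S.* v j)) (S.sym (*-distribˡ-sum m (λ j → ev (ℤ[x].const (A i j)) S.* v j))) ⟩
        y S.* v i S.+ m S.* sum (λ j → ev (ℤ[x].const (A i j)) S.* v j)   ≈⟨ S.+-congˡ (S.*-congˡ (stable i)) ⟨
        y S.* v i S.+ m S.* (y S.* v i)
          ≈⟨ solve 1 (λ x → x :+ (:- con (+ 1)) :* x := con (+ 0)) S.refl (y S.* v i) ⟩
        S.0#  ∎
        where m = S.- ⟦ + 1 ⟧ᶻ

    stable⇒annihilator : ∃[ P ] (∃[ k ] Monic k P) × ev P S.* v zero S.≈ S.0#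
    stable⇒annihilator = monic-annihilator characteristic v characteristic-dominant characteristic-kills

-- Integrality of ℤ[θ] and the power basis

module PowerBasis (f : ℤ[x].Poly) {n′ : ℕ} (f-monic : ℤ[x]′.Monic (suc n′) f) where

  private
    n = suc n′
    module N = NumberField f
    module ℤP = ℤ[x]′
    module ℚP = ℚ[x]′
  open Integral f f-monic
  open Expansion ℚ.+-*-rawRing _≡_ ℚ.+-*-isCommutativeRing using (expansion)
  open import Algebra.Properties.Semiring.Sum K.semiring using (sum; sum-cong-≋; sum-cong-≗)

  power : ℕ → N.Carrier
  power i = ℚ[x].X Qx.^ i

  power≡ : ∀ i → N.θ N.^ᴷ i ≡ power i
  power≡ zero = ≡.refl
  power≡ (suc i) = ≡.cong (N.θ N.*_) (power≡ i)

  combination : (Fin n → ℤ) → N.Carrier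
  combination a = sum (λ i → N.fromℤ (a i) N.* power (toℕ i))

  combination≡ : ∀ a → N.ℤ-combination a (λ i → N.θ N.^ᴷ toℕ i) ≡ combination a
  combination≡ a = sum-cong-≗ (λ i → ≡.cong (N.fromℤ (a i) N.*_) (power≡ (toℕ i)))

  toK-expansion : ∀ H → ℤP.Below n H → toℚ[x] H ~ combination (λ i → ℤ[x].coeff H (toℕ i))
  toK-expansion H z = K.trans (≈⇒~ (expansion n (toℚ[x] H) (toℚ-Below {p = H} z)))
    (K.reflexive (sum-cong-≗ {n} (λ i → ≡.cong (λ c → ℚ[x].const c N.* power (toℕ i)) (coeff-toℚ H (toℕ i)))))

  open import Data.Fin.Base using (zero; suc)

  coeff-tabulate : ∀ {n} (a : Fin n → ℤ) i → ℤ[x].coeff (tabulate a) (toℕ i) ≡ a i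
  coeff-tabulate a zero = ≡.refl
  coeff-tabulate a (suc i) = coeff-tabulate (a ∘ suc) i

  tabulate-Below : ∀ {n} (a : Fin n → ℤ) → ℤP.Below n (tabulate a)
  tabulate-Below {zero} a i _ = ≡.refl
  tabulate-Below {suc n} a (suc i) (s≤s l) = tabulate-Below (a ∘ suc) i l

  independent : ∀ a → combination a ~ K.0# → ∀ i → a i ≡ + 0
  independent a e i = ≡.trans (≡.sym (coeff-tabulate a i)) (ℤP.at H≋0 (toℕ i))
    where
    H = tabulate a
    H≋0 : H ℤP.≋ []
    H≋0 = toℚ-injective (remainder-unique (toℚ-Below {p = H} (tabulate-Below a)) (λ _ _ → ≡.refl)
      (K.trans (toK-expansion H (tabulate-Below a))
      (K.trans (K.reflexive (sum-cong-≗ {n} (λ j → ≡.cong (λ c → N.fromℤ c N.* power (toℕ j)) (coeff-tabulate a j)))) e)))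

  power-toℚ : ∀ i → toℚ[x] (ℤ[x].X Zx.^ i) ≡ power i
  power-toℚ zero = ≡.refl
  power-toℚ (suc i) = ≡.trans (toℚ-* ℤ[x].X (ℤ[x].X Zx.^ i)) (≡.cong (N.θ N.*_) (power-toℚ i))

  -- Multiplication by h(θ) maps the span of 1, θ, ..., θⁿ⁻¹ over ℤ into itself; the remainders of h
  -- xⁱ modulo f are the rows of its matrix.
  ℤ[θ]-integral : ∀ h → N.IsIntegral (toℚ[x] h)
  ℤ[θ]-integral h = P , (k , P-monic) ,
      -- The vector entry at index 0 is θ⁰ = 1, so annihilating it means P(α) = 0.
      ~⇒≈ (≡.subst (_~ K.0#) (≡.sym (eval≡ev P α)) (K.trans (K.sym (K.*-identityʳ _)) root))
    where
    α = toℚ[x] h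
    module E = At α
    row : (i : Fin n) → Reduced (h Zx.* ℤ[x].X Zx.^ toℕ i)
    row i = reduce (h Zx.* ℤ[x].X Zx.^ toℕ i)
    A : Fin n → Fin n → ℤ
    A i j = ℤ[x].coeff (Reduced.rem (row i)) (toℕ j)
    open Elimination K E.ev E.ev-homomorphism
    stable : ∀ i → E.ev ℤ[x].X K.* power (toℕ i) ~ sum (λ j → E.ev (ℤ[x].const (A i j)) K.* power (toℕ j))
    stable i = begin
      E.ev ℤ[x].X K.* power (toℕ i)        ≈⟨ K.*-congʳ E.ev-X ⟩
      α K.* power (toℕ i)                  ≡⟨ ≡.cong (α K.*_) (≡.sym (power-toℚ (toℕ i))) ⟩
      α K.* toℚ[x] (ℤ[x].X Zx.^ toℕ i)     ≈⟨ toK-* h (ℤ[x].X Zx.^ toℕ i) ⟨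
      toℚ[x] (h Zx.* ℤ[x].X Zx.^ toℕ i)    ≈⟨ Reduced.cong (row i) ⟩
      toℚ[x] (Reduced.rem (row i))         ≈⟨ toK-expansion (Reduced.rem (row i)) (Reduced.below (row i)) ⟩
      combination (A i)                    ≈⟨ sum-cong-≋ {n} (λ j → K.*-congʳ {power (toℕ j)} (E.ev-const (A i j))) ⟨
      sum (λ j → E.ev (ℤ[x].const (A i j)) K.* power (toℕ j)) ∎
      where open K using (begin_; step-≈-⟩; step-≈-⟨; step-≡-⟩; _∎)
    result = stable⇒annihilator A (λ j → power (toℕ j)) stable
    P = proj₁ result
    k = proj₁ (proj₁ (proj₂ result))
    P-monic = proj₂ (proj₁ (proj₂ result))
    root = proj₂ (proj₂ result)

  isIntegralBasis : (∀ {α} → N.IsIntegral α → ∀ {p} → Prime p → ∀ s H → ℤP.Below n H →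
      N.fromℤ (+ p ℤ.* s) K.* α ~ toℚ[x] H → Modulo.𝔽[x]._≋_ p H []) →
    N.IsIntegralBasis {n} (λ i → N.θ N.^ᴷ toℕ i)
  isIntegralBasis removable = record
    { integral = λ i → ≡.subst N.IsIntegral (≡.trans (power-toℚ (toℕ i)) (≡.sym (power≡ (toℕ i)))) (ℤ[θ]-integral (ℤ[x].X Zx.^ toℕ i))
    ; spanning = λ α α-integral → let H , z , e = ∈ℤ[θ] (removable α-integral) in
        (λ i → ℤ[x].coeff H (toℕ i)) ,
        ~⇒≈ (K.trans e (K.trans (toK-expansion H z) (K.reflexive (≡.sym (combination≡ (λ i → ℤ[x].coeff H (toℕ i)))))))
    ; independent = λ a e → independent a (K.trans (K.reflexive (≡.sym (combination≡ a))) (≈⇒~′ e)) }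

-- Irreducibility

open ℤ[x]′ using (_≋_; at; coeffwise; Monic; Below)
open ℤ[x] using (const; coeff; _*ₚ_)

const-cancelℤ : ∀ {a} p q → a ≢ + 0 → const a *ₚ p ≋ const a *ₚ q → p ≋ q
const-cancelℤ {a} p q a≢0 e = coeffwise λ i → ℤ.*-cancelˡ-≡ a (coeff p i) (coeff q i) {{ℤ.≢-nonZero a≢0}}
  (≡.trans (≡.sym (ℤ[x]′.coeff-const* a p i)) (≡.trans (at e i) (ℤ[x]′.coeff-const* a q i)))

-- Removing content rescales coefficients by nonzero integers, and irreducibility needs only to know
-- that a constant factor was constant before. It is therefore enough to carry along which
-- coefficients vanish.
_⊑_ : ℤ[x].Poly → ℤ[x].Poly → Set
G ⊑ G′ = ∀ i → coeff G′ i ≡ + 0 → coeff G i ≡ + 0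

const*-⊑ : ∀ {p G G₁ G′} → G ≋ const (+ p) *ₚ G₁ → G₁ ⊑ G′ → G ⊑ G′
const*-⊑ {p} {G} {G₁} e s i z = ≡.trans (at e i) (≡.trans (ℤ[x]′.coeff-const* (+ p) G₁ i)
  (≡.trans (≡.cong (+ p ℤ.*_) (s i z)) (ℤ.*-zeroʳ (+ p))))

-- Gauss's lemma, one prime at a time: G H vanishes modulo p and 𝔽ₚ[x] is a domain, so p divides one
-- of the factors and cancels.
remove-content : ∀ f ps → All Prime ps → ∀ G H → const (+ product ps) *ₚ f ≋ G *ₚ H →
  ∃₂ λ G′ H′ → f ≋ G′ *ₚ H′ × G ⊑ G′ × H ⊑ H′
remove-content f [] [] G H e = G , H , Zx.trans (Zx.sym (Zx.*-identityˡ f)) e , (λ _ z → z) , (λ _ z → z)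
remove-content f (p ∷ ps) (p-prime ∷ ps-prime) G H e = go (zero-productₚ G H GH≋0)
  where
  open ModuloPrime p-prime
  P = const (+ p)
  Q = const (+ product ps)
  pQ : P *ₚ (Q *ₚ f) ≋ G *ₚ H
  pQ = Zx.trans (Zx.sym (Zx.*-assoc P Q f)) (Zx.trans (Zx.*-congʳ {f} (Zx.trans (ℤ[x]′.const-* (+ p) Q)
    (Zx.reflexive (≡.cong const (≡.sym (ℤ.pos-* p (product ps))))))) e)
  GH≋0 : G *ₚ H 𝔽[x].≋ []
  GH≋0 = 𝔽[x].≋-trans (≋⇒≋ₖ (Zx.sym pQ)) (const*-≋ₖ[] (Q *ₚ f))
  Primitive : ℤ[x].Poly → ℤ[x].Poly → Set
  Primitive G H = ∃₂ λ G′ H′ → f ≋ G′ *ₚ H′ × G ⊑ G′ × H ⊑ H′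
  divideˡ : ∀ G₁ → G ≋ P *ₚ G₁ → Primitive G₁ H → Primitive G H
  divideˡ G₁ eG (G′ , H′ , fGH , g , h) = G′ , H′ , fGH , const*-⊑ {p} {G} {G₁} {G′} eG g , h
  divideʳ : ∀ H₁ → H ≋ P *ₚ H₁ → Primitive G H₁ → Primitive G H
  divideʳ H₁ eH (G′ , H′ , fGH , g , h) = G′ , H′ , fGH , g , const*-⊑ {p} {H} {H₁} {H′} eH h
  goˡ : (∃[ G₁ ] G ≋ P *ₚ G₁) → Primitive G H
  goˡ (G₁ , eG) = divideˡ G₁ eG (remove-content f ps ps-prime G₁ H (const-cancelℤ (Q *ₚ f) (G₁ *ₚ H) (prime≢0 p-prime)
    (Zx.trans pQ (Zx.trans (Zx.*-congʳ {H} eG) (Zx.*-assoc P G₁ H)))))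
  goʳ : (∃[ H₁ ] H ≋ P *ₚ H₁) → Primitive G H
  goʳ (H₁ , eH) = divideʳ H₁ eH (remove-content f ps ps-prime G H₁ (const-cancelℤ (Q *ₚ f) (G *ₚ H₁) (prime≢0 p-prime)
    (Zx.trans pQ (Zx.trans (Zx.*-congˡ {G} eH) (Zx.solve 3 (λ g p h → g Zx.:* (p Zx.:* h) Zx.:= p Zx.:* (g Zx.:* h)) Zx.refl G P H₁)))))
  go : G 𝔽[x].≋ [] ⊎ H 𝔽[x].≋ [] → Primitive G H
  go = [ (λ z → goˡ (≋ₖ[]⇒const* G z)) , (λ z → goʳ (≋ₖ[]⇒const* H z)) ]′

module Eisenstein {p : ℕ} (p-prime : Prime p) (f : ℤ[x].Poly) {n′ : ℕ}
  (f-monic : Monic (suc n′) f) (low : ∀ i → i ℕ.< suc n′ → + p ∣ᶻ coeff f i)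
  (b : ℤ) (f₀ : coeff f 0 ≡ + p ℤ.* b) (p∤b : ¬ (+ p ∣ᶻ b)) where

  open ModuloPrime p-prime

  private
    n = suc n′

    f≢0 : ¬ f ≋ []
    f≢0 e with ≡.trans (≡.sym (proj₁ f-monic)) (at e n)
    ... | ()

  module _ (G H : ℤ[x].Poly) (e : f ≋ G *ₚ H) (p∤H₀ : ¬ (+ p ∣ᶻ coeff H 0))
    {j G₁} (eG : G 𝔽[x].≋ 𝔽[x].shift j G₁) (G₁₀≁0 : ¬ coeff G₁ 0 ~ + 0)
    {i} (zG : Below (suc i) G) (Gᵢ≢0 : coeff G i ≢ + 0)
    {l} (zH : Below (suc l) H) (Hₗ≢0 : coeff H l ≢ + 0) where

    private
      -- Modulo p, G starts with xʲ and H with a nonzero constant, so this is the lowest nonzero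
      -- coefficient of f. As f ≡ xⁿ, it follows that j = n, so G has degree at least n and nothing
      -- is left for H.
      fⱼ : coeff f j ~ coeff G₁ 0 ℤ.* coeff H 0
      fⱼ = ~-trans (𝔽[x].at (𝔽[x].≋-trans (≋⇒≋ₖ e) (𝔽[x].≋-trans (𝔽[x].*ₚ-cong {r = H} eG 𝔽[x].≋-refl) (𝔽[x].shift-* j G₁ H))) j)
        (~-trans (≈⇒~ (≡.trans (≡.cong (coeff (𝔽[x].shift j (G₁ *ₚ H))) (≡.sym (ℕ.+-identityʳ j))) (𝔽[x].coeff-shift j (G₁ *ₚ H) 0)))
          (𝔽[x].coeff-0-* G₁ H))
      fⱼ≁0 : ¬ coeff f j ~ + 0
      fⱼ≁0 z = [ G₁₀≁0 , (λ y → p∤H₀ (~0⇒∣ y)) ]′ (~0-product _ _ (~-trans (~-sym fⱼ) z))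
      j≡n : j ≡ n
      j≡n with ℕ.<-cmp j n
      ... | tri< j<n _ _ = ⊥-elim (fⱼ≁0 (∣⇒~0 (low j j<n)))
      ... | tri≈ _ j≡n _ = j≡n
      ... | tri> _ _ n<j = ⊥-elim (fⱼ≁0 (≈⇒~ (proj₂ f-monic j n<j)))
      Gⱼ≁0 : ¬ coeff G j ≡ + 0
      Gⱼ≁0 z = G₁₀≁0 (~-trans (≈⇒~ (≡.trans (≡.sym (𝔽[x].coeff-shift j G₁ 0)) (≡.cong (coeff (𝔽[x].shift j G₁)) (ℕ.+-identityʳ j))))
        (~-trans (~-sym (𝔽[x].at eG j)) (≈⇒~ z)))
      n≤i : n ℕ.≤ i
      n≤i with n ℕ.≤? i
      ... | yes n≤i = n≤i
      ... | no n≰i = ⊥-elim (Gⱼ≁0 (zG j (≡.subst (suc i ℕ.≤_) (≡.sym j≡n) (ℕ.≰⇒> n≰i))))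
      fᵢ₊ₗ : coeff f (i ℕ.+ l) ≢ + 0
      fᵢ₊ₗ z = [ Gᵢ≢0 , Hₗ≢0 ]′ (ℤ.i*j≡0⇒i≡0∨j≡0 _ (≡.trans (≡.sym (ℤ[x]′.leadingCoeff-* G H zG zH)) (≡.trans (≡.sym (at e (i ℕ.+ l))) z)))

    degree-cofactor : l ≡ 0
    degree-cofactor = ℕ.n≤0⇒n≡0 (ℕ.≮⇒≥ λ 0<l → fᵢ₊ₗ (proj₂ f-monic (i ℕ.+ l) (ℕ.≤-trans (s≤s n≤i) (ℕ.m<m+n i 0<l))))

  constant-factor : ∀ G H → f ≋ G *ₚ H → ¬ (+ p ∣ᶻ coeff H 0) → Below 1 H
  constant-factor G H e p∤H₀ =
    [ (λ z → ⊥-elim (G≢0 z))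
    , (λ (j , G₁ , eG , G₁₀≁0) →
      [ (λ z → ⊥-elim (f≢0 (Zx.trans e (Zx.*-congʳ {H} z))))
      , (λ (i , zG , Gᵢ≢0) →
        [ (λ z → ⊥-elim (f≢0 (Zx.trans e (Zx.trans (Zx.*-congˡ {G} z) (Zx.zeroʳ G)))))
        , (λ (l , zH , Hₗ≢0) → ≡.subst (λ k → Below (suc k) H) (degree-cofactor G H e p∤H₀ {j} {G₁} eG G₁₀≁0 zG Gᵢ≢0 zH Hₗ≢0) zH)
        ]′ (ℤDomain.zero-or-leading H))
      ]′ (ℤDomain.zero-or-leading G))
    ]′ (zero-or-trailing G)
    where
    G≢0 : ¬ G 𝔽[x].≋ []
    G≢0 z = ∤1 (~0⇒∣ (~-trans (≈⇒~ (≡.sym (proj₁ f-monic)))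
      (𝔽[x].at (𝔽[x].≋-trans (≋⇒≋ₖ e) (𝔽[x].*ₚ-cong {r = H} z 𝔽[x].≋-refl)) n)))

  one-constant-factor : ∀ G H → f ≋ G *ₚ H → Below 1 G ⊎ Below 1 H
  one-constant-factor G H e with + p ∣ᶻ? coeff G 0 | + p ∣ᶻ? coeff H 0
  ... | _ | no p∤H₀ = inj₂ (constant-factor G H e p∤H₀)
  ... | no p∤G₀ | _ = inj₁ (constant-factor H G (Zx.trans e (Zx.*-comm G H)) p∤G₀)
  -- If p divides both constant terms, p² divides their product p b.
  ... | yes (ℤ∣.divides g eg) | yes (ℤ∣.divides h eh) = ⊥-elim (p∤b (ℤ∣.divides (g ℤ.* h)
    (ℤ.*-cancelˡ-≡ (+ p) b (g ℤ.* h ℤ.* + p) {{ℤ.≢-nonZero (prime≢0 p-prime)}}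
      (≡.trans (≡.sym f₀) (≡.trans (at e 0) (≡.trans (ℤ[x]′.coeff-0-* G H) (≡.trans (≡.cong₂ ℤ._*_ eg eh) (lemma g h (+ p)))))))))
    where
    lemma : ∀ g h p → g ℤ.* p ℤ.* (h ℤ.* p) ≡ p ℤ.* (g ℤ.* h ℤ.* p)
    lemma = solve-∀

  private
    Q≋ : ∀ {p q : ℚ[x].Poly} → (∀ i → ℚ[x].coeff p i ≡ ℚ[x].coeff q i) → p Qx.≈ q
    Q≋ = ℚ[x]′.coeffwise

    toℚf≢0 : ¬ toℚ[x] f Qx.≈ []
    toℚf≢0 e = f≢0 (toℚ-injective e)

    constant⇒unit : ∀ x y N Y → toℚ[x] f Qx.≈ x Qx.* y → toℚ[x] Y Qx.≈ ℚ[x].const (ι (+ suc N)) Qx.* y → Below 1 Y →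
      ∃[ u ] u Qx.* y Qx.≈ Qx.1#
    constant⇒unit x y N Y e eY z = ℚ[x].const y₀⁻¹ ,
      Qx.trans (Qx.*-congˡ {ℚ[x].const y₀⁻¹} y≋) (Qx.trans (ℚ[x]′.const-* y₀⁻¹ (ℚ[x].const y₀)) (ℚ[x]′.∷-cong (proj₂ inv) ℚ[x]′.≋-refl))
      where
      y₀ = ℚ[x].coeff y 0
      N≢0 : ι (+ suc N) ≢ ℚ.0ℚ
      N≢0 e with ι-injective {+ suc N} {+ 0} e
      ... | ()
      y≋ : y Qx.≈ ℚ[x].const y₀
      y≋ = ℚ[x]′.Below-1 λ i 1≤i → [ ⊥-elim ∘ N≢0 , id ]′ (ℚ-zero-product (ι (+ suc N)) (ℚ[x].coeff y i)
        (≡.trans (≡.sym (≡.trans (ℚ[x]′.at eY i) (ℚ[x]′.coeff-const* (ι (+ suc N)) y i)))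
          (≡.trans (coeff-toℚ Y i) (≡.cong ι (z i 1≤i)))))
      y₀≢0 : y₀ ≢ ℚ.0ℚ
      y₀≢0 z = toℚf≢0 (Qx.trans e (Qx.trans (Qx.*-congˡ {x} (Qx.trans y≋ (ℚ[x]′.0∷[] z))) (Qx.zeroʳ x)))
      inv = ℚ-inverse y₀ y₀≢0
      y₀⁻¹ = proj₁ inv

    split : ∀ x y → toℚ[x] f Qx.≈ x Qx.* y → (∃[ u ] u Qx.* x Qx.≈ Qx.1#) ⊎ (∃[ u ] u Qx.* y Qx.≈ Qx.1#)
    split x y e = conclude (remove-content f factors factorsPrime G H NMf≋GH)
      where
      cx = clear-denominators x
      cy = clear-denominators y
      N = proj₁ cx
      G = proj₁ (proj₂ cx)
      eG = proj₂ (proj₂ cx)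
      M = proj₁ cy
      H = proj₁ (proj₂ cy)
      eH = proj₂ (proj₂ cy)
      open PrimeFactorisation (factorise (suc N ℕ.* suc M))
      A = ι (+ suc N)
      B = ι (+ suc M)
      c : ι (+ product factors) ≡ A ℚ.* B
      c = ≡.trans (≡.cong (λ k → ι (+ k)) (≡.sym isFactorisation)) (≡.trans (≡.cong ι (ℤ.pos-* (suc N) (suc M))) (ι-* (+ suc N) (+ suc M)))
      NMf≋GH : const (+ product factors) *ₚ f ≋ G *ₚ H
      NMf≋GH = toℚ-injective (begin
        toℚ[x] (const (+ product factors) *ₚ f)    ≡⟨ toℚ-* (const (+ product factors)) f ⟩
        ℚ[x].const (ι (+ product factors)) Qx.* toℚ[x] f
          ≈⟨ Qx.*-cong (Qx.trans (ℚ[x]′.∷-cong c (ℚ[x]′.≋-refl {[]})) (Qx.sym (ℚ[x]′.const-* A (ℚ[x].const B)))) e ⟩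
        (ℚ[x].const A Qx.* ℚ[x].const B) Qx.* (x Qx.* y)
          ≈⟨ Qx.solve 4 (λ a b x y → a Qx.:* b Qx.:* (x Qx.:* y) Qx.:= a Qx.:* x Qx.:* (b Qx.:* y)) Qx.refl (ℚ[x].const A) (ℚ[x].const B) x y ⟩
        (ℚ[x].const A Qx.* x) Qx.* (ℚ[x].const B Qx.* y)   ≈⟨ Qx.*-cong eG eH ⟨
        toℚ[x] G Qx.* toℚ[x] H                     ≡⟨ toℚ-* G H ⟨
        toℚ[x] (G *ₚ H)                            ∎)
        where open import Relation.Binary.Reasoning.Setoid Qx.setoid
      conclude : (∃₂ λ G′ H′ → f ≋ G′ *ₚ H′ × G ⊑ G′ × H ⊑ H′) → (∃[ u ] u Qx.* x Qx.≈ Qx.1#) ⊎ (∃[ u ] u Qx.* y Qx.≈ Qx.1#)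
      conclude (G′ , H′ , fGH , g , h) = Sum.map
        (λ z → constant⇒unit y x N G (Qx.trans e (Qx.*-comm x y)) eG (λ i l → g i (z i l)))
        (λ z → constant⇒unit x y M H e eH (λ i l → h i (z i l)))
        (one-constant-factor G′ H′ fGH)

    f∤1 : ∀ q → ¬ q Qx.* toℚ[x] f Qx.≈ Qx.1#
    f∤1 q e with ℚ[x]′.at (ℚ[x]′.Monic-∣-Below (toℚ-Monic {p = f} f-monic) (Qx.divides q (Qx.sym e))
                   (ℚ[x]′.Below-≤ {n = n} {Qx.1#} (s≤s z≤n) (ℚ[x]′.Below-const ℚ.1ℚ))) 0
    ... | ()

  irreducible : IrreducibleOverℚ f
  irreducible = RawSemiringDefinitions.mkIrred (λ { (q ∣ʳ, e) → f∤1 q (Q≋ e) })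
    (λ {x} {y} e → Sum.map (λ { (u , e) → u ∣ʳ, ℚ[x]′.at e }) (λ { (u , e) → u ∣ʳ, ℚ[x]′.at e }) (split x y (Q≋ e)))

-- Valuations and the discriminant

prime-∣-prime : ∀ {p q} → Prime p → Prime q → p ℕ.∣ q → p ≡ q
prime-∣-prime p-prime q-prime p∣q with prime⇒irreducible q-prime p∣q
... | inj₁ ≡.refl = ⊥-elim (¬prime[1] p-prime)
... | inj₂ p≡q = p≡q

prime-∣-^ : ∀ {p} q k → Prime p → p ℕ.∣ q ℕ.^ k → p ℕ.∣ q
prime-∣-^ q zero p-prime d = ⊥-elim (¬prime[1] (≡.subst Prime (ℕ.∣1⇒≡1 d) p-prime))
prime-∣-^ q (suc k) p-prime d = [ (λ z → z) , prime-∣-^ q k p-prime ]′ (euclidsLemma q (q ℕ.^ k) p-prime d)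

∤⇒coprime : ∀ {p x} → Prime p → ¬ (p ℕ.∣ x) → Coprime p x
∤⇒coprime p-prime p∤x {i} (i∣p , i∣x) with prime⇒irreducible p-prime i∣p
... | inj₁ i≡1 = i≡1
... | inj₂ ≡.refl = ⊥-elim (p∤x i∣x)

coprime-* : ∀ {x y z} → Coprime x z → Coprime y z → Coprime (x ℕ.* y) z
coprime-* {x} {y} {z} cx cy {i} (i∣xy , i∣z) =
  cy (coprime-divisor {i} {x} (λ (j∣i , j∣x) → cx (j∣x , ℕ.∣-trans j∣i i∣z)) i∣xy , i∣z)

coprime-^ : ∀ {x z} k → Coprime x z → Coprime (x ℕ.^ k) z
coprime-^ {z = z} zero c = Coprimality.1-coprimeTo z
coprime-^ (suc k) c = coprime-* c (coprime-^ k c)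

coprime-∣ : ∀ {x y z} → Coprime x y → x ℕ.∣ z → y ℕ.∣ z → x ℕ.* y ℕ.∣ z
coprime-∣ {x} {y} c x∣z (ℕ.divides q ≡.refl) =
  ℕ.*-monoˡ-∣ y (coprime-divisor c (≡.subst (x ℕ.∣_) (ℕ.*-comm q y) x∣z))

largestPower-∣ : ∀ p z k → p ℕ.^ largestPower p z k ℕ.∣ z
largestPower-∣ p z zero = ℕ.1∣ z
largestPower-∣ p z (suc k) with (p ℕ.^ suc k) ℕ.∣? z
... | yes d = d
... | no _ = largestPower-∣ p z k

private
  powers : ℤ → List ℕ → ℕ
  powers z qs = product (map (λ q → q ℕ.^ ν q z) qs)

  prime-∣-powers : ∀ z {p} qs → Prime p → All Prime qs → p ℕ.∣ powers z qs → ¬ All (p ≢_) qs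
  prime-∣-powers z [] p-prime [] d [] = ¬prime[1] (≡.subst Prime (ℕ.∣1⇒≡1 d) p-prime)
  prime-∣-powers z (q ∷ qs) p-prime (q-prime ∷ qs-prime) d (p≢q ∷ p∉qs) =
    [ (λ p∣q^ → p≢q (prime-∣-prime p-prime q-prime (prime-∣-^ q (ν q z) p-prime p∣q^)))
    , (λ p∣ → prime-∣-powers z qs p-prime qs-prime p∣ p∉qs) ]′
    (euclidsLemma (q ℕ.^ ν q z) (powers z qs) p-prime d)

  -- Each factor divides z, and powers of distinct primes are coprime.
  powers-∣ : ∀ z qs → All Prime qs → Unique qs → powers z qs ℕ.∣ ∣ z ∣
  powers-∣ z [] [] [] = ℕ.1∣ ∣ z ∣
  powers-∣ z (q ∷ qs) (q-prime ∷ qs-prime) (q∉qs ∷ qs-unique) = coprime-∣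
    (coprime-^ (ν q z) (∤⇒coprime q-prime (λ d → prime-∣-powers z qs q-prime qs-prime d q∉qs)))
    (largestPower-∣ q ∣ z ∣ ∣ z ∣) (powers-∣ z qs qs-prime qs-unique)

module _ (a : ℤ) where

  private
    P? = λ p → prime? p ×-dec (p ℕ.∣? ∣ a ∣)

    divisors : All (λ p → Prime p × p ℕ.∣ ∣ a ∣) (primeDivisors a)
    divisors = all-filter P? (upTo (suc ∣ a ∣))

    primes : All Prime (primeDivisors a)
    primes = All.map proj₁ divisors

  partAt-∣ : ∀ z → partAt a z ℕ.∣ ∣ z ∣
  partAt-∣ z = powers-∣ z (primeDivisors a) primes (filter⁺ P? (upTo⁺ (suc ∣ a ∣)))

  ∤⇒∤partAt : ∀ {p} z → Prime p → ¬ (p ℕ.∣ ∣ a ∣) → ¬ (p ℕ.∣ partAt a z)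
  ∤⇒∤partAt {p} z p-prime p∤a d = prime-∣-powers z (primeDivisors a) p-prime primes d
    (All.map (λ { (_ , q∣a) ≡.refl → p∤a q∣a }) divisors)

  -- A prime p ∤ a is coprime to `partAt a z`, so a factor p² of z survives the division.
  squarefree-quotient : ∀ z → Squarefree ((∣ z ∣ ℕ./ partAt a z) {{partAt-nonZero a z}}) →
    ∀ {p} → Prime p → ¬ (+ p ∣ᶻ a) → ¬ (+ p ℤ.* + p ∣ᶻ z)
  squarefree-quotient z squarefree {p} p-prime p∤a p²∣z =
    ¬prime[1] (≡.subst Prime (squarefree p p²∣quotient) p-prime)
    where
    instance _ = partAt-nonZero a z
    M = partAt a z
    coprime : Coprime p M
    coprime = ∤⇒coprime p-prime (∤⇒∤partAt z p-prime (λ d → p∤a (∣⇒∣ᶻ d)))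
    p²∣ : p ℕ.* p ℕ.∣ M ℕ.* (∣ z ∣ ℕ./ M)
    p²∣ = ≡.subst₂ ℕ._∣_ (ℤ.abs-* (+ p) (+ p)) (≡.sym (ℕ.m*[n/m]≡n (partAt-∣ z))) (∣ᶻ⇒∣ p²∣z)
    p²∣quotient : p ℕ.* p ℕ.∣ ∣ z ∣ ℕ./ M
    p²∣quotient = coprime-divisor (coprime-* coprime coprime) p²∣

gcd≡1⇒∤ : ∀ {p} a b → Prime p → gcd a b ≡ 1ℤ → + p ∣ᶻ a → ¬ (+ p ∣ᶻ b)
gcd≡1⇒∤ a b p-prime g≡1 p∣a p∣b = ¬prime[1] (≡.subst Prime
  (ℕ.∣1⇒≡1 (≡.subst (_ ℕ.∣_) (ℤ.+-injective g≡1) (gcdℕ-greatest (∣ᶻ⇒∣ p∣a) (∣ᶻ⇒∣ p∣b)))) p-prime)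

^-distrib-* : ∀ x y k → (x ℤ.* y) ℤ.^ k ≡ x ℤ.^ k ℤ.* y ℤ.^ k
^-distrib-* x y zero = ≡.refl
^-distrib-* x y (suc k) = ≡.trans (≡.cong (x ℤ.* y ℤ.*_) (^-distrib-* x y k)) (lemma x y (x ℤ.^ k) (y ℤ.^ k))
  where
  lemma : ∀ x y a b → x ℤ.* y ℤ.* (a ℤ.* b) ≡ x ℤ.* a ℤ.* (y ℤ.* b)
  lemma = solve-∀

-- The trinomial k X^{k+1} − (k+1) X^k + 1, homogenised, has a double root at 1.
double-root : ∀ A B k → ∃[ E ] + k ℤ.* (A ℤ.* A ℤ.^ k) ℤ.- (1ℤ ℤ.+ + k) ℤ.* (A ℤ.^ k ℤ.* B) ℤ.+ B ℤ.* B ℤ.^ k ≡ (A ℤ.- B) ℤ.* (A ℤ.- B) ℤ.* E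
double-root A B zero = + 0 , lemma A B
  where
  lemma : ∀ A B → + 0 ℤ.* (A ℤ.* 1ℤ) ℤ.- (1ℤ ℤ.+ + 0) ℤ.* (1ℤ ℤ.* B) ℤ.+ B ℤ.* 1ℤ ≡ (A ℤ.- B) ℤ.* (A ℤ.- B) ℤ.* + 0
  lemma = solve-∀
double-root A B (suc k) with double-root A B k
-- If Tₖ denotes the left-hand side, then Tₖ₊₁ = B Tₖ + (k + 1) Aᵏ (A - B)².
... | E , e = B ℤ.* E ℤ.+ (1ℤ ℤ.+ + k) ℤ.* A ℤ.^ k , (begin
  (1ℤ ℤ.+ + k) ℤ.* (A ℤ.* (A ℤ.* a)) ℤ.- (1ℤ ℤ.+ (1ℤ ℤ.+ + k)) ℤ.* (A ℤ.* a ℤ.* B) ℤ.+ B ℤ.* (B ℤ.* c)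
    ≡⟨ lemma₁ A B (+ k) a c ⟩
  B ℤ.* (+ k ℤ.* (A ℤ.* a) ℤ.- (1ℤ ℤ.+ + k) ℤ.* (a ℤ.* B) ℤ.+ B ℤ.* c) ℤ.+ (1ℤ ℤ.+ + k) ℤ.* a ℤ.* ((A ℤ.- B) ℤ.* (A ℤ.- B))
    ≡⟨ ≡.cong (λ z → B ℤ.* z ℤ.+ (1ℤ ℤ.+ + k) ℤ.* a ℤ.* ((A ℤ.- B) ℤ.* (A ℤ.- B))) e ⟩
  B ℤ.* ((A ℤ.- B) ℤ.* (A ℤ.- B) ℤ.* E) ℤ.+ (1ℤ ℤ.+ + k) ℤ.* a ℤ.* ((A ℤ.- B) ℤ.* (A ℤ.- B))
    ≡⟨ lemma₂ (A ℤ.- B) B E (+ k) a ⟩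
  (A ℤ.- B) ℤ.* (A ℤ.- B) ℤ.* (B ℤ.* E ℤ.+ (1ℤ ℤ.+ + k) ℤ.* a) ∎)
  where
  open ≡.≡-Reasoning
  a = A ℤ.^ k
  c = B ℤ.^ k
  lemma₁ : ∀ A B k a c → (1ℤ ℤ.+ k) ℤ.* (A ℤ.* (A ℤ.* a)) ℤ.- (1ℤ ℤ.+ (1ℤ ℤ.+ k)) ℤ.* (A ℤ.* a ℤ.* B) ℤ.+ B ℤ.* (B ℤ.* c)
    ≡ B ℤ.* (k ℤ.* (A ℤ.* a) ℤ.- (1ℤ ℤ.+ k) ℤ.* (a ℤ.* B) ℤ.+ B ℤ.* c) ℤ.+ (1ℤ ℤ.+ k) ℤ.* a ℤ.* ((A ℤ.- B) ℤ.* (A ℤ.- B))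
  lemma₁ = solve-∀
  lemma₂ : ∀ t B E k a → B ℤ.* (t ℤ.* t ℤ.* E) ℤ.+ (1ℤ ℤ.+ k) ℤ.* a ℤ.* (t ℤ.* t) ≡ t ℤ.* t ℤ.* (B ℤ.* E ℤ.+ (1ℤ ℤ.+ k) ℤ.* a)
  lemma₂ = solve-∀

prime²-∣-cancel : ∀ {p} → Prime p → ∀ x y → ¬ (+ p ∣ᶻ x) → + p ℤ.* + p ∣ᶻ x ℤ.* y → + p ℤ.* + p ∣ᶻ y
prime²-∣-cancel {p} p-prime x y p∤x d = ∣⇒∣ᶻ (≡.subst (ℕ._∣ ∣ y ∣) (≡.sym (ℤ.abs-* (+ p) (+ p)))
  (coprime-divisor (coprime-* coprime coprime) (≡.subst₂ ℕ._∣_ (ℤ.abs-* (+ p) (+ p)) (ℤ.abs-* x y) (∣ᶻ⇒∣ d))))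
  where
  coprime : Coprime p ∣ x ∣
  coprime = ∤⇒coprime p-prime (λ z → p∤x (∣⇒∣ᶻ z))

-- With A = (n + 1)/p and B = n (1 − u)/p one has p (A − B) = t, and double-root
-- gives n 𝒟 = pⁿ⁻¹ E.
p²∣𝒟 : ∀ {p} → Prime p → ∀ n₀ u D →
  let n = 3 ℕ.+ n₀ ; N = + n ; t = 1ℤ ℤ.+ u ℤ.* N in
  t ≢ + 0 → N ℤ.^ n ℤ.* (1ℤ ℤ.- u) ℤ.^ suc n ℤ.+ u ℤ.* (N ℤ.+ 1ℤ) ℤ.^ suc n ≡ D ℤ.* t ℤ.^ 2 →
  ¬ (+ p ∣ᶻ N) → + p ∣ᶻ N ℤ.+ 1ℤ → + p ∣ᶻ 1ℤ ℤ.- u → + p ℤ.* + p ∣ᶻ D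
p²∣𝒟 {p} p-prime n₀ u D t≢0 spec p∤N (ℤ∣.divides A eA) (ℤ∣.divides w ew) =
  prime²-∣-cancel p-prime N D p∤N (ℤ∣.divides (P ℤ.^ n₀ ℤ.* E) main)
    where
    P N t : ℤ
    n : ℕ
    n = 3 ℕ.+ n₀
    P = + p
    N = + n
    t = 1ℤ ℤ.+ u ℤ.* N
    open ≡.≡-Reasoning
    B E T : ℤ
    B = N ℤ.* w
    E = proj₁ (double-root A B n)
    T = A ℤ.- B
    t≡TP : t ≡ T ℤ.* P
    t≡TP = begin
      1ℤ ℤ.+ u ℤ.* N                          ≡⟨ lemma u N ⟩
      (N ℤ.+ 1ℤ) ℤ.- N ℤ.* (1ℤ ℤ.- u)         ≡⟨ ≡.cong₂ (λ x y → x ℤ.- N ℤ.* y) eA ew ⟩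
      A ℤ.* P ℤ.- N ℤ.* (w ℤ.* P)             ≡⟨ lemma′ A P N w ⟩
      (A ℤ.- N ℤ.* w) ℤ.* P                   ∎
      where
      lemma : ∀ u N → 1ℤ ℤ.+ u ℤ.* N ≡ (N ℤ.+ 1ℤ) ℤ.- N ℤ.* (1ℤ ℤ.- u)
      lemma = solve-∀
      lemma′ : ∀ A P N w → A ℤ.* P ℤ.- N ℤ.* (w ℤ.* P) ≡ (A ℤ.- N ℤ.* w) ℤ.* P
      lemma′ = solve-∀
    powers-of : ∀ x → (x ℤ.* P) ℤ.^ suc n ≡ x ℤ.^ suc n ℤ.* P ℤ.^ suc n
    powers-of x = ^-distrib-* x P (suc n)
    numerator : N ℤ.* (D ℤ.* t ℤ.^ 2) ≡ P ℤ.^ suc n ℤ.* (T ℤ.* T ℤ.* E)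
    numerator = begin
      N ℤ.* (D ℤ.* t ℤ.^ 2)
        ≡⟨ ≡.cong (N ℤ.*_) spec ⟨
      N ℤ.* (N ℤ.^ n ℤ.* (1ℤ ℤ.- u) ℤ.^ suc n ℤ.+ u ℤ.* (N ℤ.+ 1ℤ) ℤ.^ suc n)
        ≡⟨ distr N (N ℤ.^ n) ((1ℤ ℤ.- u) ℤ.^ suc n) u ((N ℤ.+ 1ℤ) ℤ.^ suc n) ⟩
      N ℤ.^ suc n ℤ.* (1ℤ ℤ.- u) ℤ.^ suc n ℤ.+ N ℤ.* u ℤ.* (N ℤ.+ 1ℤ) ℤ.^ suc n
        ≡⟨ ≡.cong₂ (λ x y → N ℤ.^ suc n ℤ.* x ℤ.+ N ℤ.* u ℤ.* y)
             (≡.trans (≡.cong (ℤ._^ suc n) ew) (powers-of w)) (≡.trans (≡.cong (ℤ._^ suc n) eA) (powers-of A)) ⟩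
      N ℤ.^ suc n ℤ.* (w ℤ.^ suc n ℤ.* P ℤ.^ suc n) ℤ.+ N ℤ.* u ℤ.* (A ℤ.^ suc n ℤ.* P ℤ.^ suc n)
        ≡⟨ assoc (N ℤ.^ suc n) (w ℤ.^ suc n) (P ℤ.^ suc n) (N ℤ.* u) (A ℤ.^ suc n) ⟩
      P ℤ.^ suc n ℤ.* (N ℤ.^ suc n ℤ.* w ℤ.^ suc n ℤ.+ N ℤ.* u ℤ.* A ℤ.^ suc n)
        ≡⟨ ≡.cong₂ (λ x y → P ℤ.^ suc n ℤ.* (x ℤ.+ y ℤ.* A ℤ.^ suc n)) (≡.sym (^-distrib-* N w (suc n))) Nu ⟩
      P ℤ.^ suc n ℤ.* (B ℤ.^ suc n ℤ.+ (N ℤ.- B ℤ.* P) ℤ.* A ℤ.^ suc n)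
        ≡⟨ ≡.cong (P ℤ.^ suc n ℤ.*_) (trinomial B N P A (B ℤ.^ n) (A ℤ.^ n)) ⟩
      P ℤ.^ suc n ℤ.* (N ℤ.* (A ℤ.* A ℤ.^ n) ℤ.- A ℤ.* P ℤ.* (A ℤ.^ n ℤ.* B) ℤ.+ B ℤ.* B ℤ.^ n)
        ≡⟨ ≡.cong (λ z → P ℤ.^ suc n ℤ.* (N ℤ.* (A ℤ.* A ℤ.^ n) ℤ.- z ℤ.* (A ℤ.^ n ℤ.* B) ℤ.+ B ℤ.* B ℤ.^ n)) (≡.trans (≡.sym eA) (ℤ.+-comm N 1ℤ)) ⟩
      P ℤ.^ suc n ℤ.* (N ℤ.* (A ℤ.* A ℤ.^ n) ℤ.- (1ℤ ℤ.+ N) ℤ.* (A ℤ.^ n ℤ.* B) ℤ.+ B ℤ.* B ℤ.^ n)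
        ≡⟨ ≡.cong (P ℤ.^ suc n ℤ.*_) (proj₂ (double-root A B n)) ⟩
      P ℤ.^ suc n ℤ.* (T ℤ.* T ℤ.* E)  ∎
      where
      distr : ∀ N a b u c → N ℤ.* (a ℤ.* b ℤ.+ u ℤ.* c) ≡ N ℤ.* a ℤ.* b ℤ.+ N ℤ.* u ℤ.* c
      distr = solve-∀
      assoc : ∀ a b c d e → a ℤ.* (b ℤ.* c) ℤ.+ d ℤ.* (e ℤ.* c) ≡ c ℤ.* (a ℤ.* b ℤ.+ d ℤ.* e)
      assoc = solve-∀
      trinomial : ∀ B N P A b a → B ℤ.* b ℤ.+ (N ℤ.- B ℤ.* P) ℤ.* (A ℤ.* a) ≡ N ℤ.* (A ℤ.* a) ℤ.- A ℤ.* P ℤ.* (a ℤ.* B) ℤ.+ B ℤ.* b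
      trinomial = solve-∀
      Nu : N ℤ.* u ≡ N ℤ.- B ℤ.* P
      Nu = ≡.trans (lemma N u) (≡.trans (≡.cong (λ z → N ℤ.- N ℤ.* z) ew) (≡.cong (λ z → N ℤ.- z) (≡.sym (ℤ.*-assoc N w P))))
        where
        lemma : ∀ N u → N ℤ.* u ≡ N ℤ.- N ℤ.* (1ℤ ℤ.- u)
        lemma = solve-∀
    main : N ℤ.* D ≡ P ℤ.^ n₀ ℤ.* E ℤ.* (P ℤ.* P)
    main = ℤ.*-cancelˡ-≡ (t ℤ.* t) _ _ {{ℤ.≢-nonZero (λ z → [ t≢0 , t≢0 ]′ (ℤ.i*j≡0⇒i≡0∨j≡0 t z))}} (begin
      t ℤ.* t ℤ.* (N ℤ.* D)                        ≡⟨ lemma₁ t N D ⟩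
      N ℤ.* (D ℤ.* (t ℤ.* (t ℤ.* 1ℤ)))             ≡⟨ numerator ⟩
      -- Of the n + 1 = n₀ + 4 factors P, two turn T² into t² and two form the required P².
      P ℤ.* (P ℤ.* (P ℤ.* (P ℤ.* Q))) ℤ.* (T ℤ.* T ℤ.* E)
        ≡⟨ lemma₂ P Q T E ⟩
      T ℤ.* P ℤ.* (T ℤ.* P) ℤ.* (Q ℤ.* E ℤ.* (P ℤ.* P))
        ≡⟨ ≡.cong (λ z → z ℤ.* z ℤ.* (Q ℤ.* E ℤ.* (P ℤ.* P))) t≡TP ⟨
      t ℤ.* t ℤ.* (Q ℤ.* E ℤ.* (P ℤ.* P))          ∎)
      where
      Q = P ℤ.^ n₀
      lemma₁ : ∀ t N D → t ℤ.* t ℤ.* (N ℤ.* D) ≡ N ℤ.* (D ℤ.* (t ℤ.* (t ℤ.* 1ℤ)))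
      lemma₁ = solve-∀
      lemma₂ : ∀ P Q T E → P ℤ.* (P ℤ.* (P ℤ.* (P ℤ.* Q))) ℤ.* (T ℤ.* T ℤ.* E) ≡ T ℤ.* P ℤ.* (T ℤ.* P) ℤ.* (Q ℤ.* E ℤ.* (P ℤ.* P))
      lemma₂ = solve-∀

-- The polynomial ℱ

open Zx using (_≈_; _+_; _*_; -_; _-_; _^_)
open ℤ[x] using (Poly; X; coeff) renaming (const to C)
open PolynomialOperations ℤ.+-*-rawRing using (𝐷; shift)

C-* : ∀ a b → C (a ℤ.* b) ≈ C a * C b
C-* a b = Zx.sym (ℤ[x]′.const-* a (C b))

C-^ : ∀ a k → C (a ℤ.^ k) ≈ C a ^ k
C-^ a zero = Zx.refl
C-^ a (suc k) = Zx.trans (C-* a (a ℤ.^ k)) (Zx.*-congˡ {C a} (C-^ a k))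

𝐷-C : ∀ a → 𝐷 (C a) ≈ []
𝐷-C a = Zx.zeroʳ X

𝐷-C* : ∀ a p → 𝐷 (C a * p) ≈ C a * 𝐷 p
𝐷-C* a p = Zx.trans (ℤ[x]′.𝐷-* (C a) p) (Zx.+-congʳ {C a * 𝐷 p} (Zx.*-congʳ {p} (𝐷-C a)))

𝐷-X : 𝐷 X ≈ C 1ℤ
𝐷-X = Zx.trans (Zx.+-congˡ {C 1ℤ} (Zx.trans (Zx.*-congˡ {X} (𝐷-C 1ℤ)) (Zx.zeroʳ X))) (Zx.+-identityʳ (C 1ℤ))

𝐷-X^ : ∀ k → 𝐷 (X ^ suc k) ≈ C (+ suc k) * X ^ k
𝐷-X^ zero = Zx.trans (ℤ[x]′.𝐷-cong (Zx.*-identityʳ X)) (Zx.trans 𝐷-X (Zx.sym (Zx.*-identityʳ (C 1ℤ))))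
𝐷-X^ (suc k) = begin
  𝐷 (X * X ^ suc k)                                 ≈⟨ ℤ[x]′.𝐷-* X (X ^ suc k) ⟩
  𝐷 X * (X * X ^ k) + X * 𝐷 (X ^ suc k)             ≈⟨ Zx.+-cong (Zx.*-congʳ {X * X ^ k} 𝐷-X) (Zx.*-congˡ {X} (𝐷-X^ k)) ⟩
  C 1ℤ * (X * X ^ k) + X * (C (+ suc k) * X ^ k)
    ≈⟨ Zx.solve 4 (λ o x y c → o Zx.:* (x Zx.:* y) Zx.:+ x Zx.:* (c Zx.:* y) Zx.:= (o Zx.:+ c) Zx.:* (x Zx.:* y)) Zx.refl (C 1ℤ) X (X ^ k) (C (+ suc k)) ⟩
  (C 1ℤ + C (+ suc k)) * (X * X ^ k)                ∎
  where open import Relation.Binary.Reasoning.Setoid Zx.setoid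

coeff-X^ : ∀ n i → i ℕ.< n → coeff (X ^ n) i ≡ + 0
coeff-X^ (suc n) zero i<n = ℤ[x]′.at (ℤ[x]′.X* (X ^ n)) 0
coeff-X^ (suc n) (suc i) (s≤s i<n) = ≡.trans (ℤ[x]′.at (ℤ[x]′.X* (X ^ n)) (suc i)) (coeff-X^ n i i<n)

X^-monic : ∀ n → ℤ[x]′.Monic n (X ^ n)
X^-monic zero = ≡.refl , ℤ[x]′.Below-const 1ℤ
X^-monic (suc n) = ≡.trans (ℤ[x]′.at (ℤ[x]′.X* (X ^ n)) (suc n)) (proj₁ (X^-monic n)) ,
  ℤ[x]′.Below-cong {q = X * X ^ n} (Zx.sym (ℤ[x]′.X* (X ^ n))) (ℤ[x]′.Below-∷ (proj₂ (X^-monic n)))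

id-homomorphism : IsHomomorphism ℤ.+-*-rawRing _≡_ ℤ.+-*-commutativeRing id
id-homomorphism = record { φ-cong = id ; φ-+ = λ _ _ → ≡.refl ; φ-* = λ _ _ → ≡.refl ; φ-0 = ≡.refl ; φ-1 = ≡.refl }

module EvalAt = Evaluation ℤ.+-*-rawRing _≡_ ℤ.+-*-isCommutativeRing ℤ.+-*-commutativeRing id id-homomorphism

ev₀ : ∀ p → EvalAt.ev (+ 0) p ≡ coeff p 0
ev₀ [] = ≡.refl
ev₀ (a ∷ p) = ≡.trans (≡.cong (λ z → a ℤ.+ z) (ℤ.*-zeroˡ (EvalAt.ev (+ 0) p))) (ℤ.+-identityʳ a)

module Trinomial (n₁ : ℕ) (m b : ℤ) (f w : Poly) (f≈ : f ≈ X ^ suc n₁ + C b * w)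
  (geometric : C (m ℤ.^ 2) * X * w + C 1ℤ ≈ w + (C (m ℤ.^ 2) * X) ^ suc n₁) where

  open import Relation.Binary.Reasoning.Setoid Zx.setoid

  n : ℕ
  n = suc n₁

  N u : ℤ
  N = + n
  u = b ℤ.* m ℤ.^ (2 ℕ.* n)

  Y : Poly
  Y = C (m ℤ.^ 2) * X

  a c : ℤ
  a = (N ℤ.+ 1ℤ) ℤ.* m ℤ.^ 2
  c = N ℤ.* (1ℤ ℤ.- u)

  -- Differentiating the trinomial gives (m² θ − 1) f′(θ) = θⁿ⁻¹ L(θ).
  L : Poly
  L = C a * X + C (ℤ.- c)

  bYⁿ : C b * Y ^ n ≈ C u * X ^ n
  bYⁿ = begin
    C b * Y ^ n                            ≈⟨ Zx.*-congˡ {C b} (Zx.^-distrib-* (C (m ℤ.^ 2)) X n) ⟩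
    C b * (C (m ℤ.^ 2) ^ n * X ^ n)        ≈⟨ Zx.*-congˡ {C b} (Zx.*-congʳ {X ^ n} (C-^ (m ℤ.^ 2) n)) ⟨
    C b * (C ((m ℤ.^ 2) ℤ.^ n) * X ^ n)    ≡⟨ ≡.cong (λ z → C b * (C z * X ^ n)) (ℤ.^-*-assoc m 2 n) ⟩
    C b * (C (m ℤ.^ (2 ℕ.* n)) * X ^ n)    ≈⟨ Zx.*-assoc (C b) (C (m ℤ.^ (2 ℕ.* n))) (X ^ n) ⟨
    C b * C (m ℤ.^ (2 ℕ.* n)) * X ^ n      ≈⟨ Zx.*-congʳ {X ^ n} (C-* b (m ℤ.^ (2 ℕ.* n))) ⟨
    C u * X ^ n                            ∎

  -- Follows from (Y - 1) w = Yⁿ - 1 and b Yⁿ = u xⁿ. The identity is (m² x - 1) f = m² xⁿ⁺¹ + (u -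
  -- 1) xⁿ - b with the negative terms moved across.
  trinomial : Y * f + X ^ n + C b ≈ f + Y * X ^ n + C u * X ^ n
  trinomial = begin
    Y * f + X ^ n + C b
      ≈⟨ Zx.+-cong (Zx.+-congʳ {X ^ n} (Zx.*-congˡ {Y} f≈)) (Zx.sym (Zx.*-identityʳ (C b))) ⟩
    Y * (X ^ n + C b * w) + X ^ n + C b * C 1ℤ
      ≈⟨ Zx.solve 5 (λ y x b w o → y Zx.:* (x Zx.:+ b Zx.:* w) Zx.:+ x Zx.:+ b Zx.:* o Zx.:= x Zx.:+ y Zx.:* x Zx.:+ b Zx.:* (y Zx.:* w Zx.:+ o)) Zx.refl Y (X ^ n) (C b) w (C 1ℤ) ⟩
    X ^ n + Y * X ^ n + C b * (Y * w + C 1ℤ)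
      ≈⟨ Zx.+-congˡ {X ^ n + Y * X ^ n} (Zx.*-congˡ {C b} geometric) ⟩
    X ^ n + Y * X ^ n + C b * (w + Y ^ n)
      ≈⟨ Zx.solve 5 (λ y x b w z → x Zx.:+ y Zx.:* x Zx.:+ b Zx.:* (w Zx.:+ z) Zx.:= x Zx.:+ b Zx.:* w Zx.:+ y Zx.:* x Zx.:+ b Zx.:* z) Zx.refl Y (X ^ n) (C b) w (Y ^ n) ⟩
    X ^ n + C b * w + Y * X ^ n + C b * Y ^ n
      ≈⟨ Zx.+-cong (Zx.+-congʳ {Y * X ^ n} (Zx.sym f≈)) bYⁿ ⟩
    f + Y * X ^ n + C u * X ^ n  ∎

  private
    M² = C (m ℤ.^ 2)

    𝐷Y : 𝐷 Y ≈ M²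
    𝐷Y = Zx.trans (𝐷-C* (m ℤ.^ 2) X) (Zx.trans (Zx.*-congˡ {M²} 𝐷-X) (Zx.*-identityʳ M²))

    𝐷Y* : ∀ p → 𝐷 (Y * p) ≈ M² * p + Y * 𝐷 p
    𝐷Y* p = Zx.trans (ℤ[x]′.𝐷-* Y p) (Zx.+-congʳ {Y * 𝐷 p} (Zx.*-congʳ {p} 𝐷Y))

  𝐷L : 𝐷 L ≈ C a
  𝐷L = begin
    𝐷 (C a * X + C (ℤ.- c))        ≈⟨ ℤ[x]′.𝐷-+ (C a * X) (C (ℤ.- c)) ⟩
    𝐷 (C a * X) + 𝐷 (C (ℤ.- c))    ≈⟨ Zx.+-cong (𝐷-C* a X) (𝐷-C (ℤ.- c)) ⟩
    C a * 𝐷 X + []                 ≈⟨ Zx.+-identityʳ (C a * 𝐷 X) ⟩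
    C a * 𝐷 X                      ≈⟨ Zx.*-congˡ {C a} 𝐷-X ⟩
    C a * C 1ℤ                     ≈⟨ Zx.*-identityʳ (C a) ⟩
    C a                            ∎

  derivative : M² * f + Y * 𝐷 f ≈ 𝐷 f + X ^ n₁ * L
  derivative = begin
    M² * f + Y * 𝐷 f
      ≈⟨ Zx.solve 2 (λ z y → z Zx.:= z Zx.:+ y Zx.:+ Zx.con (+ 0) Zx.:- y) Zx.refl (M² * f + Y * 𝐷 f) (C N * X ^ n₁) ⟩
    M² * f + Y * 𝐷 f + C N * X ^ n₁ + [] - C N * X ^ n₁
      ≈⟨ Zx.+-congʳ { - (C N * X ^ n₁)} differentiated ⟩
    𝐷 f + (M² * X ^ n + Y * (C N * X ^ n₁)) + C u * (C N * X ^ n₁) - C N * X ^ n₁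
      ≈⟨ Zx.solve 6 (λ d m x y n u → d Zx.:+ (m Zx.:* (x Zx.:* y) Zx.:+ m Zx.:* x Zx.:* (n Zx.:* y)) Zx.:+ u Zx.:* (n Zx.:* y) Zx.:- n Zx.:* y
           Zx.:= d Zx.:+ (y Zx.:* (n Zx.:* m Zx.:* x Zx.:+ m Zx.:* x) Zx.:+ y Zx.:* (n Zx.:* u Zx.:- n))) Zx.refl (𝐷 f) M² X (X ^ n₁) (C N) (C u) ⟩
    𝐷 f + (X ^ n₁ * (C N * M² * X + M² * X) + X ^ n₁ * (C N * C u - C N))
      ≈⟨ Zx.+-congˡ {𝐷 f} (Zx.trans (Zx.sym (Zx.distribˡ (X ^ n₁) (C N * M² * X + M² * X) (C N * C u - C N)))
           (Zx.*-congˡ {X ^ n₁} (Zx.+-cong aX L₀))) ⟩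
    𝐷 f + X ^ n₁ * L ∎
    where
    aX : C N * M² * X + M² * X ≈ C a * X
    aX = begin
      C N * M² * X + M² * X      ≈⟨ Zx.+-congˡ {C N * M² * X} (Zx.*-congʳ {X} (Zx.*-identityˡ M²)) ⟨
      C N * M² * X + C 1ℤ * M² * X
        ≈⟨ Zx.solve 4 (λ n o m x → n Zx.:* m Zx.:* x Zx.:+ o Zx.:* m Zx.:* x Zx.:= (n Zx.:+ o) Zx.:* m Zx.:* x) Zx.refl (C N) (C 1ℤ) M² X ⟩
      C (N ℤ.+ 1ℤ) * M² * X      ≈⟨ Zx.*-congʳ {X} (C-* (N ℤ.+ 1ℤ) (m ℤ.^ 2)) ⟨
      C a * X                    ∎
    L₀ : C N * C u - C N ≈ C (ℤ.- c)
    L₀ = Zx.trans (Zx.+-congʳ { - C N} (Zx.sym (C-* N u))) (Zx.reflexive (≡.cong C (lemma N u)))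
      where
      lemma : ∀ N u → N ℤ.* u ℤ.+ ℤ.- N ≡ ℤ.- (N ℤ.* (1ℤ ℤ.- u))
      lemma = solve-∀
    differentiated : M² * f + Y * 𝐷 f + C N * X ^ n₁ + [] ≈ 𝐷 f + (M² * X ^ n + Y * (C N * X ^ n₁)) + C u * (C N * X ^ n₁)
    differentiated = begin
      M² * f + Y * 𝐷 f + C N * X ^ n₁ + []
        ≈⟨ Zx.+-cong (Zx.+-cong (𝐷Y* f) (𝐷-X^ n₁)) (𝐷-C b) ⟨
      𝐷 (Y * f) + 𝐷 (X ^ n) + 𝐷 (C b)
        ≈⟨ Zx.trans (ℤ[x]′.𝐷-+ (Y * f + X ^ n) (C b)) (Zx.+-congʳ {𝐷 (C b)} (ℤ[x]′.𝐷-+ (Y * f) (X ^ n))) ⟨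
      𝐷 (Y * f + X ^ n + C b)                     ≈⟨ ℤ[x]′.𝐷-cong trinomial ⟩
      𝐷 (f + Y * X ^ n + C u * X ^ n)
        ≈⟨ Zx.trans (ℤ[x]′.𝐷-+ (f + Y * X ^ n) (C u * X ^ n)) (Zx.+-cong (ℤ[x]′.𝐷-+ f (Y * X ^ n)) (𝐷-C* u (X ^ n))) ⟩
      𝐷 f + 𝐷 (Y * X ^ n) + C u * 𝐷 (X ^ n)
        ≈⟨ Zx.+-cong (Zx.+-congˡ {𝐷 f} (Zx.trans (𝐷Y* (X ^ n)) (Zx.+-congˡ {M² * X ^ n} (Zx.*-congˡ {Y} (𝐷-X^ n₁))))) (Zx.*-congˡ {C u} (𝐷-X^ n₁)) ⟩
      𝐷 f + (M² * X ^ n + Y * (C N * X ^ n₁)) + C u * (C N * X ^ n₁) ∎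

  -- At a point with m² ξ = 1 the second derivative of f drops out. If f′ and L vanish there as
  -- well, what remains is ξⁿ⁻¹ a = 0; this excludes a double root at 1/m².
  derivative² : M² * 𝐷 f + (M² * 𝐷 f + Y * 𝐷 (𝐷 f)) ≈ 𝐷 (𝐷 f) + (𝐷 (X ^ n₁) * L + X ^ n₁ * C a)
  derivative² = begin
    M² * 𝐷 f + (M² * 𝐷 f + Y * 𝐷 (𝐷 f))        ≈⟨ Zx.+-cong (𝐷-C* (m ℤ.^ 2) f) (𝐷Y* (𝐷 f)) ⟨
    𝐷 (M² * f) + 𝐷 (Y * 𝐷 f)                   ≈⟨ ℤ[x]′.𝐷-+ (M² * f) (Y * 𝐷 f) ⟨
    𝐷 (M² * f + Y * 𝐷 f)                       ≈⟨ ℤ[x]′.𝐷-cong derivative ⟩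
    𝐷 (𝐷 f + X ^ n₁ * L)                       ≈⟨ ℤ[x]′.𝐷-+ (𝐷 f) (X ^ n₁ * L) ⟩
    𝐷 (𝐷 f) + 𝐷 (X ^ n₁ * L)
      ≈⟨ Zx.+-congˡ {𝐷 (𝐷 f)} (Zx.trans (ℤ[x]′.𝐷-* (X ^ n₁) L) (Zx.+-congˡ {𝐷 (X ^ n₁) * L} (Zx.*-congˡ {X ^ n₁} 𝐷L))) ⟩
    𝐷 (𝐷 f) + (𝐷 (X ^ n₁) * L + X ^ n₁ * C a)  ∎

  coeff-w : coeff w 0 ≡ 1ℤ
  coeff-w = ≡.trans (≡.trans (≡.sym (ℤ.+-identityʳ _)) (≡.sym (≡.trans (ℤ[x]′.coeff-+ w (Y ^ n) 0) (≡.cong (λ z → coeff w 0 ℤ.+ z) Yⁿ₀))))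
    (≡.trans (≡.sym (ℤ[x]′.at geometric 0)) (≡.trans (ℤ[x]′.coeff-+ (Y * w) (C 1ℤ) 0) (≡.cong (λ z → z ℤ.+ 1ℤ) (Y* w))))
    where
    Y₀ : coeff Y 0 ≡ + 0
    Y₀ = ≡.trans (ℤ[x]′.coeff-const* (m ℤ.^ 2) X 0) (ℤ.*-zeroʳ (m ℤ.^ 2))
    Y* : ∀ p → coeff (Y * p) 0 ≡ + 0
    Y* p = ≡.trans (ℤ[x]′.coeff-0-* Y p) (≡.trans (≡.cong (ℤ._* coeff p 0) Y₀) (ℤ.*-zeroˡ (coeff p 0)))
    Yⁿ₀ : coeff (Y ^ n) 0 ≡ + 0
    Yⁿ₀ = Y* (Y ^ n₁)

  coeff-f : ∀ i → coeff f i ≡ coeff (X ^ n) i ℤ.+ b ℤ.* coeff w i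
  coeff-f i = ≡.trans (ℤ[x]′.at f≈ i) (≡.trans (ℤ[x]′.coeff-+ (X ^ n) (C b * w) i) (≡.cong (λ z → coeff (X ^ n) i ℤ.+ z) (ℤ[x]′.coeff-const* b w i)))

  coeff-f₀ : coeff f 0 ≡ b
  coeff-f₀ = ≡.trans (coeff-f 0) (≡.trans (≡.cong₂ (λ x y → x ℤ.+ b ℤ.* y) (coeff-X^ n 0 (s≤s z≤n)) coeff-w)
    (≡.trans (ℤ.+-identityˡ _) (ℤ.*-identityʳ b)))

^≡ : ∀ x k → x ℤ∣.^ k ≡ x ℤ.^ k
^≡ x zero = ≡.refl
^≡ x (suc k) = ≡.cong (x ℤ.*_) (^≡ x k)

module _ (k : ℕ) where
  open Modulo k
  open CommutativeRing quotientRing using (setoid)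
  open import Relation.Binary.Reasoning.Setoid setoid

  ~-^ : ∀ {x y} j → x ~ y → x ℤ.^ j ~ y ℤ.^ j
  ~-^ zero e = ≈⇒~ ≡.refl
  ~-^ (suc j) e = ~-* e (~-^ j e)

  -- Up to sign, the resultant of f and L is t 𝒟.
  resultant : ∀ n m b ξ F D →
    let N = + n ; u = b ℤ.* m ℤ.^ (2 ℕ.* n) ; M = m ℤ.^ 2 ; a = (N ℤ.+ 1ℤ) ℤ.* M ; t = 1ℤ ℤ.+ u ℤ.* N in
    M ℤ.* ξ ℤ.* F ℤ.+ ξ ℤ.^ n ℤ.+ b ≡ F ℤ.+ M ℤ.* ξ ℤ.* ξ ℤ.^ n ℤ.+ u ℤ.* ξ ℤ.^ n →
    N ℤ.^ n ℤ.* (1ℤ ℤ.- u) ℤ.^ suc n ℤ.+ u ℤ.* (N ℤ.+ 1ℤ) ℤ.^ suc n ≡ D ℤ.* t ℤ.^ 2 →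
    a ℤ.* ξ ~ N ℤ.* (1ℤ ℤ.- u) → t ℤ.^ 2 ℤ.* D ~ a ℤ.^ n ℤ.* t ℤ.* F
  resultant n m b ξ F D T spec aξ = begin
    t ℤ.^ 2 ℤ.* D                            ≡⟨ ≡.trans (ℤ.*-comm (t ℤ.^ 2) D) (≡.sym spec) ⟩
    N ℤ.^ n ℤ.* (v ℤ.* v ℤ.^ n) ℤ.+ u ℤ.* ((N ℤ.+ 1ℤ) ℤ.* (N ℤ.+ 1ℤ) ℤ.^ n)
      ≡⟨ ≡.cong₂ ℤ._+_
           (≡.trans (lemma₁ (N ℤ.^ n) v (v ℤ.^ n)) (≡.cong (v ℤ.*_) (≡.sym (^-distrib-* N v n))))
           (≡.trans (lemma₂ b (m ℤ.^ (2 ℕ.* n)) (N ℤ.+ 1ℤ) ((N ℤ.+ 1ℤ) ℤ.^ n))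
             (≡.cong (λ z → (N ℤ.+ 1ℤ) ℤ.* b ℤ.* z) (≡.trans (≡.cong ((N ℤ.+ 1ℤ) ℤ.^ n ℤ.*_) (≡.sym (ℤ.^-*-assoc m 2 n))) (≡.sym (^-distrib-* (N ℤ.+ 1ℤ) M n))))) ⟩
    v ℤ.* c ℤ.^ n ℤ.+ (N ℤ.+ 1ℤ) ℤ.* b ℤ.* a ℤ.^ n
      -- The coefficient v is split as (N + 1) v - c: once this c is replaced by a ξ, N + 1 becomes
      -- a common factor and the trinomial identity at ξ applies.
      ≡⟨ lemma₃ N v (c ℤ.^ n) b (a ℤ.^ n) ⟩
    (N ℤ.+ 1ℤ) ℤ.* v ℤ.* c ℤ.^ n ℤ.+ (N ℤ.+ 1ℤ) ℤ.* b ℤ.* a ℤ.^ n ℤ.- c ℤ.* c ℤ.^ n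
      ≈⟨ ~-+ (~-+ (~-* (≈⇒~ {(N ℤ.+ 1ℤ) ℤ.* v} ≡.refl) c^n) (≈⇒~ {(N ℤ.+ 1ℤ) ℤ.* b ℤ.* a ℤ.^ n} ≡.refl)) (~-neg (~-* (~-sym aξ) c^n)) ⟩
    (N ℤ.+ 1ℤ) ℤ.* v ℤ.* (a ℤ.^ n ℤ.* ξ ℤ.^ n) ℤ.+ (N ℤ.+ 1ℤ) ℤ.* b ℤ.* a ℤ.^ n ℤ.- a ℤ.* ξ ℤ.* (a ℤ.^ n ℤ.* ξ ℤ.^ n)
      ≡⟨ lemma₄ N M u b ξ (ξ ℤ.^ n) (a ℤ.^ n) ⟩
    (N ℤ.+ 1ℤ) ℤ.* a ℤ.^ n ℤ.* (ξ ℤ.^ n ℤ.+ b ℤ.- M ℤ.* ξ ℤ.* ξ ℤ.^ n ℤ.- u ℤ.* ξ ℤ.^ n)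
      ≡⟨ ≡.cong ((N ℤ.+ 1ℤ) ℤ.* a ℤ.^ n ℤ.*_) (solved M ξ F (ξ ℤ.^ n) b u T) ⟩
    (N ℤ.+ 1ℤ) ℤ.* a ℤ.^ n ℤ.* (F ℤ.- M ℤ.* ξ ℤ.* F)
      ≡⟨ lemma₅ N (a ℤ.^ n) F M ξ ⟩
    a ℤ.^ n ℤ.* (N ℤ.+ 1ℤ ℤ.- a ℤ.* ξ) ℤ.* F
      ≈⟨ ~-* (~-* (≈⇒~ {a ℤ.^ n} ≡.refl) (~-+ (≈⇒~ {N ℤ.+ 1ℤ} ≡.refl) (~-neg aξ))) (≈⇒~ {F} ≡.refl) ⟩
    a ℤ.^ n ℤ.* (N ℤ.+ 1ℤ ℤ.- c) ℤ.* F      ≡⟨ ≡.cong (λ z → a ℤ.^ n ℤ.* z ℤ.* F) (lemma₆ N u) ⟩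
    a ℤ.^ n ℤ.* t ℤ.* F ∎
    where
    N = + n
    u = b ℤ.* m ℤ.^ (2 ℕ.* n)
    v = 1ℤ ℤ.- u
    M = m ℤ.^ 2
    a = (N ℤ.+ 1ℤ) ℤ.* M
    c = N ℤ.* v
    t = 1ℤ ℤ.+ u ℤ.* N
    c^n : c ℤ.^ n ~ a ℤ.^ n ℤ.* ξ ℤ.^ n
    c^n = ~-trans (~-^ n (~-sym aξ)) (≈⇒~ (^-distrib-* a ξ n))
    lemma₁ : ∀ x v y → x ℤ.* (v ℤ.* y) ≡ v ℤ.* (x ℤ.* y)
    lemma₁ = solve-∀
    lemma₂ : ∀ b x y z → b ℤ.* x ℤ.* (y ℤ.* z) ≡ y ℤ.* b ℤ.* (z ℤ.* x)
    lemma₂ = solve-∀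
    lemma₃ : ∀ N v x b y → v ℤ.* x ℤ.+ (N ℤ.+ 1ℤ) ℤ.* b ℤ.* y ≡ (N ℤ.+ 1ℤ) ℤ.* v ℤ.* x ℤ.+ (N ℤ.+ 1ℤ) ℤ.* b ℤ.* y ℤ.- N ℤ.* v ℤ.* x
    lemma₃ = solve-∀
    lemma₄ : ∀ N M u b ξ x y → (N ℤ.+ 1ℤ) ℤ.* (1ℤ ℤ.- u) ℤ.* (y ℤ.* x) ℤ.+ (N ℤ.+ 1ℤ) ℤ.* b ℤ.* y ℤ.- (N ℤ.+ 1ℤ) ℤ.* M ℤ.* ξ ℤ.* (y ℤ.* x)
      ≡ (N ℤ.+ 1ℤ) ℤ.* y ℤ.* (x ℤ.+ b ℤ.- M ℤ.* ξ ℤ.* x ℤ.- u ℤ.* x)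
    lemma₄ = solve-∀
    lemma₅ : ∀ N y F M ξ → (N ℤ.+ 1ℤ) ℤ.* y ℤ.* (F ℤ.- M ℤ.* ξ ℤ.* F) ≡ y ℤ.* (N ℤ.+ 1ℤ ℤ.- (N ℤ.+ 1ℤ) ℤ.* M ℤ.* ξ) ℤ.* F
    lemma₅ = solve-∀
    lemma₆ : ∀ N u → N ℤ.+ 1ℤ ℤ.- N ℤ.* (1ℤ ℤ.- u) ≡ 1ℤ ℤ.+ u ℤ.* N
    lemma₆ = solve-∀
    solved : ∀ M ξ F x b u → M ℤ.* ξ ℤ.* F ℤ.+ x ℤ.+ b ≡ F ℤ.+ M ℤ.* ξ ℤ.* x ℤ.+ u ℤ.* x → x ℤ.+ b ℤ.- M ℤ.* ξ ℤ.* x ℤ.- u ℤ.* x ≡ F ℤ.- M ℤ.* ξ ℤ.* F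
    solved M ξ F x b u e = ≡.trans (l M ξ F x b u) (≡.trans (≡.cong (λ z → z ℤ.- M ℤ.* ξ ℤ.* F ℤ.- M ℤ.* ξ ℤ.* x ℤ.- u ℤ.* x) e) (r M ξ F x u))
      where
      l : ∀ M ξ F x b u → x ℤ.+ b ℤ.- M ℤ.* ξ ℤ.* x ℤ.- u ℤ.* x ≡ M ℤ.* ξ ℤ.* F ℤ.+ x ℤ.+ b ℤ.- M ℤ.* ξ ℤ.* F ℤ.- M ℤ.* ξ ℤ.* x ℤ.- u ℤ.* x
      l = solve-∀
      r : ∀ M ξ F x u → F ℤ.+ M ℤ.* ξ ℤ.* x ℤ.+ u ℤ.* x ℤ.- M ℤ.* ξ ℤ.* F ℤ.- M ℤ.* ξ ℤ.* x ℤ.- u ℤ.* x ≡ F ℤ.- M ℤ.* ξ ℤ.* F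
      r = solve-∀

-- The witness comes from one Newton step, starting at an inverse a′ of a modulo p.
module _ {p} (p-prime : Prime p) where
  open ModuloPrime p-prime

  root-mod-p² : ∀ a c → ¬ (+ p ∣ᶻ a) → ∃[ ξ ] (+ p ℤ.* + p ∣ᶻ a ℤ.* ξ ℤ.- c)
  root-mod-p² a c p∤a = c ℤ.* (a′ ℤ.* (+ 2 ℤ.- a ℤ.* a′)) , ℤ∣.divides (ℤ.- c ℤ.* (k ℤ.* k))
    (≡.trans (lemma a c a′) (≡.trans (≡.cong (λ z → ℤ.- c ℤ.* ((z ℤ.- 1ℤ) ℤ.* (z ℤ.- 1ℤ))) (equation (proj₂ inv))) (lemma′ c k (+ p))))
    where
    inv = ~-inverse a (p∤a ∘ ~0⇒∣)
    a′ = proj₁ inv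
    k = factor (proj₂ inv)
    lemma : ∀ a c a′ → a ℤ.* (c ℤ.* (a′ ℤ.* (+ 2 ℤ.- a ℤ.* a′))) ℤ.- c ≡ ℤ.- c ℤ.* ((a′ ℤ.* a ℤ.- 1ℤ) ℤ.* (a′ ℤ.* a ℤ.- 1ℤ))
    lemma = solve-∀
    lemma′ : ∀ c k p → ℤ.- c ℤ.* ((1ℤ ℤ.+ k ℤ.* p ℤ.- 1ℤ) ℤ.* (1ℤ ℤ.+ k ℤ.* p ℤ.- 1ℤ)) ≡ ℤ.- c ℤ.* (k ℤ.* k) ℤ.* (p ℤ.* p)
    lemma′ = solve-∀

-- Integral elements with p in the denominator

module Removable (n₀ : ℕ) (m b : ℤ) (f w : Poly) (f-monic : ℤ[x]′.Monic (3 ℕ.+ n₀) f)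
  (f≈ : f ≈ X ^ (3 ℕ.+ n₀) + C b * w)
  (geometric : C (m ℤ.^ 2) * X * w + C 1ℤ ≈ w + (C (m ℤ.^ 2) * X) ^ (3 ℕ.+ n₀))
  (D : ℤ) (spec : 𝒟-numerator (3 ℕ.+ n₀) m b ≡ D ℤ.* 𝒟-denominator (3 ℕ.+ n₀) m b)
  (t≢0 : 1ℤ ℤ.+ b ℤ.* m ℤ.^ (2 ℕ.* (3 ℕ.+ n₀)) ℤ.* + (3 ℕ.+ n₀) ≢ + 0)
  {p : ℕ} (p-prime : Prime p)
  (n-m-coprime : + p ∣ᶻ + (3 ℕ.+ n₀) → ¬ (+ p ∣ᶻ m))
  (b-squarefree : ∀ b′ → b ≡ + p ℤ.* b′ → ¬ (+ p ∣ᶻ b′))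
  (D-squarefree : ¬ (+ p ∣ᶻ b ℤ.* m) → ¬ (+ p ℤ.* + p ∣ᶻ D))
  {α : NumberField.Carrier f} (α-integral : NumberField.IsIntegral f α)
  (s : ℤ) (H : Poly) (H-below : ℤ[x]′.Below (3 ℕ.+ n₀) H)
  (relation : Integral._~_ f f-monic (NumberField._*_ f (NumberField.fromℤ f (+ p ℤ.* s)) α) (toℚ[x] H)) where

  open Trinomial (suc (suc n₀)) m b f w f≈ geometric
  private
    module I = Integral f f-monic
    module K = I.K

    t : ℤ
    t = 1ℤ ℤ.+ u ℤ.* N

    fromℤ : ℤ → NumberField.Carrier f
    fromℤ = NumberField.fromℤ f

  open ModuloPrime p-prime
  private
    module 𝔽 = ModuloPrime.P p-prime
    P = + p

  -- α = r/(s S)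
  as-fraction : ∀ S r → f Zx.∣ H * S - C P * r → α K.* toℚ[x] (C s * S) K.≈ toℚ[x] r
  as-fraction S r f∣ = I.fromℤ-cancel (prime≢0 p-prime) (begin
    fromℤ P K.* (α K.* toℚ[x] (C s * S))             ≈⟨ K.*-congˡ {fromℤ P} (K.*-congˡ {α} (I.toK-* (C s) S)) ⟩
    fromℤ P K.* (α K.* (fromℤ s K.* toℚ[x] S))
      ≈⟨ K.solve 4 (λ p a s x → p K.:* (a K.:* (s K.:* x)) K.:= p K.:* s K.:* a K.:* x) K.refl (fromℤ P) α (fromℤ s) (toℚ[x] S) ⟩
    fromℤ P K.* fromℤ s K.* α K.* toℚ[x] S           ≈⟨ K.*-congʳ {toℚ[x] S} (K.*-congʳ {α} (I.fromℤ-* P s)) ⟨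
    fromℤ (P ℤ.* s) K.* α K.* toℚ[x] S               ≈⟨ K.*-congʳ {toℚ[x] S} relation ⟩
    toℚ[x] H K.* toℚ[x] S                            ≈⟨ I.toK-* H S ⟨
    toℚ[x] (H * S)
      ≈⟨ I.toK-cong (Zx.solve 2 (λ x y → x Zx.:= (x Zx.:- y) Zx.:+ y) Zx.refl (H * S) (C P * r)) ⟩
    toℚ[x] ((H * S - C P * r) + C P * r)             ≈⟨ I.toK-+ (H * S - C P * r) (C P * r) ⟩
    toℚ[x] (H * S - C P * r) K.+ toℚ[x] (C P * r)    ≈⟨ K.+-cong (I.∣⇒toK~0 f∣) (I.toK-* (C P) r) ⟩
    K.0# K.+ fromℤ P K.* toℚ[x] r                    ≈⟨ K.+-identityˡ (fromℤ P K.* toℚ[x] r) ⟩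
    fromℤ P K.* toℚ[x] r                             ∎)
    where open K using (begin_; step-≈-⟩; step-≈-⟨; _∎)

  numerator-integral : ∀ S r → f Zx.∣ H * S - C P * r → ∃₂ λ k v → f Zx.∣ r ^ k + C s * S * v
  numerator-integral S r f∣ = I.integral⇒∣ (C s * S) r (as-fraction S r f∣) α-integral

  module _ (ξ : ℤ) where
    open EvalAt ξ

    ev-∣ : ∀ {g h} → g Zx.∣ h → ev g ∣ᶻ ev h
    ev-∣ {g} {h} (Zx.divides q e) = ℤ∣.divides (ev q) (≡.trans (ev-cong e) (ev-* q g))

    -- A homomorphism ℤ[θ] → 𝔽ₚ killing the denominator of an integral element
    -- kills the numerator.
    numerator-root : ∀ S r → f Zx.∣ H * S - C P * r → P ∣ᶻ ev f → P ∣ᶻ ev S → P ∣ᶻ ev r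
    numerator-root S r f∣ p∣f p∣S = go (numerator-integral S r f∣)
      where
      go : (∃₂ λ k v → f Zx.∣ r ^ k + C s * S * v) → P ∣ᶻ ev r
      go (k , v , f∣rᵏ) = prime-∣^ (ev r) k (ℤ∣.∣-respʳ lemma (ℤ∣.∣-+ (ℤ∣.∣-trans p∣f (ev-∣ f∣rᵏ))
          (ℤ∣.∣-neg (ℤ∣.∣-*ʳ (ev v) (ℤ∣.∣-*ˡ (ev (C s)) p∣S)))))
        where
        cancel : ∀ x y → x ℤ.+ y ℤ.- y ≡ x
        cancel = solve-∀
        lemma : ev (r ^ k + C s * S * v) ℤ.- ev (C s) ℤ.* ev S ℤ.* ev v ≡ ev r ℤ∣.^ k
        lemma = ≡.trans (≡.cong (ℤ._- ev (C s) ℤ.* ev S ℤ.* ev v) (≡.trans (ev-+ (r ^ k) (C s * S * v))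
            (≡.cong₂ ℤ._+_ (ev-^ r k) (≡.trans (ev-* (C s * S) v) (≡.cong (ℤ._* ev v) (ev-* (C s) S))))))
          (cancel (ev r ℤ∣.^ k) (ev (C s) ℤ.* ev S ℤ.* ev v))

  -- Multiplied by θⁱ⁺¹ with j + i + 1 = n, the numerator θʲ h(θ) becomes
  -- −b w(θ) h(θ), which p divides exactly once.
  module Ramified (p∣b : P ∣ᶻ b) {j h} (H≋ : H 𝔽[x].≋ shift j h) (h₀≁0 : ¬ coeff h 0 ~ + 0) where

    private
      b′ = ℤ∣.quotient p∣b
      b≡ : b ≡ P ℤ.* b′
      b≡ = ≡.trans (ℤ∣.equality p∣b) (ℤ.*-comm b′ P)

      j<n : j ℕ.< n
      j<n = ℕ.≰⇒> λ n≤j → h₀≁0 (~-trans (≈⇒~ (≡.trans (≡.sym (𝔽[x].coeff-shift j h 0)) (≡.cong (coeff (shift j h)) (ℕ.+-identityʳ j))))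
        (~-trans (~-sym (𝔽[x].at H≋ j)) (≈⇒~ (H-below j n≤j))))

      i = n ℕ.∸ suc j
      n≡ : n ≡ j ℕ.+ suc i
      n≡ = ≡.trans (≡.sym (ℕ.m+[n∸m]≡n j<n)) (≡.sym (ℕ.+-suc j i))

      lifted = ≋ₖ[]⇒const* (H - shift j h) (𝔽[x].≋-trans (𝔽[x].+ₚ-cong {r = - shift j h} H≋ 𝔽[x].≋-refl) (𝔽[x].negₚ-inverseʳ (shift j h)))
      e = proj₁ lifted

      S = X ^ suc i
      -- From H = xʲ h + p e and xʲ S = xⁿ = f - p b′ w one gets H S = h f + p r.
      r = - (C b′ * (w * h)) + e * S

      f∣ : f Zx.∣ H * S - C P * r
      f∣ = Zx.divides h (begin
        H * S - C P * r
          ≈⟨ Zx.+-congʳ { - (C P * r)} (Zx.*-congʳ {S} (Zx.trans (Zx.solve 2 (λ x y → x Zx.:= y Zx.:+ (x Zx.:- y)) Zx.refl H (shift j h))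
               (Zx.+-cong (ℤ[x]′.shift≋ j h) (proj₂ lifted)))) ⟩
        (X ^ j * h + C P * e) * S - C P * (- (C b′ * (w * h)) + e * S)
          ≈⟨ Zx.solve 7 (λ x h p e s b w → (x Zx.:* h Zx.:+ p Zx.:* e) Zx.:* s Zx.:- p Zx.:* (Zx.:- (b Zx.:* (w Zx.:* h)) Zx.:+ e Zx.:* s)
               Zx.:= h Zx.:* (x Zx.:* s Zx.:+ p Zx.:* b Zx.:* w)) Zx.refl (X ^ j) h (C P) e S (C b′) w ⟩
        h * (X ^ j * X ^ suc i + C P * C b′ * w)
          ≈⟨ Zx.*-congˡ {h} (Zx.+-cong
               (Zx.trans (Zx.sym (Zx.^-homo-* X j (suc i))) (Zx.reflexive (≡.cong (X ^_) (≡.sym n≡))))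
               (Zx.*-congʳ {w} (Zx.trans (Zx.sym (C-* P b′)) (Zx.reflexive (≡.cong C (≡.sym b≡)))))) ⟩
        h * (X ^ n + C b * w)      ≈⟨ Zx.*-congˡ {h} f≈ ⟨
        h * f                      ∎)
        where open import Relation.Binary.Reasoning.Setoid Zx.setoid

      -- Since p divides f(0) = b, θ ↦ 0 defines a homomorphism to 𝔽ₚ. It kills S and, as w(0) = 1,
      -- sends r to -b′ h(0).
      open EvalAt (+ 0)

      p∣S₀ : P ∣ᶻ ev S
      p∣S₀ = ℤ∣.divides (+ 0) (≡.trans (ev₀ S) (coeff-X^ (suc i) 0 (s≤s z≤n)))

      p∣r₀ : P ∣ᶻ ev r
      p∣r₀ = numerator-root (+ 0) S r f∣ (≡.subst (P ∣ᶻ_) (≡.sym (≡.trans (ev₀ f) coeff-f₀)) p∣b) p∣S₀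

      p∣b′h₀ : P ∣ᶻ b′ ℤ.* coeff h 0
      p∣b′h₀ = ℤ∣.∣-respʳ lemma (ℤ∣.∣-+ (ℤ∣.∣-*ˡ (ev e) p∣S₀) (ℤ∣.∣-neg p∣r₀))
        where
        cancel : ∀ b h x → x ℤ.- (ℤ.- (b ℤ.* (1ℤ ℤ.* h)) ℤ.+ x) ≡ b ℤ.* h
        cancel = solve-∀
        lemma : ev e ℤ.* ev S ℤ.- ev r ≡ b′ ℤ.* coeff h 0
        lemma = ≡.trans (≡.cong (λ z → ev e ℤ.* ev S ℤ.- z) (≡.trans (ev-+ (- (C b′ * (w * h))) (e * S)) (≡.cong₂ ℤ._+_
            (≡.trans (ev-neg (C b′ * (w * h))) (≡.cong ℤ.-_ (≡.trans (ev-* (C b′) (w * h)) (≡.cong₂ ℤ._*_ (ev-const b′)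
              (≡.trans (ev-* w h) (≡.cong₂ ℤ._*_ (≡.trans (ev₀ w) coeff-w) (ev₀ h)))))))
            (ev-* e S)))) (cancel b′ (coeff h 0) (ev e ℤ.* ev S))

    impossible : ⊥
    impossible = [ b-squarefree b′ b≡ , h₀≁0 ∘ ∣⇒~0 ]′ (prime-∣* b′ (coeff h 0) p∣b′h₀)

  module Unramified (p∤b : ¬ P ∣ᶻ b) where

    private
      f₀≁0 : ¬ coeff f 0 ~ + 0
      f₀≁0 z = p∤b (≡.subst (P ∣ᶻ_) coeff-f₀ (~0⇒∣ z))

      f-monicₚ : 𝔽[x].Monic n f
      f-monicₚ = ≈⇒~ (proj₁ f-monic) , λ i n<i → ≈⇒~ (proj₂ f-monic i n<i)

      H-belowₚ : 𝔽[x].Below n H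
      H-belowₚ i n≤i = ≈⇒~ (H-below i n≤i)

      ^≡𝔽 : ∀ g k → g ^ k ≡ g 𝔽.^ k
      ^≡𝔽 g zero = ≡.refl
      ^≡𝔽 g (suc k) = ≡.cong (g *_) (^≡𝔽 g k)

      -- The original fraction for α, with numerator H and with p in the place of S; it can be used
      -- at every root of f modulo p.
      CP-f∣ : f Zx.∣ H * C P - C P * H
      CP-f∣ = Zx.divides [] (Zx.solve 2 (λ h p → h Zx.:* p Zx.:- p Zx.:* h Zx.:= Zx.con (+ 0)) Zx.refl H (C P))

      f∣𝐷f*H : f 𝔽.∣ 𝐷 f 𝔽.* H
      f∣𝐷f*H = go (numerator-integral (C P) H CP-f∣)
        where
        go : (∃₂ λ k v → f Zx.∣ H ^ k + C s * C P * v) → f 𝔽.∣ 𝐷 f 𝔽.* H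
        go (k , v , Zx.divides q e) = ∣^⇒∣𝐷* ~-inverse k f H f₀≁0 (𝔽.divides q Hᵏ≋)
          where
          vanishes : C s * C P * v 𝔽.≈ []
          vanishes = 𝔽.trans (≋⇒≋ₖ (Zx.solve 3 (λ s p v → s Zx.:* p Zx.:* v Zx.:= p Zx.:* (s Zx.:* v)) Zx.refl (C s) (C P) v))
            (const*-≋ₖ[] (C s * v))
          Hᵏ≋ : H 𝔽.^ k 𝔽.≈ q 𝔽.* f
          Hᵏ≋ = begin
            H 𝔽.^ k                 ≡⟨ ^≡𝔽 H k ⟨
            H ^ k                   ≈⟨ 𝔽.+-identityʳ (H ^ k) ⟨
            H ^ k + []              ≈⟨ 𝔽.+-congˡ {H ^ k} vanishes ⟨
            H ^ k + C s * C P * v   ≈⟨ ≋⇒≋ₖ e ⟩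
            q * f                   ∎
            where open import Relation.Binary.Reasoning.Setoid 𝔽.setoid

      -- Multiplying f ∣ f′ H by m² x - 1 gives f ∣ xⁿ⁻¹ L H, and the power of x cancels because
      -- f(0) = b is a unit modulo p.
      f∣L*H : f 𝔽.∣ L 𝔽.* H
      f∣L*H = ∣*X^⇒∣ ~-inverse n₁ f (L 𝔽.* H) f₀≁0
        (𝔽.∣-respʳ equation′ (𝔽.∣-+ (𝔽.∣-*ˡ (M² 𝔽.* H) (𝔽.∣-refl {f})) (𝔽.∣-*ˡ (Y 𝔽.- C 1ℤ) f∣𝐷f*H)))
        where
        n₁ = 2 ℕ.+ n₀
        M² = C (m ℤ.^ 2)
        open import Relation.Binary.Reasoning.Setoid 𝔽.setoid
        equation′ : M² 𝔽.* H 𝔽.* f 𝔽.+ (Y 𝔽.- C 1ℤ) 𝔽.* (𝐷 f 𝔽.* H) 𝔽.≈ L 𝔽.* H 𝔽.* X 𝔽.^ n₁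
        equation′ = begin
          M² 𝔽.* H 𝔽.* f 𝔽.+ (Y 𝔽.- C 1ℤ) 𝔽.* (𝐷 f 𝔽.* H)
            ≈⟨ 𝔽.solve 6 (λ m h f y o d → m 𝔽.:* h 𝔽.:* f 𝔽.:+ (y 𝔽.:- o) 𝔽.:* (d 𝔽.:* h) 𝔽.:= (m 𝔽.:* f 𝔽.:+ y 𝔽.:* d) 𝔽.:* h 𝔽.:- o 𝔽.:* d 𝔽.:* h) 𝔽.refl M² H f Y (C 1ℤ) (𝐷 f) ⟩
          (M² 𝔽.* f 𝔽.+ Y 𝔽.* 𝐷 f) 𝔽.* H 𝔽.- C 1ℤ 𝔽.* 𝐷 f 𝔽.* H
            ≈⟨ 𝔽.+-cong (𝔽.*-congʳ {H} (≋⇒≋ₖ derivative)) (𝔽.-‿cong (𝔽.*-congʳ {H} (𝔽.*-identityˡ (𝐷 f)))) ⟩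
          (𝐷 f 𝔽.+ X ^ n₁ 𝔽.* L) 𝔽.* H 𝔽.- 𝐷 f 𝔽.* H
            ≈⟨ 𝔽.solve 4 (λ d x l h → (d 𝔽.:+ x 𝔽.:* l) 𝔽.:* h 𝔽.:- d 𝔽.:* h 𝔽.:= l 𝔽.:* h 𝔽.:* x) 𝔽.refl (𝐷 f) (X ^ n₁) L H ⟩
          L 𝔽.* H 𝔽.* X ^ n₁     ≡⟨ ≡.cong (L 𝔽.* H 𝔽.*_) (^≡𝔽 X n₁) ⟩
          L 𝔽.* H 𝔽.* X 𝔽.^ n₁   ∎

      L₁ : coeff L 1 ≡ a
      L₁ = ≡.trans (ℤ[x]′.coeff-+ (C a * X) (C (ℤ.- c)) 1) (≡.trans (ℤ.+-identityʳ _) (≡.trans (ℤ[x]′.coeff-const* a X 1) (ℤ.*-identityʳ a)))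

    -- L reduces to the unit -c, so f divides H, whose degree is smaller.
    constant-L : P ∣ᶻ a → ¬ P ∣ᶻ c → H 𝔽.≈ []
    constant-L p∣a p∤c = 𝔽[x].Monic-∣-Below f-monicₚ (𝔽.∣-respʳ undo (𝔽.∣-*ˡ (C κ⁻¹) f∣L*H)) H-belowₚ
      where
      κ = ℤ.- c
      inv = ~-inverse κ (λ z → p∤c (≡.subst (P ∣ᶻ_) (ℤ.neg-involutive c) (ℤ∣.∣-neg (~0⇒∣ z))))
      κ⁻¹ = proj₁ inv
      open import Relation.Binary.Reasoning.Setoid 𝔽.setoid
      undo : C κ⁻¹ 𝔽.* (L 𝔽.* H) 𝔽.≈ H
      undo = begin
        C κ⁻¹ 𝔽.* (L 𝔽.* H)
          ≈⟨ 𝔽.*-congˡ {C κ⁻¹} (𝔽.*-congʳ {H} (𝔽.+-congʳ {C κ} (𝔽.*-congʳ {X} (𝔽[x].0∷[] (∣⇒~0 p∣a))))) ⟩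
        C κ⁻¹ 𝔽.* (C κ 𝔽.* H)      ≈⟨ 𝔽.*-assoc (C κ⁻¹) (C κ) H ⟨
        C κ⁻¹ 𝔽.* C κ 𝔽.* H        ≈⟨ 𝔽.*-congʳ {H} (𝔽.trans (𝔽[x].const-* κ⁻¹ (C κ)) (𝔽[x].∷-cong (proj₂ inv) (𝔽[x].≋-refl {[]}))) ⟩
        C 1ℤ 𝔽.* H                 ≈⟨ 𝔽.*-identityˡ H ⟩
        H                          ∎

    -- If p ∣ m, then u ≡ 0 and c ≡ n modulo p, and gcd(n, m) = 1 excludes p ∣ n. If p ∣ n + 1, then
    -- p ∤ n, so p ∣ c would leave p ∣ 1 - u and hence p² ∣ 𝒟.
    c-unit : P ∣ᶻ a → ¬ P ∣ᶻ c
    c-unit p∣a p∣c = [ from-n+1 , (λ d → p∣m-impossible (p∣m d)) ]′ (prime-∣* (N ℤ.+ 1ℤ) (m ℤ.^ 2) p∣a)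
      where
      p∣m : P ∣ᶻ m ℤ.^ 2 → P ∣ᶻ m
      p∣m d = prime-∣^ m 2 d
      cancel₁ : ∀ u → 1ℤ ℤ.- u ℤ.+ u ≡ 1ℤ
      cancel₁ = solve-∀
      cancel₂ : ∀ N → N ℤ.+ 1ℤ ℤ.- N ≡ 1ℤ
      cancel₂ = solve-∀
      p∣m-impossible : P ∣ᶻ m → ⊥
      p∣m-impossible p∣m = [ (λ p∣N → n-m-coprime p∣N p∣m)
        -- The exponent is 2n - 1, in the form to which one unfolding of `m ^ (2 * n)` leads. Thus p
        -- ∣ u, and with p ∣ 1 - u also p ∣ 1.
        , (λ p∣1-u → ∤1 (ℤ∣.∣-respʳ (cancel₁ u) (ℤ∣.∣-+ p∣1-u (ℤ∣.∣-*ˡ b (ℤ∣.∣-*ʳ (m ℤ.^ (2 ℕ.+ (n₀ ℕ.+ 1 ℕ.* n))) p∣m))))) ]′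
        (prime-∣* N (1ℤ ℤ.- u) p∣c)
      from-n+1 : P ∣ᶻ N ℤ.+ 1ℤ → ⊥
      from-n+1 p∣N+1 = [ p∤N , (λ p∣1-u → D-squarefree (λ d → [ p∤b , p∣m-impossible ]′ (prime-∣* b m d))
          (p²∣𝒟 p-prime n₀ u D t≢0 spec p∤N p∣N+1 p∣1-u)) ]′ (prime-∣* N (1ℤ ℤ.- u) p∣c)
        where
        p∤N : ¬ P ∣ᶻ N
        p∤N p∣N = ∤1 (ℤ∣.∣-respʳ (cancel₂ N) (ℤ∣.∣-+ p∣N+1 (ℤ∣.∣-neg p∣N)))

    module LinearFactor (p∤a : ¬ P ∣ᶻ a) where

      private
        q = 𝔽.quotient f∣L*H

        L-below : 𝔽[x].Below 2 L
        L-below (suc (suc i)) _ = ≈⇒~ (≡.trans (ℤ[x]′.coeff-+ (C a * X) (C (ℤ.- c)) (suc (suc i)))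
          (≡.trans (ℤ.+-identityʳ _) (≡.trans (ℤ[x]′.coeff-const* a X (suc (suc i))) (ℤ.*-zeroʳ a))))
        L-below (suc zero) (s≤s ())

        -- L has degree at most 1 and H at most n - 1, so L H has at most the degree of f and the
        -- cofactor is a constant.
        q-below : 𝔽[x].Below 1 q
        q-below = 𝔽[x].Monic-*-Below f q f-monicₚ (𝔽[x].Below-cong {p = L 𝔽.* H} {f 𝔽.* q}
          (𝔽.trans (𝔽.equality f∣L*H) (𝔽.*-comm q f))
          (≡.subst (λ k → 𝔽[x].Below k (L 𝔽.* H)) (≡.sym (ℕ.+-comm n 1)) (𝔽[x].Below-* {1} {suc (suc n₀)} L H L-below H-belowₚ)))

      κ : ℤ
      κ = coeff q 0

      L*H≋ : L 𝔽.* H 𝔽.≈ C κ 𝔽.* f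
      L*H≋ = 𝔽.trans (𝔽.equality f∣L*H) (𝔽.*-congʳ {f} {q} {C κ} (𝔽[x].Below-1 {q} q-below))

      κ~0⇒ : κ ~ + 0 → H 𝔽.≈ []
      κ~0⇒ κ~0 = [ (λ z → ⊥-elim (p∤a (~0⇒∣ (~-trans (≈⇒~ (≡.sym L₁)) (𝔽[x].at z 1))))) , id ]′
        (zero-productₚ L H (𝔽.trans L*H≋ (𝔽.*-congʳ {f} (𝔽[x].0∷[] κ~0))))

      module _ (κ≁0 : ¬ κ ~ + 0) where

        private
          lifted = ≋ₖ[]⇒const* (L * H - C κ * f)
            (𝔽.trans (𝔽.+-congʳ { 𝔽.- (C κ 𝔽.* f)} L*H≋) (𝔽.-‿inverseʳ (C κ 𝔽.* f)))
          r = proj₁ lifted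

          L*H≈ : L * H ≈ C κ * f + C P * r
          L*H≈ = Zx.trans (Zx.solve 2 (λ x y → x Zx.:= y Zx.:+ (x Zx.:- y)) Zx.refl (L * H) (C κ * f))
            (Zx.+-congˡ {C κ * f} (proj₂ lifted))

          -- The second fraction, r/(s L): unlike the integer p, its denominator L can be made
          -- divisible by p² by the choice of ξ.
          f∣ : f Zx.∣ H * L - C P * r
          f∣ = Zx.divides (C κ) (Zx.trans (Zx.+-congʳ { - (C P * r)} (Zx.trans (Zx.*-comm H L) L*H≈))
            (Zx.solve 2 (λ x y → x Zx.:+ y Zx.:- y Zx.:= x) Zx.refl (C κ * f) (C P * r)))

          root = root-mod-p² p-prime a c p∤a
          ξ = proj₁ root
          open EvalAt ξ
          F F′ : ℤ
          F = ev f
          F′ = ev (𝐷 f)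

          evY : ev Y ≡ m ℤ.^ 2 ℤ.* ξ
          evY = ≡.trans (ev-* (C (m ℤ.^ 2)) X) (≡.cong₂ ℤ._*_ (ev-const (m ℤ.^ 2)) ev-X)

          evL : ev L ≡ a ℤ.* ξ ℤ.- c
          evL = ≡.trans (ev-+ (C a * X) (C (ℤ.- c))) (≡.cong₂ ℤ._+_
            (≡.trans (ev-* (C a) X) (≡.cong₂ ℤ._*_ (ev-const a) ev-X)) (ev-const (ℤ.- c)))

          p²∣L : P ℤ.* P ∣ᶻ ev L
          p²∣L = ≡.subst (P ℤ.* P ∣ᶻ_) (≡.sym evL) (proj₂ root)

          P∣P² : P ∣ᶻ P ℤ.* P
          P∣P² = ℤ∣.divides P ≡.refl

          p∣L : P ∣ᶻ ev L
          p∣L = ℤ∣.∣-trans P∣P² p²∣L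

          evC* : ∀ x g → ev (C x * g) ≡ x ℤ.* ev g
          evC* x g = ≡.trans (ev-* (C x) g) (≡.cong (ℤ._* ev g) (ev-const x))

          cancel : ∀ x y → x ℤ.+ y ℤ.- y ≡ x
          cancel = solve-∀

          κF : ev L ℤ.* ev H ℤ.- P ℤ.* ev r ≡ κ ℤ.* F
          κF = ≡.trans (≡.cong (ℤ._- P ℤ.* ev r) (≡.trans (≡.sym (ev-* L H)) (≡.trans (ev-cong L*H≈)
            (≡.trans (ev-+ (C κ * f) (C P * r)) (≡.cong₂ ℤ._+_ (evC* κ f) (evC* P r)))))) (cancel (κ ℤ.* F) (P ℤ.* ev r))

          cancel-κ : ∀ x → P ∣ᶻ κ ℤ.* x → P ∣ᶻ x
          cancel-κ x d = [ (λ z → ⊥-elim (κ≁0 (∣⇒~0 z))) , id ]′ (prime-∣* κ x d)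

          p∣F : P ∣ᶻ F
          p∣F = cancel-κ F (ℤ∣.∣-respʳ κF (ℤ∣.∣-+ (ℤ∣.∣-*ʳ (ev H) p∣L) (ℤ∣.∣-neg (ℤ∣.∣-*ʳ (ev r) ℤ∣.∣-refl))))

          p∣r : P ∣ᶻ ev r
          p∣r = numerator-root ξ L r f∣ p∣F p∣L

          p∣H : P ∣ᶻ ev H
          p∣H = numerator-root ξ (C P) H CP-f∣ p∣F (≡.subst (P ∣ᶻ_) (≡.sym (ev-const P)) ℤ∣.∣-refl)

          -- Both terms of κ f(ξ) = L(ξ) H(ξ) - p r(ξ) are divisible by p²: the first since ξ is a
          -- root of L modulo p², the second since p ∣ r(ξ).
          p²∣F : P ℤ.* P ∣ᶻ F
          p²∣F = prime²-∣-cancel p-prime κ F (κ≁0 ∘ ∣⇒~0)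
            (ℤ∣.∣-respʳ κF (ℤ∣.∣-+ (ℤ∣.∣-*ʳ (ev H) p²∣L) (ℤ∣.∣-neg (p·p∣ p∣r))))
            where
            p·p∣ : ∀ {x} → P ∣ᶻ x → P ℤ.* P ∣ᶻ P ℤ.* x
            p·p∣ (ℤ∣.divides k e) = ℤ∣.divides k (≡.trans (≡.cong (P ℤ.*_) e) (lemma P k))
              where
              lemma : ∀ P k → P ℤ.* (k ℤ.* P) ≡ k ℤ.* (P ℤ.* P)
              lemma = solve-∀

          -- Differentiating L H = κ f + p r gives κ f′ ≡ a H + L H′ modulo p, and both H and L
          -- vanish at ξ.
          p∣F′ : P ∣ᶻ F′
          p∣F′ = cancel-κ F′ (ℤ∣.∣-respʳ κF′ (ℤ∣.∣-+ (ℤ∣.∣-+ (ℤ∣.∣-*ˡ a p∣H) (ℤ∣.∣-*ʳ (ev (𝐷 H)) p∣L))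
            (ℤ∣.∣-neg (ℤ∣.∣-*ʳ (ev (𝐷 r)) ℤ∣.∣-refl))))
            where
            differentiated : C a * H + L * 𝐷 H ≈ C κ * 𝐷 f + C P * 𝐷 r
            differentiated = begin
              C a * H + L * 𝐷 H          ≈⟨ Zx.+-congʳ {L * 𝐷 H} (Zx.*-congʳ {H} 𝐷L) ⟨
              𝐷 L * H + L * 𝐷 H          ≈⟨ ℤ[x]′.𝐷-* L H ⟨
              𝐷 (L * H)                  ≈⟨ ℤ[x]′.𝐷-cong L*H≈ ⟩
              𝐷 (C κ * f + C P * r)      ≈⟨ ℤ[x]′.𝐷-+ (C κ * f) (C P * r) ⟩
              𝐷 (C κ * f) + 𝐷 (C P * r)  ≈⟨ Zx.+-cong (𝐷-C* κ f) (𝐷-C* P r) ⟩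
              C κ * 𝐷 f + C P * 𝐷 r      ∎
              where open import Relation.Binary.Reasoning.Setoid Zx.setoid
            κF′ : a ℤ.* ev H ℤ.+ ev L ℤ.* ev (𝐷 H) ℤ.- P ℤ.* ev (𝐷 r) ≡ κ ℤ.* F′
            κF′ = ≡.trans (≡.cong (ℤ._- P ℤ.* ev (𝐷 r)) (≡.trans
                (≡.sym (≡.trans (ev-+ (C a * H) (L * 𝐷 H)) (≡.cong₂ ℤ._+_ (evC* a H) (ev-* L (𝐷 H)))))
                (≡.trans (ev-cong differentiated) (≡.trans (ev-+ (C κ * 𝐷 f) (C P * 𝐷 r)) (≡.cong₂ ℤ._+_ (evC* κ (𝐷 f)) (evC* P (𝐷 r)))))))
              (cancel (κ ℤ.* F′) (P ℤ.* ev (𝐷 r)))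

          evX^ : ∀ k → ev (X ^ k) ≡ ξ ℤ.^ k
          evX^ k = ≡.trans (ev-^ X k) (≡.trans (^≡ (ev X) k) (≡.cong (ℤ._^ k) ev-X))

          trinomial-ξ : m ℤ.^ 2 ℤ.* ξ ℤ.* F ℤ.+ ξ ℤ.^ n ℤ.+ b ≡ F ℤ.+ m ℤ.^ 2 ℤ.* ξ ℤ.* ξ ℤ.^ n ℤ.+ u ℤ.* ξ ℤ.^ n
          trinomial-ξ = ≡.trans (≡.sym (≡.trans (ev-+ (Y * f + X ^ n) (C b)) (≡.cong₂ ℤ._+_
              (≡.trans (ev-+ (Y * f) (X ^ n)) (≡.cong₂ ℤ._+_ (≡.trans (ev-* Y f) (≡.cong (ℤ._* F) evY)) (evX^ n))) (ev-const b))))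
            (≡.trans (ev-cong trinomial) (≡.trans (ev-+ (f + Y * X ^ n) (C u * X ^ n)) (≡.cong₂ ℤ._+_
              (≡.trans (ev-+ f (Y * X ^ n)) (≡.cong (λ z → F ℤ.+ z) (≡.trans (ev-* Y (X ^ n)) (≡.cong₂ ℤ._*_ evY (evX^ n)))))
              (≡.trans (evC* u (X ^ n)) (≡.cong (u ℤ.*_) (evX^ n))))))

          -- `resultant` is applied modulo p², where ξ is still a root of L.
          p²∣t²D : P ℤ.* P ∣ᶻ t ℤ.^ 2 ℤ.* D
          p²∣t²D = ≡.subst (_∣ᶻ t ℤ.^ 2 ℤ.* D) (ℤ.pos-* p p) (Modulo.~0⇒∣ (p ℕ.* p) (Modulo.~-trans (p ℕ.* p)
            (resultant (p ℕ.* p) n m b ξ F D trinomial-ξ spec aξ~c)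
            (Modulo.∣⇒~0 (p ℕ.* p) (ℤ∣.∣-*ˡ (a ℤ.^ n ℤ.* t) (≡.subst (_∣ᶻ F) (≡.sym (ℤ.pos-* p p)) p²∣F)))))
            where
            aξ~c : Modulo._~_ (p ℕ.* p) (a ℤ.* ξ) c
            aξ~c = Modulo.congruent (ℤ∣.quotient (proj₂ root)) (≡.trans (lemma (a ℤ.* ξ) c)
              (≡.cong (λ z → c ℤ.+ z) (≡.trans (ℤ∣.equality (proj₂ root)) (≡.cong (ℤ∣.quotient (proj₂ root) ℤ.*_) (≡.sym (ℤ.pos-* p p))))))
              where
              lemma : ∀ x c → x ≡ c ℤ.+ (x ℤ.- c)
              lemma = solve-∀

          p∤m : ¬ P ∣ᶻ m
          p∤m d = p∤a (ℤ∣.∣-*ˡ (N ℤ.+ 1ℤ) (ℤ∣.∣-*ʳ (m ℤ.^ 1) d))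

          -- Since L(ξ) - t = (n + 1)(m² ξ - 1) and p ∤ n + 1, p ∣ t would give m² ξ ≡ 1. Then
          -- `derivative²` yields ξⁿ⁻¹ a ≡ 0, although ξ and a are units modulo p.
          p∤t : ¬ P ∣ᶻ t
          p∤t p∣t = [ (λ d → ∤1 (1∈ (prime-∣^ ξ n₁ (≡.subst (P ∣ᶻ_) (≡.sym (^≡ ξ n₁)) d)))) , p∤a ]′ (prime-∣* (ξ ℤ.^ n₁) a p∣ξⁿa)
            where
            n₁ = suc (suc n₀)
            M = m ℤ.^ 2
            p∣Mξ-1 : P ∣ᶻ M ℤ.* ξ ℤ.- 1ℤ
            p∣Mξ-1 = [ (λ d → ⊥-elim (p∤a (ℤ∣.∣-*ʳ M d))) , id ]′ (prime-∣* (N ℤ.+ 1ℤ) (M ℤ.* ξ ℤ.- 1ℤ)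
              (ℤ∣.∣-respʳ (≡.trans (≡.cong (ℤ._- t) evL) (lemma N M ξ u)) (ℤ∣.∣-+ p∣L (ℤ∣.∣-neg p∣t))))
              where
              lemma : ∀ N M ξ u → (N ℤ.+ 1ℤ) ℤ.* M ℤ.* ξ ℤ.- N ℤ.* (1ℤ ℤ.- u) ℤ.- (1ℤ ℤ.+ u ℤ.* N) ≡ (N ℤ.+ 1ℤ) ℤ.* (M ℤ.* ξ ℤ.- 1ℤ)
              lemma = solve-∀
            1∈ : P ∣ᶻ ξ → P ∣ᶻ 1ℤ
            1∈ d = ℤ∣.∣-respʳ (lemma (M ℤ.* ξ)) (ℤ∣.∣-+ (ℤ∣.∣-*ˡ M d) (ℤ∣.∣-neg p∣Mξ-1))
              where
              lemma : ∀ x → x ℤ.- (x ℤ.- 1ℤ) ≡ 1ℤ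
              lemma = solve-∀
            F″ Z : ℤ
            F″ = ev (𝐷 (𝐷 f))
            Z = ev (𝐷 (X ^ n₁))
            derivative²-ξ : M ℤ.* F′ ℤ.+ (M ℤ.* F′ ℤ.+ M ℤ.* ξ ℤ.* F″) ≡ F″ ℤ.+ (Z ℤ.* ev L ℤ.+ ξ ℤ.^ n₁ ℤ.* a)
            derivative²-ξ = ≡.trans (≡.sym (≡.trans (ev-+ (C M * 𝐷 f) (C M * 𝐷 f + Y * 𝐷 (𝐷 f))) (≡.cong₂ ℤ._+_ (evC* M (𝐷 f))
                (≡.trans (ev-+ (C M * 𝐷 f) (Y * 𝐷 (𝐷 f))) (≡.cong₂ ℤ._+_ (evC* M (𝐷 f)) (≡.trans (ev-* Y (𝐷 (𝐷 f))) (≡.cong (ℤ._* F″) evY)))))))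
              (≡.trans (ev-cong derivative²) (≡.trans (ev-+ (𝐷 (𝐷 f)) (𝐷 (X ^ n₁) * L + X ^ n₁ * C a)) (≡.cong (λ z → F″ ℤ.+ z)
                (≡.trans (ev-+ (𝐷 (X ^ n₁) * L) (X ^ n₁ * C a)) (≡.cong₂ ℤ._+_ (ev-* (𝐷 (X ^ n₁)) L)
                  (≡.trans (ev-* (X ^ n₁) (C a)) (≡.cong₂ ℤ._*_ (evX^ n₁) (ev-const a))))))))
            p∣ξⁿa : P ∣ᶻ ξ ℤ.^ n₁ ℤ.* a
            p∣ξⁿa = ℤ∣.∣-respʳ (≡.trans (l M F′ ξ F″ Z (ev L)) (≡.trans (≡.cong (λ z → z ℤ.- F″ ℤ.- Z ℤ.* ev L) derivative²-ξ) (r′ F″ (Z ℤ.* ev L) (ξ ℤ.^ n₁ ℤ.* a))))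
              (ℤ∣.∣-+ (ℤ∣.∣-+ (ℤ∣.∣-*ˡ (M ℤ.+ M) p∣F′) (ℤ∣.∣-*ʳ F″ p∣Mξ-1)) (ℤ∣.∣-neg (ℤ∣.∣-*ˡ Z p∣L)))
              where
              l : ∀ M F′ ξ F″ Z L → (M ℤ.+ M) ℤ.* F′ ℤ.+ (M ℤ.* ξ ℤ.- 1ℤ) ℤ.* F″ ℤ.- Z ℤ.* L ≡ M ℤ.* F′ ℤ.+ (M ℤ.* F′ ℤ.+ M ℤ.* ξ ℤ.* F″) ℤ.- F″ ℤ.- Z ℤ.* L
              l = solve-∀
              r′ : ∀ x y z → x ℤ.+ (y ℤ.+ z) ℤ.- x ℤ.- y ≡ z
              r′ = solve-∀

        simple-impossible : ⊥
        simple-impossible = D-squarefree (λ d → [ p∤b , p∤m ]′ (prime-∣* b m d))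
          (prime²-∣-cancel p-prime (t ℤ.^ 2) D (λ d → p∤t (prime-∣^ t 2 d)) p²∣t²D)

    vanishes : H 𝔽.≈ []
    vanishes = [ (λ p∣a → constant-L p∣a (c-unit p∣a))
               , (λ p∤a → [ LinearFactor.κ~0⇒ p∤a , (λ κ≁0 → ⊥-elim (LinearFactor.simple-impossible p∤a κ≁0)) ]′
                   (toSum (~0? (LinearFactor.κ p∤a))))
               ]′ (toSum (P ∣ᶻ? a))

  removable : H 𝔽[x].≋ []
  removable = [ (λ p∣b → [ id , (λ { (j , h , H≋ , h₀≁0) → ⊥-elim (Ramified.impossible p∣b {j} {h} H≋ h₀≁0) }) ]′ (zero-or-trailing H))
              , Unramified.vanishes ]′ (toSum (P ∣ᶻ? b))

-- The geometric sum and the theorem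

prime-divisor : ∀ k → 2 ℕ.≤ k → ∃[ p ] Prime p × p ℕ.∣ k
prime-divisor (suc k) 2≤k = first factors factorsPrime isFactorisation
  where
  open PrimeFactorisation (factorise (suc k))
  first : ∀ ps → All Prime ps → suc k ≡ product ps → ∃[ p ] Prime p × p ℕ.∣ suc k
  first [] [] e = ⊥-elim (ℕ.<⇒≢ 2≤k (≡.sym e))
  first (p ∷ ps) (p-prime ∷ _) e = p , p-prime , ≡.subst (p ℕ.∣_) (≡.sym e) (ℕ.m∣m*n (product ps))

module GeometricSum (Y : Poly) where

  geometricSum : ℕ → Poly
  geometricSum zero = []
  geometricSum (suc k) = Y ^ k + geometricSum k

  telescope : ∀ k → Y * geometricSum k + C 1ℤ ≈ geometricSum k + Y ^ k
  telescope zero = Zx.+-congʳ {C 1ℤ} (Zx.zeroʳ Y)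
  telescope (suc k) = begin
    Y * (Y ^ k + geometricSum k) + C 1ℤ
      ≈⟨ Zx.solve 4 (λ y z g o → y Zx.:* (z Zx.:+ g) Zx.:+ o Zx.:= (y Zx.:* g Zx.:+ o) Zx.:+ y Zx.:* z) Zx.refl Y (Y ^ k) (geometricSum k) (C 1ℤ) ⟩
    (Y * geometricSum k + C 1ℤ) + Y * Y ^ k    ≈⟨ Zx.+-congʳ {Y * Y ^ k} (telescope k) ⟩
    (geometricSum k + Y ^ k) + Y * Y ^ k       ≈⟨ Zx.+-congʳ {Y * Y ^ k} (Zx.+-comm (geometricSum k) (Y ^ k)) ⟩
    (Y ^ k + geometricSum k) + Y * Y ^ k       ∎
    where open import Relation.Binary.Reasoning.Setoid Zx.setoid

  Below-^ : ℤ[x]′.Below 2 Y → ∀ k → ℤ[x]′.Below (suc k) (Y ^ k)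
  Below-^ z zero = ℤ[x]′.Below-const 1ℤ
  Below-^ z (suc k) = ℤ[x]′.Below-* Y (Y ^ k) z (Below-^ z k)

  Below-geometricSum : ℤ[x]′.Below 2 Y → ∀ k → ℤ[x]′.Below k (geometricSum k)
  Below-geometricSum z zero i _ = ≡.refl
  Below-geometricSum z (suc k) = ℤ[x]′.Below-+ {p = Y ^ k} (Below-^ z k)
    (ℤ[x]′.Below-≤ {p = geometricSum k} (ℕ.n≤1+n k) (Below-geometricSum z k))

module _ (n : ℕ) (m b : ℤ) where

  private
    module Raw = RawSemiringDefinitions (RawRing.rawSemiring ℤ[x].polyRing)
    Y = C (m ℤ.^ 2) * X
  open GeometricSum Y

  private
    ^≡^ : ∀ p k → p Raw.^ k ≡ p ^ k
    ^≡^ p zero = ≡.refl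
    ^≡^ p (suc k) = ≡.cong (p *_) (^≡^ p k)

    -- The exponents fall from k - 1 to 0, which is the order in which `geometricSum` adds its
    -- terms.
    sum≡ : ∀ k → Raw.sum {k} (λ i → Y Raw.^ (k ℕ.∸ suc (toℕ i))) ≡ geometricSum k
    sum≡ zero = ≡.refl
    sum≡ (suc k) = ≡.cong₂ _+_ (^≡^ Y k) (sum≡ k)

  ℱ′ : Poly
  ℱ′ = X ^ n + C b * geometricSum n

  ℱ≡ : ℱ n m b ≡ ℱ′
  ℱ≡ = ≡.cong₂ (λ x y → x + C b * y) (^≡^ X n) (sum≡ n)

  ℱ′-monic : ℤ[x]′.Monic n ℱ′
  ℱ′-monic = ≡.trans (ℤ[x]′.coeff-+ (X ^ n) (C b * g) n) (≡.cong₂ ℤ._+_ (proj₁ (X^-monic n))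
      (≡.trans (ℤ[x]′.coeff-const* b g n) (≡.trans (≡.cong (b ℤ.*_) (g-below n ℕ.≤-refl)) (ℤ.*-zeroʳ b)))) ,
    ℤ[x]′.Below-+ {p = X ^ n} (proj₂ (X^-monic n)) λ i n<i → ≡.trans (ℤ[x]′.coeff-const* b g i)
      (≡.trans (≡.cong (b ℤ.*_) (g-below i (ℕ.<⇒≤ n<i))) (ℤ.*-zeroʳ b))
    where
    g = geometricSum n
    g-below : ℤ[x]′.Below n g
    g-below = Below-geometricSum (ℤ[x]′.Below-* (C (m ℤ.^ 2)) X (ℤ[x]′.Below-const (m ℤ.^ 2)) (ℤ[x]′.Below-cong {p = X ^ 1} (Zx.*-identityʳ X) (proj₂ (X^-monic 1)))) n

corollary1p4 : (n : ℕ) (m b : ℤ) → 3 ℕ.≤ n → 2 ℕ.≤ ∣ m ∣ → (+ 2) ℤ.≤ b →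
    gcd b m ≡ 1ℤ → Squarefree ∣ b ∣ →
    Squarefree (d n m b) →
    gcd (+ n) m ≡ 1ℤ →
    Monogenic (ℱ n m b)
corollary1p4 (suc (suc (suc n₀))) m b (s≤s (s≤s (s≤s z≤n))) _ 2≤b _ b-squarefree d-squarefree n⊥m =
  ≡.subst Monogenic (≡.sym (ℱ≡ n m b)) record
    { degree = n
    ; monic = f-monic
    ; irreducible = irreducible
    ; powerBasis = PowerBasis.isIntegralBasis f f-monic λ α-integral p-prime s H H-below relation →
        Removable.removable n₀ m b f (geometricSum n) f-monic Zx.refl (telescope n) (𝒟 n m b) (𝒟-spec n m b) t≢0
          p-prime (λ p∣n → gcd≡1⇒∤ (+ n) m p-prime n⊥m p∣n) (squarefree p-prime)
          (λ p∤bm → squarefree-quotient (b ℤ.* m) (𝒟 n m b) d-squarefree p-prime p∤bm)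
          α-integral s H H-below relation
    }
  where
  n = suc (suc (suc n₀))
  f = ℱ′ n m b
  f-monic = ℱ′-monic n m b
  open GeometricSum (C (m ℤ.^ 2) * X)

  -- Modulo n this is 1, and n > 1.
  t≢0 : 1ℤ ℤ.+ b ℤ.* m ℤ.^ (2 ℕ.* n) ℤ.* + n ≢ + 0
  t≢0 e = n≢1 (ℕ.∣1⇒≡1 (∣ᶻ⇒∣ {+ n} {1ℤ} (ℤ∣.divides (ℤ.- u)
    (≡.trans (lemma u (+ n)) (≡.trans (≡.cong (λ z → z ℤ.+ ℤ.- u ℤ.* + n) e) (ℤ.+-identityˡ _))))))
    where
    u = b ℤ.* m ℤ.^ (2 ℕ.* n)
    n≢1 : n ≢ 1
    n≢1 ()
    lemma : ∀ u N → 1ℤ ≡ (1ℤ ℤ.+ u ℤ.* N) ℤ.+ ℤ.- u ℤ.* N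
    lemma = solve-∀

  squarefree : ∀ {p} → Prime p → ∀ b′ → b ≡ + p ℤ.* b′ → ¬ (+ p ∣ᶻ b′)
  squarefree {p} p-prime b′ b≡pb′ (ℤ∣.divides q b′≡qp) = ¬prime[1] (≡.subst Prime (b-squarefree p
    (≡.subst (ℕ._∣ ∣ b ∣) (ℤ.abs-* (+ p) (+ p)) (∣ᶻ⇒∣ (ℤ∣.divides q (≡.trans b≡pb′ (≡.trans (≡.cong (+ p ℤ.*_) b′≡qp) (lemma (+ p) q))))))) p-prime)
    where
    lemma : ∀ p q → p ℤ.* (q ℤ.* p) ≡ q ℤ.* (p ℤ.* p)
    lemma = solve-∀

  irreducible : IrreducibleOverℚ f
  irreducible = from (prime-divisor ∣ b ∣ (ℤ.drop‿+≤+ (≡.subst (+ 2 ℤ.≤_) (≡.sym (ℤ.0≤i⇒+∣i∣≡i (ℤ.≤-trans (ℤ.+≤+ z≤n) 2≤b))) 2≤b)))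
    where
    open Trinomial (suc (suc n₀)) m b f (geometricSum n) Zx.refl (telescope n) using (coeff-f; coeff-f₀)
    from : (∃[ p ] Prime p × p ℕ.∣ ∣ b ∣) → IrreducibleOverℚ f
    from (p , p-prime , p∣∣b∣) = Eisenstein.irreducible p-prime f f-monic
      (λ i i<n → ℤ∣.∣-respʳ (≡.sym (≡.trans (coeff-f i) (≡.trans (≡.cong (λ z → z ℤ.+ b ℤ.* coeff (geometricSum n) i) (coeff-X^ n i i<n)) (ℤ.+-identityˡ _))))
        (ℤ∣.∣-*ʳ (coeff (geometricSum n) i) p∣b))
      b′ (≡.trans coeff-f₀ b≡) (squarefree p-prime b′ b≡)
      where
      p∣b : + p ∣ᶻ b
      p∣b = ∣⇒∣ᶻ p∣∣b∣
      b′ = ℤ∣.quotient p∣b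
      b≡ : b ≡ + p ℤ.* b′
      b≡ = ≡.trans (ℤ∣.equality p∣b) (ℤ.*-comm b′ (+ p))
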